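{- Let $N$ be a lattice, let $\sigma\subset N_{\mathbb R}=N\otimes_{\mathbb Z}\mathbb R$ be a strongly convex rational polyhedral cone, let $\Delta$ be a rational simplicial subdivision of $\sigma$, and let $v_1,\ldots,v_s$ be the primitive generators of the rays of $\Delta$. Then, in the quotient field of $\mathbb Z[N]$, \[ (1-x^{v_1})\cdots(1-x^{v_s})\cdot G_\sigma \;=\; H_\Delta+\sum_{\tau\in\Delta^{\mathrm{sing}}}\Bigl(B_\tau\cdot H_{\operatorname{lk}\tau}\cdot\prod_{v_i\notin\operatorname{Star}\tau}(1-x^{v_i})\Bigr). \]
   Context: $\mathbb Z[N]$ is the Laurent polynomial (group) ring of $N$, with monomials $x^v$ for $v\in N$. $G_\sigma=\sum_{v\in\sigma\cap N}x^v$ is the generating function of lattice points of $\sigma$ (a rational function). For a cone $\tau$ we write $v_i\in\tau$ to mean that $v_i$ generates a ray of $\tau$. Define $H_\Delta=\sum_{\tau\in\Delta}\bigl(\prod_{v_i\in\tau}x^{v_i}\cdot\prod_{v_j\notin\tau}(1-x^{v_j})\bigr)$, the sum over all cones of $\Delta$ (including the zero cone). A cone is unimodular if it is spanned by part of a basis of $N$; $\Delta^{\mathrm{sing}}$ is the set of cones of $\Delta$ that are not unimodular. For $\tau\in\Delta$ spanned by $v_1,\ldots,v_r$ (after renumbering), $\operatorname{Box}(\tau)=\{a_1v_1+\cdots+a_rv_r : 0<a_i<1\}$ and $B_\tau=\sum_{v\in\operatorname{Box}(\tau)\cap N}x^v$. The link $\operatorname{lk}\tau$ is the set of cones $\gamma\in\Delta$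 with $\gamma\cap\tau=0$ and $\gamma+\tau\in\Delta$; $v_j\in\operatorname{lk}\tau$ means $v_j$ generates a ray of some cone of $\operatorname{lk}\tau$, and $H_{\operatorname{lk}\tau}=\sum_{\gamma\in\operatorname{lk}\tau}\bigl(\prod_{v_i\in\gamma}x^{v_i}\cdot\prod_{v_j\in\operatorname{lk}\tau,\,v_j\notin\gamma}(1-x^{v_j})\bigr)$. $\operatorname{Star}\tau$ is the union of the maximal cones of $\Delta$ containing $\tau$, and $v_i\notin\operatorname{Star}\tau$ means $v_i$ does not generate a ray of any such cone. -}

module Defs where

import Algebra.Properties.AbelianGroup
open import Data.Bool.Base using (Bool; true; false; _∨_; if_then_else_)
import Data.Bool.Properties as Bool
open import Data.Empty using (⊥-elim) renaming (⊥ to Absurd)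
open import Data.Fin.Base using (Fin)
open import Data.Fin.Subset using (Subset; inside; outside; ⁅_⁆; _∩_; _∪_; _⊆_; Empty) renaming (_∈_ to _∈ₛ_; ∣_∣ to ∣_∣ₛ)
open import Data.Fin.Subset.Properties using (_∈?_; _⊆?_; nonempty?; anySubset?)
open import Data.Integer.Base as ℤ using (ℤ; +_; -[1+_]; 0ℤ; 1ℤ; ∣_∣)
import Data.Integer.DivMod as ℤ
import Data.Integer.Properties as ℤ
open import Data.Integer.Tactic.RingSolver using (solve-∀)
open import Data.List.Base as List using (List; []; _∷_; _++_)
open import Data.List.Membership.Propositional using (_∈_)
import Data.List.Membership.Propositional.Properties as ∈
import Data.List.Membership.DecPropositional as DecMembership
open import Data.List.Relation.Unary.All as All using (All; []; _∷_)
import Data.List.Relation.Unary.All.Properties as All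
open import Data.List.Relation.Unary.AllPairs using ([]; _∷_)
open import Data.List.Relation.Unary.Any using (here)
open import Data.List.Relation.Unary.Unique.Propositional using (Unique)
import Data.List.Relation.Unary.Unique.Propositional.Properties as Unique
open import Data.Nat.Base as ℕ using (ℕ; zero; suc)
open import Data.Nat.Induction using (Acc; acc; <-wellFounded)
import Data.Nat.Properties as ℕ
open import Data.Product using (∃; ∃-syntax; ∃!; _×_; _,_; proj₁; proj₂)
open import Data.Rational.Base as ℚ using (ℚ; 0ℚ; 1ℚ; _/_)
import Data.Rational.Properties as ℚ
open import Data.Rational.Solver using (module +-*-Solver)
import Data.Rational.Unnormalised.Base as ℚᵘ
import Data.Rational.Unnormalised.Properties as ℚᵘ
open import Data.Unit.Base using (⊤; tt)
open import Data.Vec.Base as Vec using (Vec; []; _∷_; lookup)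
import Data.Vec.Properties as Vec
open import Data.Vec.Relation.Unary.All as VAll using ([]; _∷_)
open import Function.Base using (_∘_; id)
open import Function.Bundles using (_⇔_)
open import Level using (0ℓ)
open import Relation.Binary.Definitions using (tri<; tri≈; tri>)
open import Relation.Binary.PropositionalEquality
open import Relation.Nullary.Decidable as Dec using (Dec; yes; no; does; _×-dec_; ¬?)
open import Relation.Nullary.Negation using (¬_)
open import Relation.Unary using (Pred; Decidable)

------------------------------------------------------------------------
-- The lattice and its cones

-- A basis of the lattice is fixed, so N = ℤⁿ.  All cones are rational, and a
-- rational cone is determined by its rational points, so N ⊗ ℝ is replaced by
-- N ⊗ ℚ = ℚⁿ throughout.

N : ℕ → Set
N n = Vec ℤ n

Nℚ : ℕ → Set
Nℚ n = Vec ℚ n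

toℚ : ℤ → ℚ
toℚ z = z / 1

embed : ∀ {n} → N n → Nℚ n
embed = Vec.map toℚ

infixl 6 _⊕_ _⊝_

_⊕_ _⊝_ : ∀ {n} → N n → N n → N n
_⊕_ = Vec.zipWith ℤ._+_
_⊝_ = Vec.zipWith ℤ._-_

0ᴺ : ∀ {n} → N n
0ᴺ = Vec.replicate _ 0ℤ

axpy : ∀ {n} → ℤ → N n → N n → N n
axpy c v w = Vec.map (c ℤ.*_) v ⊕ w

combℤ : ∀ {n k} → Vec ℤ k → Vec (N n) k → N n
combℤ []       []       = 0ᴺ
combℤ (c ∷ cs) (v ∷ vs) = axpy c v (combℤ cs vs)

comb : ∀ {n k} → Vec ℚ k → Vec (N n) k → Nℚ n
comb []       []       = Vec.replicate _ 0ℚ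
comb (a ∷ as) (v ∷ vs) = Vec.zipWith ℚ._+_ (Vec.map (a ℚ.*_) (embed v)) (comb as vs)

-- The cone spanned by v₁, …, vₖ.
pos : ∀ {n k} → Vec (N n) k → Pred (Nℚ n) 0ℓ
pos vs x = ∃[ a ] VAll.All (0ℚ ℚ.≤_) a × comb a vs ≡ x

-- The lattice points of the open parallelepiped spanned by v₁, …, vₖ; for k = 0
-- this is the origin alone.
Box : ∀ {n k} → Vec (N n) k → Pred (N n) 0ℓ
Box vs x = ∃[ a ] VAll.All (λ q → 0ℚ ℚ.< q × q ℚ.< 1ℚ) a × comb a vs ≡ embed x

StronglyConvex : ∀ {n k} → Vec (N n) k → Set
StronglyConvex vs = ∀ x → pos vs x → pos vs (Vec.map ℚ.-_ x) → x ≡ Vec.replicate _ 0ℚ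

LinearlyIndependent : ∀ {n k} → Vec (N n) k → Set
LinearlyIndependent vs = ∀ a → comb a vs ≡ Vec.replicate _ 0ℚ → a ≡ Vec.replicate _ 0ℚ

-- The case v = 0 is excluded by k = 0.
Primitive : ∀ {n} → N n → Set
Primitive v = ∀ (k : ℕ) w → v ≡ Vec.map (+ k ℤ.*_) w → k ≡ 1

IsBasis : ∀ {n k} → Vec (N n) k → Set
IsBasis b = ∀ x → ∃! _≡_ (λ c → combℤ c b ≡ x)

PartOfBasis : ∀ {n k} → Vec (N n) k → Set
PartOfBasis {n} vs = ∃[ m ] ∃ λ (ws : Vec (N n) m) → IsBasis (vs Vec.++ ws)

------------------------------------------------------------------------
-- Decidability of pos, Box and PartOfBasis, and finiteness of Box

module FourierMotzkin where

  open import Data.Rational.Base using (_+_; _*_; -_; _-_; 1/_; _<_; _≤_)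

  _≤[_]_ : ℚ → Bool → ℚ → Set
  p ≤[ true  ] q = p < q
  p ≤[ false ] q = p ≤ q

  _≤[_]?_ : ∀ p s q → Dec (p ≤[ s ] q)
  p ≤[ true  ]? q = p ℚ.<? q
  p ≤[ false ]? q = p ℚ.≤? q

  <⇒≤[] : ∀ s {p q} → p < q → p ≤[ s ] q
  <⇒≤[] true  p<q = p<q
  <⇒≤[] false p<q = ℚ.<⇒≤ p<q

  ≤[]-trans : ∀ s t {p q r} → p ≤[ s ] q → q ≤[ t ] r → p ≤[ s ∨ t ] r
  ≤[]-trans true  true  x y = ℚ.<-trans x y
  ≤[]-trans true  false x y = ℚ.<-≤-trans x y
  ≤[]-trans false true  x y = ℚ.≤-<-trans x y
  ≤[]-trans false false x y = ℚ.≤-trans x y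

  <-≤[]-trans : ∀ t {p q r} → p < q → q ≤[ t ] r → p < r
  <-≤[]-trans t = ≤[]-trans true t

  ≤[]-<-trans : ∀ s {p q r} → p ≤[ s ] q → q < r → p < r
  ≤[]-<-trans true  = ℚ.<-trans
  ≤[]-<-trans false = ℚ.≤-<-trans

  +-mono-≤[] : ∀ s r {p q} → p ≤[ s ] q → (r + p) ≤[ s ] (r + q)
  +-mono-≤[] true  r = ℚ.+-monoʳ-< r
  +-mono-≤[] false r = ℚ.+-monoʳ-≤ r

  0≤q-p⇒p≤q : ∀ s {p q} → 0ℚ ≤[ s ] (q - p) → p ≤[ s ] q
  0≤q-p⇒p≤q s {p} {q} h = subst₂ _≤[ s ]_ (ℚ.+-identityʳ p)
    (solve 2 (λ p q → p :+ (q :+ (:- p)) := q) refl p q) (+-mono-≤[] s p h)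
    where open +-*-Solver

  p≤q⇒0≤q-p : ∀ s {p q} → p ≤[ s ] q → 0ℚ ≤[ s ] (q - p)
  p≤q⇒0≤q-p s {p} {q} h = subst₂ _≤[ s ]_ (ℚ.+-inverseˡ p) (ℚ.+-comm (- p) q) (+-mono-≤[] s (- p) h)

  *-pos : ∀ s d {p} → 0ℚ < d → 0ℚ ≤[ s ] p → 0ℚ ≤[ s ] (d * p)
  *-pos true  d {p} d>0 h = subst (_< d * p) (ℚ.*-zeroʳ d) (ℚ.*-monoʳ-<-pos d {{ℚ.positive d>0}} h)
  *-pos false d {p} d>0 h = subst (_≤ d * p) (ℚ.*-zeroʳ d)
    (ℚ.*-monoˡ-≤-nonNeg d {{ℚ.nonNegative (ℚ.<⇒≤ d>0)}} h)

  *-pos⁻ : ∀ s d {p} → 0ℚ < d → 0ℚ ≤[ s ] (d * p) → 0ℚ ≤[ s ] p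
  *-pos⁻ true  d {p} d>0 h = ℚ.*-cancelˡ-<-nonNeg d {{ℚ.nonNegative (ℚ.<⇒≤ d>0)}} (subst (_< d * p) (sym (ℚ.*-zeroʳ d)) h)
  *-pos⁻ false d {p} d>0 h = ℚ.*-cancelˡ-≤-pos d {{ℚ.positive d>0}} (subst (_≤ d * p) (sym (ℚ.*-zeroʳ d)) h)

  dot : ∀ {k} → Vec ℚ k → Vec ℚ k → ℚ
  dot []       []       = 0ℚ
  dot (c ∷ cs) (a ∷ as) = c * a + dot cs as

  Aff : ℕ → Set
  Aff k = Vec ℚ k × ℚ

  ev : ∀ {k} → Aff k → Vec ℚ k → ℚ
  ev (c , b) a = dot c a + b

  Constraint : ℕ → Set
  Constraint k = Bool × Aff k

  Sat : ∀ {k} → Vec ℚ k → Constraint k → Set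
  Sat a (s , f) = 0ℚ ≤[ s ] ev f a

  scale : ∀ {k} → ℚ → Aff k → Aff k
  scale t (c , b) = Vec.map (t *_) c , t * b

  _⊖_ : ∀ {k} → Aff k → Aff k → Aff k
  (c , b) ⊖ (d , e) = Vec.zipWith _-_ c d , b - e

  dot-scale : ∀ {k} t (c a : Vec ℚ k) → dot (Vec.map (t *_) c) a ≡ t * dot c a
  dot-scale t []      []      = sym (ℚ.*-zeroʳ t)
  dot-scale t (c ∷ cs) (a ∷ as) = trans (cong (λ u → (t * c * a) + u) (dot-scale t cs as))
    (solve 4 (λ t c a r → t :* c :* a :+ t :* r := t :* (c :* a :+ r)) refl t c a (dot cs as))
    where open +-*-Solver

  ev-scale : ∀ {k} t (f : Aff k) a → ev (scale t f) a ≡ t * ev f a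
  ev-scale t (c , b) a = trans (cong (_+ t * b) (dot-scale t c a)) (sym (ℚ.*-distribˡ-+ t _ _))

  dot-⊖ : ∀ {k} (c d a : Vec ℚ k) → dot (Vec.zipWith _-_ c d) a ≡ dot c a - dot d a
  dot-⊖ [] [] [] = refl
  dot-⊖ (c ∷ cs) (d ∷ ds) (a ∷ as) = trans (cong (λ u → ((c - d) * a) + u) (dot-⊖ cs ds as))
    (solve 5 (λ c d a r s → (c :+ (:- d)) :* a :+ (r :+ (:- s)) := (c :* a :+ r) :+ (:- (d :* a :+ s)))
       refl c d a (dot cs as) (dot ds as))
    where open +-*-Solver

  ev-⊖ : ∀ {k} (f g : Aff k) a → ev (f ⊖ g) a ≡ ev f a - ev g a
  ev-⊖ (c , b) (d , e) a = trans (cong (_+ (b - e)) (dot-⊖ c d a))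
    (solve 4 (λ r s b e → (r :+ (:- s)) :+ (b :+ (:- e)) := (r :+ b) :+ (:- (s :+ e))) refl (dot c a) (dot d a) b e)
    where open +-*-Solver

  Lower Upper : ℚ → Bool × ℚ → Set
  Lower x (s , l) = l ≤[ s ] x
  Upper x (s , u) = x ≤[ s ] u


  greatest : (l : Bool × ℚ) (ls : List (Bool × ℚ)) {P : Bool × ℚ → Set} → P l → All P ls →
             ∃[ m ] P m × (∀ x → Lower x m → All (Lower x) (l ∷ ls))
  greatest l [] pl [] = l , pl , λ x h → h ∷ []
  greatest l@(s , p) (l′@(s′ , p′) ∷ ls) pl (pl′ ∷ ps) with ℚ.<-cmp p p′
  ... | tri< p<p′ _ _ = let (m , pm , h) = greatest l′ ls pl′ ps in
    m , pm , λ x k → <⇒≤[] s (<-≤[]-trans s′ p<p′ (All.head (h x k))) ∷ h x k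
  ... | tri> _ _ p′<p = let (m , pm , h) = greatest l ls pl ps in
    m , pm , λ x k → All.head (h x k) ∷ <⇒≤[] s′ (<-≤[]-trans s p′<p (All.head (h x k))) ∷ All.tail (h x k)
  greatest l@(true , p) (l′@(s′ , p) ∷ ls) pl (pl′ ∷ ps) | tri≈ _ refl _ = let (m , pm , h) = greatest l ls pl ps in
    m , pm , λ x k → All.head (h x k) ∷ <⇒≤[] s′ (All.head (h x k)) ∷ All.tail (h x k)
  greatest l@(false , p) (l′@(true , p) ∷ ls) pl (pl′ ∷ ps) | tri≈ _ refl _ = let (m , pm , h) = greatest l′ ls pl′ ps in
    m , pm , λ x k → ℚ.<⇒≤ (All.head (h x k)) ∷ h x k
  greatest l@(false , p) (l′@(false , p) ∷ ls) pl (pl′ ∷ ps) | tri≈ _ refl _ = let (m , pm , h) = greatest l′ ls pl′ ps in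
    m , pm , λ x k → All.head (h x k) ∷ h x k

  least : (l : Bool × ℚ) (ls : List (Bool × ℚ)) {P : Bool × ℚ → Set} → P l → All P ls →
             ∃[ m ] P m × (∀ x → Upper x m → All (Upper x) (l ∷ ls))
  least l [] pl [] = l , pl , λ x h → h ∷ []
  least l@(s , p) (l′@(s′ , p′) ∷ ls) pl (pl′ ∷ ps) with ℚ.<-cmp p′ p
  ... | tri< p′<p _ _ = let (m , pm , h) = least l′ ls pl′ ps in
    m , pm , λ x k → <⇒≤[] s (≤[]-<-trans s′ (All.head (h x k)) p′<p) ∷ h x k
  ... | tri> _ _ p<p′ = let (m , pm , h) = least l ls pl ps in
    m , pm , λ x k → All.head (h x k) ∷ <⇒≤[] s′ (≤[]-<-trans s (All.head (h x k)) p<p′) ∷ All.tail (h x k)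
  least l@(true , p) (l′@(s′ , p) ∷ ls) pl (pl′ ∷ ps) | tri≈ _ refl _ = let (m , pm , h) = least l ls pl ps in
    m , pm , λ x k → All.head (h x k) ∷ <⇒≤[] s′ (All.head (h x k)) ∷ All.tail (h x k)
  least l@(false , p) (l′@(true , p) ∷ ls) pl (pl′ ∷ ps) | tri≈ _ refl _ = let (m , pm , h) = least l′ ls pl′ ps in
    m , pm , λ x k → ℚ.<⇒≤ (All.head (h x k)) ∷ h x k
  least l@(false , p) (l′@(false , p) ∷ ls) pl (pl′ ∷ ps) | tri≈ _ refl _ = let (m , pm , h) = least l′ ls pl′ ps in
    m , pm , λ x k → All.head (h x k) ∷ h x k

  Compat : Bool × ℚ → Bool × ℚ → Set
  Compat (s , l) (t , u) = l ≤[ s ∨ t ] u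

  <-+1 : ∀ p → p < p + 1ℚ
  <-+1 p = subst (_< p + 1ℚ) (ℚ.+-identityʳ p) (ℚ.+-monoʳ-< p (ℚ.positive⁻¹ 1ℚ))

  -1-< : ∀ p → p - 1ℚ < p
  -1-< p = subst (p - 1ℚ <_) (ℚ.+-identityʳ p) (ℚ.+-monoʳ-< p (ℚ.negative⁻¹ (- 1ℚ)))

  between₂ : ∀ l u → Compat l u → ∃[ x ] Lower x l × Upper x u
  between₂ (s , p) (t , q) c with ℚ.<-cmp p q
  ... | tri< p<q _ _ = let (x , p<x , x<q) = ℚ.<-dense p<q in x , <⇒≤[] s p<x , <⇒≤[] t x<q
  between₂ (false , p) (false , .p) c | tri≈ _ refl _ = p , ℚ.≤-refl , ℚ.≤-refl
  between₂ (true  , p) (t     , .p) c | tri≈ _ refl _ = ⊥-elim (ℚ.<-irrefl refl c)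
  between₂ (false , p) (true  , .p) c | tri≈ _ refl _ = ⊥-elim (ℚ.<-irrefl refl c)
  between₂ (s , p) (t , q) c | tri> _ _ q<p = ⊥-elim (ℚ.<-irrefl refl (≤[]-<-trans (s ∨ t) c q<p))

  between : ∀ los ups → All (λ l → All (Compat l) ups) los → ∃[ x ] All (Lower x) los × All (Upper x) ups
  between [] [] _ = 0ℚ , [] , []
  between (l ∷ ls) [] (c ∷ cs) = let ((s , p) , _ , h) = greatest l ls c cs in
    p + 1ℚ , h _ (<⇒≤[] s (<-+1 p)) , []
  between [] (u ∷ us) _ = let ((s , p) , _ , h) = least u us {λ _ → ⊤} tt (All.universal (λ _ → tt) us) in
    p - 1ℚ , [] , h _ (<⇒≤[] s (-1-< p))
  between (l ∷ ls) (u ∷ us) (c ∷ cs) =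
    let (m  , cm , h) = greatest l ls c cs
        (m′ , c′ , k) = least u us (All.head cm) (All.tail cm)
        (x , y , z)   = between₂ m m′ c′
    in x , h x y , k x z

  at : ∀ {k} → Vec ℚ k → Constraint k → Bool × ℚ
  at a (s , f) = s , ev f a

  record Bounds {k} (P : ℚ → Vec ℚ k → Set) : Set where
    field
      los ups rest : List (Constraint k)
      to   : ∀ x a → P x a → All (Lower x ∘ at a) los × All (Upper x ∘ at a) ups × All (Sat a) rest
      from : ∀ x a → All (Lower x ∘ at a) los → All (Upper x ∘ at a) ups → All (Sat a) rest → P x a
  open Bounds

  bound : ∀ {k} (c : Constraint (suc k)) → Bounds (λ x a → Sat (x ∷ a) c)
  bound (s , (c ∷ cs , b)) with ℚ.<-cmp 0ℚ c
  ... | tri< c>0 _ _ = record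
    { los = (s , t) ∷ [] ; ups = [] ; rest = []
    ; to = λ x a h → 0≤q-p⇒p≤q s (*-pos⁻ s c c>0 (subst (0ℚ ≤[ s ]_) (eq x a) h)) ∷ [] , [] , []
    ; from = λ { x a (h ∷ []) _ _ → subst (0ℚ ≤[ s ]_) (sym (eq x a)) (*-pos s c c>0 (p≤q⇒0≤q-p s h)) } }
    where
    instance nz = ℚ.pos⇒nonZero c {{ℚ.positive c>0}}
    t = scale (- (1/ c)) (cs , b)
    eq : ∀ x a → ev (c ∷ cs , b) (x ∷ a) ≡ c * (x - ev t a)
    eq x a = begin
      c * x + dot cs a + b                       ≡⟨ ℚ.+-assoc (c * x) _ _ ⟩
      c * x + r                                  ≡⟨ cong (λ u → (c * x) + u) (ℚ.*-identityˡ r) ⟨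
      c * x + 1ℚ * r                             ≡⟨ cong (λ u → c * x + u * r) (ℚ.*-inverseʳ c) ⟨
      c * x + c * 1/ c * r                       ≡⟨ solve 4 (λ c d x r → c :* x :+ c :* d :* r := c :* (x :+ (:- ((:- d) :* r)))) refl c (1/ c) x r ⟩
      c * (x - (- (1/ c)) * r)                   ≡⟨ cong (λ u → c * (x - u)) (ev-scale (- (1/ c)) (cs , b) a) ⟨
      c * (x - ev t a)                           ∎
      where
      open ≡-Reasoning
      open +-*-Solver
      r = ev (cs , b) a
  ... | tri≈ _ 0≡c _ = record
    { los = [] ; ups = [] ; rest = (s , cs , b) ∷ []
    ; to = λ x a h → [] , [] , subst (0ℚ ≤[ s ]_) (eq x a) h ∷ []
    ; from = λ { x a _ _ (h ∷ []) → subst (0ℚ ≤[ s ]_) (sym (eq x a)) h } }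
    where
    eq : ∀ x a → ev (c ∷ cs , b) (x ∷ a) ≡ ev (cs , b) a
    eq x a = cong (_+ b) (trans (cong (λ u → u * x + dot cs a) (sym 0≡c))
      (trans (cong (_+ dot cs a) (ℚ.*-zeroˡ x)) (ℚ.+-identityˡ (dot cs a))))
  ... | tri> _ _ c<0 = record
    { los = [] ; ups = (s , t) ∷ [] ; rest = []
    ; to = λ x a h → [] , 0≤q-p⇒p≤q s (*-pos⁻ s (- c) -c>0 (subst (0ℚ ≤[ s ]_) (eq x a) h)) ∷ [] , []
    ; from = λ { x a _ (h ∷ []) _ → subst (0ℚ ≤[ s ]_) (sym (eq x a)) (*-pos s (- c) -c>0 (p≤q⇒0≤q-p s h)) } }
    where
    instance nz = ℚ.neg⇒nonZero c {{ℚ.negative c<0}}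
    -c>0 : 0ℚ < - c
    -c>0 = ℚ.neg-antimono-< c<0
    t = scale (- (1/ c)) (cs , b)
    eq : ∀ x a → ev (c ∷ cs , b) (x ∷ a) ≡ (- c) * (ev t a - x)
    eq x a = begin
      c * x + dot cs a + b                       ≡⟨ ℚ.+-assoc (c * x) _ _ ⟩
      c * x + r                                  ≡⟨ cong (λ u → (c * x) + u) (ℚ.*-identityˡ r) ⟨
      c * x + 1ℚ * r                             ≡⟨ cong (λ u → c * x + u * r) (ℚ.*-inverseʳ c) ⟨
      c * x + c * 1/ c * r                       ≡⟨ solve 4 (λ c d x r → c :* x :+ c :* d :* r := (:- c) :* (((:- d) :* r) :+ (:- x))) refl c (1/ c) x r ⟩
      (- c) * ((- (1/ c)) * r - x)               ≡⟨ cong (λ u → (- c) * (u - x)) (ev-scale (- (1/ c)) (cs , b) a) ⟨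
      (- c) * (ev t a - x)                       ∎
      where
      open ≡-Reasoning
      open +-*-Solver
      r = ev (cs , b) a

  bounds : ∀ {k} (cs : List (Constraint (suc k))) → Bounds (λ x a → All (Sat (x ∷ a)) cs)
  bounds [] = record { los = [] ; ups = [] ; rest = [] ; to = λ _ _ _ → [] , [] , [] ; from = λ _ _ _ _ _ → [] }
  bounds (c ∷ cs) = record
    { los = los B ++ los C ; ups = ups B ++ ups C ; rest = rest B ++ rest C
    ; to = λ { x a (h ∷ hs) → let (p , q , r) = to B x a h ; (p′ , q′ , r′) = to C x a hs in
               All.++⁺ p p′ , All.++⁺ q q′ , All.++⁺ r r′ }
    ; from = λ x a p q r → from B x a (All.++⁻ˡ (los B) p) (All.++⁻ˡ (ups B) q) (All.++⁻ˡ (rest B) r)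
               ∷ from C x a (All.++⁻ʳ (los B) p) (All.++⁻ʳ (ups B) q) (All.++⁻ʳ (rest B) r) }
    where
    B = bound c
    C = bounds cs

  combine : ∀ {k} → Constraint k → Constraint k → Constraint k
  combine (s , f) (t , g) = s ∨ t , g ⊖ f

  combine⁻ : ∀ {k} (a : Vec ℚ k) ls us → All (Sat a) (List.cartesianProductWith combine ls us) →
           All (λ l → All (Compat l) (List.map (at a) us)) (List.map (at a) ls)
  combine⁻ a [] us h = []
  combine⁻ a (l@(s , f) ∷ ls) us h =
    All.map⁺ (All.map (λ {(t , g)} k → 0≤q-p⇒p≤q (s ∨ t) (subst (0ℚ ≤[ s ∨ t ]_) (ev-⊖ g f a) k))
      (All.map⁻ (All.++⁻ˡ (List.map (combine l) us) h)))
    ∷ combine⁻ a ls us (All.++⁻ʳ (List.map (combine l) us) h)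

  combine⁺ : ∀ {k} x (a : Vec ℚ k) ls us → All (Lower x ∘ at a) ls → All (Upper x ∘ at a) us →
           All (Sat a) (List.cartesianProductWith combine ls us)
  combine⁺ x a [] us p q = []
  combine⁺ x a (l@(s , f) ∷ ls) us (p ∷ ps) q = All.++⁺
    (All.map⁺ (All.map (λ {(t , g)} k →
      subst (0ℚ ≤[ s ∨ t ]_) (sym (ev-⊖ g f a)) (p≤q⇒0≤q-p (s ∨ t) (≤[]-trans s t p k))) q))
    (combine⁺ x a ls us ps q)

  -- Fourier–Motzkin elimination of the first variable.
  solvable? : ∀ {k} (cs : List (Constraint k)) → Dec (∃[ a ] All (Sat a) cs)
  solvable? {zero} cs = Dec.map′ ([] ,_) (λ { ([] , h) → h }) (All.all? (λ (s , f) → 0ℚ ≤[ s ]? ev f []) cs)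
  solvable? {suc k} cs = Dec.map′
    (λ (a , h) →
      let (x , p , q) = between _ _ (combine⁻ a (los B) (ups B) (All.++⁻ʳ (rest B) h))
      in x ∷ a , from B x a (All.map⁻ p) (All.map⁻ q) (All.++⁻ˡ (rest B) h))
    (λ { (x ∷ a , h) → let (p , q , r) = to B x a h in a , All.++⁺ r (combine⁺ x a _ _ p q) })
    (solvable? (rest B ++ List.cartesianProductWith combine (los B) (ups B)))
    where
    B = bounds cs

  rows : ∀ {n k} → Vec (N n) k → Nℚ n → List (Constraint k)
  rows vs []       = []
  rows vs (x ∷ xs) = (false , c , - x) ∷ (false , scale (- 1ℚ) (c , - x)) ∷ rows (Vec.map Vec.tail vs) xs
    where c = Vec.map (toℚ ∘ Vec.head) vs

  comb-∷ : ∀ {n k} (a : Vec ℚ k) (vs : Vec (N (suc n)) k) →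
           comb a vs ≡ dot (Vec.map (toℚ ∘ Vec.head) vs) a ∷ comb a (Vec.map Vec.tail vs)
  comb-∷ [] [] = refl
  comb-∷ (a ∷ as) ((x ∷ v) ∷ vs) rewrite comb-∷ as vs = cong (λ u → u + _ ∷ _) (ℚ.*-comm a (toℚ x))

  rows⁺ : ∀ {n k} (a : Vec ℚ k) (vs : Vec (N n) k) x → comb a vs ≡ x → All (Sat a) (rows vs x)
  rows⁺ a vs [] h = []
  rows⁺ a vs (x ∷ xs) h with Vec.∷-injective (trans (sym (comb-∷ a vs)) h)
  ... | refl , h′ = ℚ.≤-reflexive (sym eq)
    ∷ ℚ.≤-reflexive (sym (trans (ev-scale (- 1ℚ) (c , - x) a) (trans (cong (- 1ℚ *_) eq) (ℚ.*-zeroʳ (- 1ℚ)))))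
    ∷ rows⁺ a (Vec.map Vec.tail vs) xs h′
    where
    c = Vec.map (toℚ ∘ Vec.head) vs
    eq : dot c a + - dot c a ≡ 0ℚ
    eq = ℚ.+-inverseʳ (dot c a)

  rows⁻ : ∀ {n k} (a : Vec ℚ k) (vs : Vec (N n) k) x → All (Sat a) (rows vs x) → comb a vs ≡ x
  rows⁻ a vs [] _ with comb a vs
  ... | [] = refl
  rows⁻ a vs (x ∷ xs) (p ∷ q ∷ r) = trans (comb-∷ a vs) (cong₂ _∷_
    (ℚ.≤-antisym
      (0≤q-p⇒p≤q false (subst (0ℚ ≤_) (trans (ev-scale (- 1ℚ) (c , - x) a)
        (solve 2 (λ d x → (:- con 1ℚ) :* (d :+ (:- x)) := x :+ (:- d)) refl (dot c a) x)) q))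
      (0≤q-p⇒p≤q false p))
    (rows⁻ a (Vec.map Vec.tail vs) xs r))
    where
    open +-*-Solver
    c = Vec.map (toℚ ∘ Vec.head) vs

  Sat₁ : ℚ → Bool × ℚ × ℚ → Set
  Sat₁ a (s , c , b) = 0ℚ ≤[ s ] (c * a + b)

  first : ∀ {k} → Bool × ℚ × ℚ → Constraint (suc k)
  first (s , c , b) = s , c ∷ Vec.replicate _ 0ℚ , b

  weaken : ∀ {k} → Constraint k → Constraint (suc k)
  weaken (s , c , b) = s , 0ℚ ∷ c , b

  dot-0 : ∀ {k} (a : Vec ℚ k) → dot (Vec.replicate k 0ℚ) a ≡ 0ℚ
  dot-0 []      = refl
  dot-0 (a ∷ as) rewrite dot-0 as | ℚ.*-zeroˡ a = refl

  first-ev : ∀ {k} c b a (as : Vec ℚ k) → ev (c ∷ Vec.replicate k 0ℚ , b) (a ∷ as) ≡ c * a + b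
  first-ev c b a as = cong (_+ b) (trans (cong (λ u → (c * a) + u) (dot-0 as)) (ℚ.+-identityʳ (c * a)))

  weaken-ev : ∀ {k} (c : Vec ℚ k) b a as → ev (0ℚ ∷ c , b) (a ∷ as) ≡ ev (c , b) as
  weaken-ev c b a as = cong (_+ b) (trans (cong (_+ dot c as) (ℚ.*-zeroˡ a)) (ℚ.+-identityˡ (dot c as)))

  each : List (Bool × ℚ × ℚ) → ∀ k → List (Constraint k)
  each ds zero    = []
  each ds (suc k) = List.map first ds ++ List.map weaken (each ds k)

  each⁺ : ∀ ds {k} (a : Vec ℚ k) → VAll.All (λ a → All (Sat₁ a) ds) a → All (Sat a) (each ds k)
  each⁺ ds [] [] = []
  each⁺ ds (a ∷ as) (p ∷ ps) = All.++⁺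
    (All.map⁺ (All.map (λ {(s , c , b)} → subst (0ℚ ≤[ s ]_) (sym (first-ev c b a as))) p))
    (All.map⁺ (All.map (λ {(s , c , b)} → subst (0ℚ ≤[ s ]_) (sym (weaken-ev c b a as))) (each⁺ ds as ps)))

  each⁻ : ∀ ds {k} (a : Vec ℚ k) → All (Sat a) (each ds k) → VAll.All (λ a → All (Sat₁ a) ds) a
  each⁻ ds [] h = []
  each⁻ ds {suc k} (a ∷ as) h =
    All.map (λ {(s , c , b)} → subst (0ℚ ≤[ s ]_) (first-ev c b a as)) (All.map⁻ (All.++⁻ˡ (List.map first ds) h))
    ∷ each⁻ ds as (All.map (λ {(s , c , b)} → subst (0ℚ ≤[ s ]_) (weaken-ev c b a as))
        (All.map⁻ (All.++⁻ʳ (List.map first ds) h)))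

  representable? : ∀ (ds : List (Bool × ℚ × ℚ)) {n k} (vs : Vec (N n) k) x →
                   Dec (∃[ a ] VAll.All (λ q → All (Sat₁ q) ds) a × comb a vs ≡ x)
  representable? ds {k = k} vs x = Dec.map′
    (λ (a , h) → a , each⁻ ds a (All.++⁻ˡ (each ds k) h) , rows⁻ a vs x (All.++⁻ʳ (each ds k) h))
    (λ (a , p , q) → a , All.++⁺ (each⁺ ds a p) (rows⁺ a vs x q))
    (solvable? (each ds k ++ rows vs x))

  pos? : ∀ {n k} (vs : Vec (N n) k) → Decidable (pos vs)
  pos? vs x = Dec.map′
    (λ (a , p , q) → a , VAll.map (λ {a} → λ { (h ∷ []) → subst (0ℚ ≤_) (eq a) h }) p , q)
    (λ (a , p , q) → a , VAll.map (λ {a} h → subst (0ℚ ≤_) (sym (eq a)) h ∷ []) p , q)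
    (representable? ((false , 1ℚ , 0ℚ) ∷ []) vs x)
    where
    eq : ∀ a → 1ℚ * a + 0ℚ ≡ a
    eq a = trans (ℚ.+-identityʳ _) (ℚ.*-identityˡ a)

  Box? : ∀ {n k} (vs : Vec (N n) k) → Decidable (Box vs)
  Box? vs x = Dec.map′
    (λ (a , p , q) → a , VAll.map (λ {a} → λ { (h ∷ k ∷ []) →
        subst (0ℚ <_) (eq a) h , 0≤q-p⇒p≤q true (subst (0ℚ <_) (eq′ a) k) }) p , q)
    (λ (a , p , q) → a , VAll.map (λ {a} (h , k) →
        subst (0ℚ <_) (sym (eq a)) h ∷ subst (0ℚ <_) (sym (eq′ a)) (p≤q⇒0≤q-p true k) ∷ []) p , q)
    (representable? ((true , 1ℚ , 0ℚ) ∷ (true , - 1ℚ , 1ℚ) ∷ []) vs (embed x))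
    where
    eq : ∀ a → 1ℚ * a + 0ℚ ≡ a
    eq a = trans (ℚ.+-identityʳ _) (ℚ.*-identityˡ a)
    eq′ : ∀ a → (- 1ℚ) * a + 1ℚ ≡ 1ℚ - a
    eq′ = solve 1 (λ a → (:- con 1ℚ) :* a :+ con 1ℚ := con 1ℚ :+ (:- a)) refl
      where open +-*-Solver

open FourierMotzkin using (pos?; Box?) public

module BoxPoints where

  open import Data.Rational.Base using (_+_; _*_; _<_; _≤_)
  module ℤGroup = Algebra.Properties.AbelianGroup ℤ.+-0-abelianGroup

  open FourierMotzkin using (dot; comb-∷)

  toℚᵘ-toℚ : ∀ z → ℚ.toℚᵘ (toℚ z) ℚᵘ.≃ ℚᵘ.mkℚᵘ z 0
  toℚᵘ-toℚ z = ℚ.toℚᵘ-fromℚᵘ (ℚᵘ.mkℚᵘ z 0)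

  toℚ-+ : ∀ i j → toℚ i + toℚ j ≡ toℚ (i ℤ.+ j)
  toℚ-+ i j = ℚ.toℚᵘ-injective (ℚᵘ.≃-trans (ℚ.toℚᵘ-homo-+ (toℚ i) (toℚ j))
    (ℚᵘ.≃-trans (ℚᵘ.+-cong (toℚᵘ-toℚ i) (toℚᵘ-toℚ j))
    (ℚᵘ.≃-trans (ℚᵘ.*≡* (cong (ℤ._* + 1) (cong₂ ℤ._+_ (ℤ.*-identityʳ i) (ℤ.*-identityʳ j))))
    (ℚᵘ.≃-sym (toℚᵘ-toℚ (i ℤ.+ j))))))

  toℚ-∣∣ : ∀ z → ℚ.∣ toℚ z ∣ ≡ toℚ (+ ∣ z ∣)
  toℚ-∣∣ z = ℚ.toℚᵘ-injective (ℚᵘ.≃-trans (ℚ.toℚᵘ-homo-∣-∣ (toℚ z))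
    (ℚᵘ.≃-trans (ℚᵘ.∣-∣-cong (toℚᵘ-toℚ z)) (ℚᵘ.≃-sym (toℚᵘ-toℚ (+ ∣ z ∣)))))

  toℚ-cancel-≤ : ∀ i j → toℚ i ≤ toℚ j → i ℤ.≤ j
  toℚ-cancel-≤ i j h = subst₂ ℤ._≤_ (ℤ.*-identityʳ i) (ℤ.*-identityʳ j)
    (ℚᵘ.drop-*≤* (ℚᵘ.≤-respʳ-≃ (toℚᵘ-toℚ j) (ℚᵘ.≤-respˡ-≃ (toℚᵘ-toℚ i) (ℚ.toℚᵘ-mono-≤ h))))

  size : ∀ {n k} → Vec (N (suc n)) k → ℕ
  size = Vec.foldr _ (λ v s → ∣ Vec.head v ∣ ℕ.+ s) 0

  ∣dot∣≤size : ∀ {n k} (a : Vec ℚ k) (vs : Vec (N (suc n)) k) → VAll.All (λ q → 0ℚ < q × q < 1ℚ) a →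
              ℚ.∣ dot (Vec.map (toℚ ∘ Vec.head) vs) a ∣ ≤ toℚ (+ size vs)
  ∣dot∣≤size [] [] [] = ℚ.≤-refl
  ∣dot∣≤size (a ∷ as) ((x ∷ _) ∷ vs) ((p , q) ∷ ps) = begin
    ℚ.∣ toℚ x * a + d ∣                 ≤⟨ ℚ.∣p+q∣≤∣p∣+∣q∣ (toℚ x * a) d ⟩
    ℚ.∣ toℚ x * a ∣ + ℚ.∣ d ∣           ≤⟨ ℚ.+-mono-≤ bound₁ (∣dot∣≤size as vs ps) ⟩
    toℚ (+ ∣ x ∣) + toℚ (+ size vs)     ≡⟨ toℚ-+ (+ ∣ x ∣) (+ size vs) ⟩
    toℚ (+ (∣ x ∣ ℕ.+ size vs))         ∎
    where
    open ℚ.≤-Reasoning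
    d = dot (Vec.map (toℚ ∘ Vec.head) vs) as
    bound₁ : ℚ.∣ toℚ x * a ∣ ≤ toℚ (+ ∣ x ∣)
    bound₁ = begin
      ℚ.∣ toℚ x * a ∣          ≡⟨ ℚ.∣p*q∣≡∣p∣*∣q∣ (toℚ x) a ⟩
      ℚ.∣ toℚ x ∣ * ℚ.∣ a ∣    ≡⟨ cong (ℚ.∣ toℚ x ∣ *_) (ℚ.0≤p⇒∣p∣≡p (ℚ.<⇒≤ p)) ⟩
      ℚ.∣ toℚ x ∣ * a          ≤⟨ ℚ.*-monoˡ-≤-nonNeg ℚ.∣ toℚ x ∣ {{ℚ.∣-∣-nonNeg (toℚ x)}} (ℚ.<⇒≤ q) ⟩
      ℚ.∣ toℚ x ∣ * 1ℚ         ≡⟨ ℚ.*-identityʳ _ ⟩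
      ℚ.∣ toℚ x ∣              ≡⟨ toℚ-∣∣ x ⟩
      toℚ (+ ∣ x ∣)            ∎

  i≤+∣i∣ : ∀ i → i ℤ.≤ + ∣ i ∣
  i≤+∣i∣ (+ n)    = ℤ.≤-refl
  i≤+∣i∣ -[1+ n ] = ℤ.-≤+

  range : ℕ → List ℤ
  range k = List.map (λ i → + i ℤ.- + k) (List.upTo (suc (k ℕ.+ k)))

  ∈-range : ∀ k z → ∣ z ∣ ℕ.≤ k → z ∈ range k
  ∈-range k z h = subst (_∈ range k) eq (∈.∈-map⁺ _ (∈.∈-upTo⁺ (ℕ.s≤s i≤2k)))
    where
    0≤z+k : + 0 ℤ.≤ z ℤ.+ + k
    0≤z+k = subst (ℤ._≤ z ℤ.+ + k) (ℤ.+-inverseʳ z) (ℤ.+-monoʳ-≤ z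
      (ℤ.≤-trans (ℤ.≤-trans (i≤+∣i∣ (ℤ.- z)) (ℤ.≤-reflexive (cong +_ (ℤ.∣-i∣≡∣i∣ z)))) (ℤ.+≤+ h)))
    i = ∣ z ℤ.+ + k ∣
    i≤2k : i ℕ.≤ k ℕ.+ k
    i≤2k = ℕ.≤-trans (ℤ.∣i+j∣≤∣i∣+∣j∣ z (+ k)) (ℕ.+-monoˡ-≤ k h)
    eq : + i ℤ.- + k ≡ z
    eq = trans (cong (ℤ._- + k) (ℤ.0≤i⇒+∣i∣≡i 0≤z+k))
      (trans (ℤ.+-assoc z (+ k) (ℤ.- + k)) (trans (cong (λ u → z ℤ.+ u) (ℤ.+-inverseʳ (+ k))) (ℤ.+-identityʳ z)))

  grid : ∀ {n k} → Vec (N n) k → List (N n)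
  grid {zero}  vs = [] ∷ []
  grid {suc n} vs = List.cartesianProductWith _∷_ (range (size vs)) (grid (Vec.map Vec.tail vs))

  ∈-grid : ∀ {n k} (vs : Vec (N n) k) x → Box vs x → x ∈ grid vs
  ∈-grid {zero}  vs [] _ = here refl
  ∈-grid {suc n} vs (x ∷ xs) (a , p , q) with Vec.∷-injective (trans (sym (comb-∷ a vs)) q)
  ... | h , h′ = ∈.∈-cartesianProductWith⁺ _∷_
    (∈-range _ x (ℤ.drop‿+≤+ (toℚ-cancel-≤ (+ ∣ x ∣) (+ size vs)
      (subst (_≤ toℚ (+ size vs)) (trans (cong ℚ.∣_∣ h) (toℚ-∣∣ x)) (∣dot∣≤size a vs p)))))
    (∈-grid (Vec.map Vec.tail vs) xs (a , p , h′))

  grid! : ∀ {n k} (vs : Vec (N n) k) → Unique (grid vs)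
  grid! {zero}  vs = [] ∷ []
  grid! {suc n} vs = Unique.cartesianProductWith⁺ _∷_ Vec.∷-injective
    (Unique.map⁺ (λ {i} {j} h → ℤ.+-injective (ℤGroup.∙-cancelʳ (ℤ.- + size vs) (+ i) (+ j) h)) (Unique.upTo⁺ (suc (size vs ℕ.+ size vs))))
    (grid! (Vec.map Vec.tail vs))

  boxPoints : ∀ {n k} → Vec (N n) k → List (N n)
  boxPoints vs = List.filter (Box? vs) (grid vs)

  boxPoints-unique : ∀ {n k} (vs : Vec (N n) k) → Unique (boxPoints vs)
  boxPoints-unique vs = Unique.filter⁺ (Box? vs) (grid! vs)

  boxPoints-complete : ∀ {n k} (vs : Vec (N n) k) {x} → Box vs x → x ∈ boxPoints vs
  boxPoints-complete vs b = ∈.∈-filter⁺ (Box? vs) (∈-grid vs _ b) b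

  boxPoints-sound : ∀ {n k} (vs : Vec (N n) k) {x} → x ∈ boxPoints vs → Box vs x
  boxPoints-sound vs h = proj₂ (∈.∈-filter⁻ (Box? vs) {xs = grid vs} h)

open BoxPoints using (boxPoints; boxPoints-unique; boxPoints-complete; boxPoints-sound) public

module Unimodularity where

  open import Data.Integer.Base using (_+_; _*_; -_; _-_)
  open import Data.Integer.DivMod using (_/ℕ_; _%ℕ_; a≡a%ℕn+[a/ℕn]*n; n%ℕd<d)
  open import Data.Vec.Base using (head; tail; map; replicate)

  record Linear {m n} (f : N m → N n) : Set where
    field
      f-0    : f (replicate _ 0ℤ) ≡ replicate _ 0ℤ
      f-axpy : ∀ c v w → f (axpy c v w) ≡ axpy c (f v) (f w)

    f-comb : ∀ {k} c (vs : Vec (N m) k) → f (combℤ c vs) ≡ combℤ c (map f vs)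
    f-comb []       []       = f-0
    f-comb (c ∷ cs) (v ∷ vs) = trans (f-axpy c v _) (cong (axpy c (f v)) (f-comb cs vs))
  open Linear

  record Aut (n : ℕ) : Set where
    field
      f g  : N n → N n
      f∘g  : ∀ x → f (g x) ≡ x
      g∘f  : ∀ x → g (f x) ≡ x
      linear : Linear f

    linear⁻¹ : Linear g
    linear⁻¹ .f-0 = trans (cong g (sym (f-0 linear))) (g∘f _)
    linear⁻¹ .f-axpy c v w = trans (cong g (sym (trans (f-axpy linear c (g v) (g w)) (cong₂ (axpy c) (f∘g v) (f∘g w))))) (g∘f _)
  open Aut

  inv : ∀ {n} → Aut n → Aut n
  inv A = record { f = g A ; g = f A ; f∘g = g∘f A ; g∘f = f∘g A ; linear = linear⁻¹ A }

  _⊙_ : ∀ {n} → Aut n → Aut n → Aut n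
  A ⊙ B = record
    { f = f A ∘ f B ; g = g B ∘ g A
    ; f∘g = λ x → trans (cong (f A) (f∘g B _)) (f∘g A x)
    ; g∘f = λ x → trans (cong (g B) (g∘f A _)) (g∘f B x)
    ; linear = record
      { f-0 = trans (cong (f A) (f-0 (linear B))) (f-0 (linear A))
      ; f-axpy = λ c v w → trans (cong (f A) (f-axpy (linear B) c v w)) (f-axpy (linear A) c _ _) } }

  idA : ∀ {n} → Aut n
  idA = record { f = id ; g = id ; f∘g = λ _ → refl ; g∘f = λ _ → refl
               ; linear = record { f-0 = refl ; f-axpy = λ _ _ _ → refl } }

  lift : ∀ {n} → Aut n → Aut (suc n)
  lift A = record
    { f = λ { (x ∷ t) → x ∷ f A t } ; g = λ { (x ∷ t) → x ∷ g A t }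
    ; f∘g = λ { (x ∷ t) → cong (x ∷_) (f∘g A t) } ; g∘f = λ { (x ∷ t) → cong (x ∷_) (g∘f A t) }
    ; linear = record { f-0 = cong (0ℤ ∷_) (f-0 (linear A))
                      ; f-axpy = λ { c (x ∷ t) (y ∷ u) → cong (c * x + y ∷_) (f-axpy (linear A) c t u) } } }

  negate : ∀ {n} → Aut (suc n)
  negate = record
    { f = ν ; g = ν ; f∘g = νν ; g∘f = νν
    ; linear = record { f-0 = refl ; f-axpy = λ { c (x ∷ t) (y ∷ u) → cong (_∷ axpy c t u) (lem c x y) } } }
    where
    ν : ∀ {n} → N (suc n) → N (suc n)
    ν (x ∷ t) = - x ∷ t
    νν : ∀ {n} (x : N (suc n)) → ν (ν x) ≡ x
    νν (x ∷ t) = cong (_∷ t) (ℤ.neg-involutive x)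
    lem : ∀ c x y → - (c * x + y) ≡ c * (- x) + (- y)
    lem = solve-∀

  swap : ∀ {n} → Aut (2 ℕ.+ n)
  swap = record
    { f = s ; g = s ; f∘g = ss ; g∘f = ss
    ; linear = record { f-0 = refl ; f-axpy = λ { c (x ∷ y ∷ t) (x′ ∷ y′ ∷ u) → refl } } }
    where
    s : ∀ {n} → N (2 ℕ.+ n) → N (2 ℕ.+ n)
    s (x ∷ y ∷ t) = y ∷ x ∷ t
    ss : ∀ {n} (x : N (2 ℕ.+ n)) → s (s x) ≡ x
    ss (x ∷ y ∷ t) = refl

  shear : ∀ {n} → ℤ → Aut (2 ℕ.+ n)
  shear q = record
    { f = σ q ; g = σ (- q)
    ; f∘g = λ { (x ∷ y ∷ t) → cong (_∷ y ∷ t) (inv₁ q x y) }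
    ; g∘f = λ { (x ∷ y ∷ t) → cong (_∷ y ∷ t) (inv₂ q x y) }
    ; linear = record
      { f-0 = cong (λ u → 0ℤ + - u ∷ _) (ℤ.*-zeroʳ q)
      ; f-axpy = λ { c (x ∷ y ∷ t) (x′ ∷ y′ ∷ u) → cong (_∷ axpy c (y ∷ t) (y′ ∷ u)) (lem q c x y x′ y′) } } }
    where
    σ : ∀ {n} → ℤ → N (2 ℕ.+ n) → N (2 ℕ.+ n)
    σ q (x ∷ y ∷ t) = x + - (q * y) ∷ y ∷ t
    inv₁ : ∀ q x y → x + - (- q * y) + - (q * y) ≡ x
    inv₁ = solve-∀
    inv₂ : ∀ q x y → x + - (q * y) + - (- q * y) ≡ x
    inv₂ = solve-∀
    lem : ∀ q c x y x′ y′ → c * x + x′ + - (q * (c * y + y′)) ≡ c * (x + - (q * y)) + (x′ + - (q * y′))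
    lem = solve-∀

  Reduces : ∀ {n} → N (suc n) → Set
  Reduces {n} v = ∃[ d ] ∃[ A ] f A v ≡ + d ∷ replicate n 0ℤ

  normalise : ∀ {n} x → Reduces (x ∷ replicate n 0ℤ)
  normalise (+ d)    = d , idA , refl
  normalise -[1+ d ] = suc d , negate , refl

  after : ∀ {n} (A : Aut (suc n)) {v w} → f A v ≡ w → Reduces w → Reduces v
  after A eq (d , B , h) = d , B ⊙ A , trans (cong (f B) eq) h

  euclid : ∀ {n} x y → Acc ℕ._<_ y → Reduces (x ∷ + y ∷ replicate n 0ℤ)
  euclid x zero     _         = normalise x
  euclid x y@(suc _) (acc rec) = after (swap ⊙ shear (x /ℕ y)) (cong (λ u → + y ∷ u ∷ _) rem)
    (euclid (+ y) (x %ℕ y) (rec (n%ℕd<d x y)))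
    where
    rem : x + - ((x /ℕ y) * + y) ≡ + (x %ℕ y)
    rem = trans (cong (_+ - ((x /ℕ y) * + y)) (a≡a%ℕn+[a/ℕn]*n x y)) (lem (+ (x %ℕ y)) ((x /ℕ y) * + y))
      where
      lem : ∀ a b → a + b + - b ≡ a
      lem = solve-∀

  reduce : ∀ {n} (v : N (suc n)) → Reduces v
  reduce (x ∷ [])        = normalise x
  reduce (x ∷ t@(_ ∷ _)) = let (d , A , h) = reduce t in
    after (lift A) (cong (x ∷_) h) (euclid x d (<-wellFounded d))

  e₁ : ∀ {n} → N (suc n)
  e₁ = 1ℤ ∷ replicate _ 0ℤ

  tail-linear : ∀ {n} → Linear {suc n} tail
  tail-linear = record { f-0 = refl ; f-axpy = λ { c (_ ∷ _) (_ ∷ _) → refl } }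

  axpy-0 : ∀ {n} c (v : N n) → axpy c (replicate n 0ℤ) v ≡ v
  axpy-0 c []      = refl
  axpy-0 c (x ∷ v) = cong₂ _∷_ (trans (cong (_+ x) (ℤ.*-zeroʳ c)) (ℤ.+-identityˡ x)) (axpy-0 c v)

  comb-e₁ : ∀ {n k} c₀ c (b : Vec (N (suc n)) k) →
            combℤ (c₀ ∷ c) (e₁ ∷ b) ≡ c₀ + head (combℤ c b) ∷ combℤ c (map tail b)
  comb-e₁ c₀ c b rewrite sym (f-comb tail-linear c b) with combℤ c b
  ... | x ∷ xs = cong₂ _∷_ (cong (_+ x) (ℤ.*-identityʳ c₀)) (axpy-0 c₀ xs)

  x-h+h : ∀ x h → x - h + h ≡ x
  x-h+h = solve-∀

  extend : ∀ {n k} (b : Vec (N (suc n)) k) → IsBasis (map tail b) → IsBasis (e₁ ∷ b)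
  extend b B (x ∷ xs) with B xs
  ... | c , h , u = x - head (combℤ c b) ∷ c
    , trans (comb-e₁ (x - head (combℤ c b)) c b) (cong₂ _∷_ (x-h+h x (head (combℤ c b))) h)
    , λ { {d₀ ∷ d} k → unique d₀ d (trans (sym (comb-e₁ d₀ d b)) k) }
    where
    unique : ∀ d₀ d → d₀ + head (combℤ d b) ∷ combℤ d (map tail b) ≡ x ∷ xs → x - head (combℤ c b) ∷ c ≡ d₀ ∷ d
    unique d₀ d k with u {d} (Vec.∷-injectiveʳ k)
    ... | refl = cong (_∷ c) (trans (cong (_- head (combℤ c b)) (sym (Vec.∷-injectiveˡ k))) (lem d₀ _))
      where
      lem : ∀ a h → a + h - h ≡ a
      lem = solve-∀

  restrict : ∀ {n k} (b : Vec (N (suc n)) k) → IsBasis (e₁ ∷ b) → IsBasis (map tail b)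
  restrict b B xs with B (0ℤ ∷ xs)
  ... | c₀ ∷ c , h , u = c , Vec.∷-injectiveʳ (trans (sym (comb-e₁ c₀ c b)) h)
    , λ {d} k → Vec.∷-injectiveʳ (u {0ℤ - head (combℤ d b) ∷ d}
        (trans (comb-e₁ (0ℤ - head (combℤ d b)) d b) (cong₂ _∷_ (x-h+h 0ℤ (head (combℤ d b))) k)))

  transport : ∀ {n k} (A : Aut n) (b : Vec (N n) k) → IsBasis b → IsBasis (map (f A) b)
  transport A b B x with B (g A x)
  ... | c , h , u = c , trans (sym (f-comb (linear A) c b)) (trans (cong (f A) h) (f∘g A x))
    , λ {d} k → u (trans (sym (g∘f A _)) (cong (g A) (trans (f-comb (linear A) d b) k)))

  axpy-scale : ∀ {n} d c (v w : N n) → axpy (d * c) v (map (d *_) w) ≡ map (d *_) (axpy c v w)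
  axpy-scale d c []      []      = refl
  axpy-scale d c (x ∷ v) (y ∷ w) = cong₂ _∷_ (lem d c x y) (axpy-scale d c v w)
    where
    lem : ∀ d c x y → d * c * x + d * y ≡ d * (c * x + y)
    lem = solve-∀

  comb-scale : ∀ {n k} d c (b : Vec (N n) k) → combℤ (map (d *_) c) b ≡ map (d *_) (combℤ c b)
  comb-scale {n} d [] [] = sym (trans (Vec.map-replicate (d *_) 0ℤ n) (cong (replicate n) (ℤ.*-zeroʳ d)))
  comb-scale d (c ∷ cs) (v ∷ b) = trans (cong (axpy (d * c) v) (comb-scale d cs b)) (axpy-scale d c v (combℤ cs b))

  axpy-1 : ∀ {n} (v : N n) → axpy 1ℤ v (replicate n 0ℤ) ≡ v
  axpy-1 []      = refl
  axpy-1 (x ∷ v) = cong₂ _∷_ (trans (ℤ.+-identityʳ _) (ℤ.*-identityˡ x)) (axpy-1 v)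

  comb-0 : ∀ {n k} (b : Vec (N n) k) → combℤ (replicate k 0ℤ) b ≡ replicate n 0ℤ
  comb-0 []      = refl
  comb-0 (v ∷ b) = trans (cong (axpy 0ℤ v) (comb-0 b)) (lem v)
    where
    lem : ∀ {n} (v : N n) → axpy 0ℤ v (replicate n 0ℤ) ≡ replicate n 0ℤ
    lem []      = refl
    lem (x ∷ v) = cong (0ℤ ∷_) (lem v)

  leading : ∀ {n k} d (b : Vec (N (suc n)) k) → IsBasis ((+ d ∷ replicate n 0ℤ) ∷ b) → d ≡ 1
  leading {n} {k} d b B with B e₁ | B (+ d ∷ replicate n 0ℤ)
  ... | c₀ ∷ c , h , _ | c′ , _ , u = ℕ.m*n≡1⇒m≡1 d ℤ.∣ c₀ ∣
    (trans (sym (ℤ.abs-* (+ d) c₀)) (cong ℤ.∣_∣ (Vec.∷-injectiveˡ (trans (sym (u {map (+ d *_) (c₀ ∷ c)} scaled)) (u {1ℤ ∷ replicate k 0ℤ} unit)))))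
    where
    D = + d ∷ replicate n 0ℤ
    unit : combℤ (1ℤ ∷ replicate k 0ℤ) (D ∷ b) ≡ D
    unit = trans (cong (axpy 1ℤ D) (comb-0 b)) (axpy-1 D)
    scaled : combℤ (map (+ d *_) (c₀ ∷ c)) (D ∷ b) ≡ D
    scaled = trans (comb-scale (+ d) (c₀ ∷ c) (D ∷ b)) (trans (cong (map (+ d *_)) h)
      (cong₂ _∷_ (ℤ.*-identityʳ (+ d)) (trans (Vec.map-replicate (+ d *_) 0ℤ n) (cong (replicate n) (ℤ.*-zeroʳ (+ d))))))

  map-cancel : ∀ {n} (A : Aut n) {k} (vs : Vec (N n) k) → map (g A) (map (f A) vs) ≡ vs
  map-cancel A vs = trans (sym (Vec.map-∘ (g A) (f A) vs)) (trans (Vec.map-cong (g∘f A) vs) (Vec.map-id vs))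

  partOfBasis[] : ∀ n → PartOfBasis {n} []
  partOfBasis[] zero    = 0 , [] , λ { [] → [] , refl , λ { {[]} _ → refl } }
  partOfBasis[] (suc n) = let (m , ws , B) = partOfBasis[] n in
    suc m , e₁ ∷ map (0ℤ ∷_) ws , extend (map (0ℤ ∷_) ws)
    (subst IsBasis (sym (trans (sym (Vec.map-∘ tail (0ℤ ∷_) ws)) (Vec.map-id ws))) B)

  -- An automorphism of N brings the first vector to d·e₁, d ≥ 0; it can belong to a
  -- basis only if d = 1, and then one passes to the quotient by e₁.
  partOfBasis? : ∀ {n k} (vs : Vec (N n) k) → Dec (PartOfBasis vs)
  partOfBasis? {n} [] = yes (partOfBasis[] n)
  partOfBasis? {zero} ([] ∷ vs) = no λ (m , ws , B) → absurd (vs Vec.++ ws) (B [])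
    where
    absurd : ∀ {k} (b : Vec (N 0) k) → ∃! _≡_ (λ c → combℤ c ([] ∷ b) ≡ []) → Absurd
    absurd {k} b (c , _ , u) with trans (sym (u {0ℤ ∷ replicate k 0ℤ} ([]! _))) (u {1ℤ ∷ replicate k 0ℤ} ([]! _))
      where
      []! : (x : N 0) → x ≡ []
      []! [] = refl
    ... | ()
  partOfBasis? {suc n} (v ∷ vs) with reduce v
  ... | d , A , h with d ℕ.≟ 1
  ... | no d≢1 = no λ (m , ws , B) → d≢1 (leading d _
          (subst (λ u → IsBasis (u ∷ map (f A) (vs Vec.++ ws))) h (transport A _ B)))
  ... | yes refl = Dec.map′ yes′ no′ (partOfBasis? (map tail (map (f A) vs)))
    where
    yes′ : PartOfBasis (map tail (map (f A) vs)) → PartOfBasis (v ∷ vs)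
    yes′ (m , ws , B) = m , map (g A) ws′ , subst IsBasis eq₂ (transport (inv A) _ (extend _ (subst IsBasis eq₁ B)))
      where
      ws′ = map (0ℤ ∷_) ws
      eq₁ : map tail (map (f A) vs) Vec.++ ws ≡ map tail (map (f A) vs Vec.++ ws′)
      eq₁ = sym (trans (Vec.map-++ tail (map (f A) vs) ws′)
        (cong (map tail (map (f A) vs) Vec.++_) (trans (sym (Vec.map-∘ tail (0ℤ ∷_) ws)) (Vec.map-id ws))))
      eq₂ : map (g A) (e₁ ∷ (map (f A) vs Vec.++ ws′)) ≡ v ∷ (vs Vec.++ map (g A) ws′)
      eq₂ = cong₂ _∷_ (trans (cong (g A) (sym h)) (g∘f A v))
        (trans (Vec.map-++ (g A) (map (f A) vs) ws′) (cong (Vec._++ map (g A) ws′) (map-cancel A vs)))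
    no′ : PartOfBasis (v ∷ vs) → PartOfBasis (map tail (map (f A) vs))
    no′ (m , ws , B) = m , map tail (map (f A) ws) , subst IsBasis eq (restrict _
        (subst (λ u → IsBasis (u ∷ map (f A) (vs Vec.++ ws))) h (transport A _ B)))
      where
      eq : map tail (map (f A) (vs Vec.++ ws)) ≡ map tail (map (f A) vs) Vec.++ map tail (map (f A) ws)
      eq = trans (cong (map tail) (Vec.map-++ (f A) vs ws)) (Vec.map-++ tail (map (f A) vs) (map (f A) ws))

open Unimodularity using (partOfBasis?) public

------------------------------------------------------------------------
-- Simplicial fans

select : ∀ {A : Set} {s} (τ : Subset s) → Vec A s → Vec A ∣ τ ∣ₛ
select []            []       = []
select (inside  ∷ τ) (x ∷ xs) = x ∷ select τ xs
select (outside ∷ τ) (x ∷ xs) = select τ xs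

-- v₁, …, vₛ are the primitive generators of the rays.  A simplicial cone is given
-- by the set of indices of its rays: its faces are the cones spanned by subsets of
-- its generators, γ ∩ τ = 0 means that the index sets are disjoint, and γ + τ is
-- spanned by the union of the generators.
record SimplicialFan (n s : ℕ) : Set where
  field
    v     : Vec (N n) s
    cones : List (Subset s)

  gens : (τ : Subset s) → Vec (N n) ∣ τ ∣ₛ
  gens τ = select τ v

  field
    v-primitive  : ∀ i → Primitive (lookup v i)
    v-ray        : ∀ i → ⁅ i ⁆ ∈ cones
    simplicial   : ∀ {τ} → τ ∈ cones → LinearlyIndependent (gens τ)
    face         : ∀ {τ ρ} → τ ∈ cones → ρ ⊆ τ → ρ ∈ cones
    -- any two cones meet in a common face
    intersection : ∀ {τ ρ} → τ ∈ cones → ρ ∈ cones →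
                   ∀ x → pos (gens τ) x → pos (gens ρ) x → pos (gens (τ ∩ ρ)) x

  Unimodular Singular Maximal : Pred (Subset s) 0ℓ
  Unimodular τ = PartOfBasis (gens τ)
  Singular   τ = τ ∈ cones × ¬ Unimodular τ
  Maximal    ρ = ρ ∈ cones × (∀ ρ′ → ρ′ ∈ cones → ρ ⊆ ρ′ → ρ′ ⊆ ρ)

  InLink : Subset s → Pred (Subset s) 0ℓ
  InLink τ γ = γ ∈ cones × Empty (γ ∩ τ) × γ ∪ τ ∈ cones

  RayOfLink RayOfStar : Subset s → Pred (Fin s) 0ℓ
  RayOfLink τ j = ∃[ γ ] InLink τ γ × j ∈ₛ γ
  RayOfStar τ i = ∃[ ρ ] Maximal ρ × τ ⊆ ρ × i ∈ₛ ρ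

  cone? : Decidable (_∈ cones)
  cone? τ = DecMembership._∈?_ (Vec.≡-dec Bool._≟_) τ cones

  singular? : Decidable Singular
  singular? τ = cone? τ ×-dec ¬? (partOfBasis? (gens τ))

  maximal? : Decidable Maximal
  maximal? ρ = cone? ρ ×-dec Dec.map′
    (λ h ρ′ p q → Dec.decidable-stable (ρ′ ⊆? ρ) λ r → h (ρ′ , p , (λ {i} → q {i}) , r))
    (λ h (ρ′ , p , q , r) → r (h ρ′ p q))
    (¬? (anySubset? λ ρ′ → cone? ρ′ ×-dec ρ ⊆? ρ′ ×-dec ¬? (ρ′ ⊆? ρ)))

  inLink? : ∀ τ → Decidable (InLink τ)
  inLink? τ γ = cone? γ ×-dec ¬? (nonempty? (γ ∩ τ)) ×-dec cone? (γ ∪ τ)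

  rayOfLink? : ∀ τ → Decidable (RayOfLink τ)
  rayOfLink? τ j = anySubset? λ γ → inLink? τ γ ×-dec j ∈? γ

  rayOfStar? : ∀ τ → Decidable (RayOfStar τ)
  rayOfStar? τ i = anySubset? λ ρ → maximal? ρ ×-dec τ ⊆? ρ ×-dec i ∈? ρ

_Subdivides_ : ∀ {n m s} → SimplicialFan n s → Vec (N n) m → Set
Δ Subdivides σ = ∀ x → pos σ x ⇔ (∃[ τ ] τ ∈ cones × pos (gens τ) x)
  where open SimplicialFan Δ

------------------------------------------------------------------------
-- The ring ℤ[N], its quotient field and lattice point series

infix 4 _≈_ _≃_
infixl 6 _+ᴸ_
infixl 7 _*ᴸ_ _⊛_ _·_

-- Finite lists of terms c·xᵛ; repeated exponents are allowed, and equality is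
-- equality of coefficients.
Laurent : ℕ → Set
Laurent n = List (ℤ × N n)

Series : ℕ → Set
Series n = N n → ℤ

coeff : ∀ {n} → Laurent n → Series n
coeff []            w = 0ℤ
coeff ((c , u) ∷ p) w = (if does (Vec.≡-dec ℤ._≟_ u w) then c else 0ℤ) ℤ.+ coeff p w

_≈_ : ∀ {n} → Laurent n → Laurent n → Set
p ≈ q = ∀ w → coeff p w ≡ coeff q w

x^_ : ∀ {n} → N n → Laurent n
x^ u = (1ℤ , u) ∷ []

0ᴸ 1ᴸ : ∀ {n} → Laurent n
0ᴸ = []
1ᴸ = x^ 0ᴺ

_+ᴸ_ _*ᴸ_ : ∀ {n} → Laurent n → Laurent n → Laurent n
p +ᴸ q = p ++ q
p *ᴸ q = List.cartesianProductWith (λ (c , u) (d , w) → c ℤ.* d , u ⊕ w) p q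

1-x^_ : ∀ {n} → N n → Laurent n
1-x^ u = (1ℤ , 0ᴺ) ∷ (ℤ.- 1ℤ , u) ∷ []

-- ℤ[N] acts on formal series with arbitrary support by multiplication.
_⊛_ : ∀ {n} → Laurent n → Series n → Series n
([]            ⊛ S) w = 0ℤ
(((c , u) ∷ p) ⊛ S) w = c ℤ.* S (w ⊝ u) ℤ.+ (p ⊛ S) w

record Fraction (n : ℕ) : Set where
  constructor _over_[_]
  field
    num den : Laurent n
    den≉0   : ¬ den ≈ 0ᴸ
open Fraction public

_≃_ : ∀ {n} → Fraction n → Fraction n → Set
F ≃ G = num F *ᴸ den G ≈ num G *ᴸ den F

1≉0 : ∀ {n} → ¬ 1ᴸ {n} ≈ 0ᴸ
1≉0 {n} h with Vec.≡-dec ℤ._≟_ (0ᴺ {n}) 0ᴺ | h 0ᴺ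
... | yes _ | ()
... | no ≢  | _ = ≢ refl

ι : ∀ {n} → Laurent n → Fraction n
ι p = p over 1ᴸ [ 1≉0 ]

_·_ : ∀ {n} → Laurent n → Fraction n → Fraction n
p · (a over b [ b≉0 ]) = (p *ᴸ a) over b [ b≉0 ]

latticePoints : ∀ {n m} → Vec (N n) m → Series n
latticePoints σ w = if does (pos? σ (embed w)) then 1ℤ else 0ℤ

-- The fraction a / b is the rational function Σ xᵛ, v ∈ σ ∩ N: multiplying the
-- series by b gives a.
_IsGeneratingFunctionOf_ : ∀ {n m} → Fraction n → Vec (N n) m → Set
G IsGeneratingFunctionOf σ = ∀ w → (den G ⊛ latticePoints σ) w ≡ coeff (num G) w

------------------------------------------------------------------------
-- The polynomials of the formula

subsets : ∀ s → List (Subset s)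
subsets zero    = [] ∷ []
subsets (suc s) = List.map (outside ∷_) (subsets s) ++ List.map (inside ∷_) (subsets s)

∑ : ∀ {n s} {P : Pred (Subset s) 0ℓ} → Decidable P → (Subset s → Laurent n) → Laurent n
∑ P? f = List.foldr (λ τ p → f τ +ᴸ p) 0ᴸ (List.filter P? (subsets _))

∏ : ∀ {n s} {P : Pred (Fin s) 0ℓ} → Decidable P → (Fin s → Laurent n) → Laurent n
∏ P? f = List.foldr (λ i p → f i *ᴸ p) 1ᴸ (List.filter P? (List.allFin _))

module _ {n s : ℕ} (Δ : SimplicialFan n s) where

  open SimplicialFan Δ

  B : Subset s → Laurent n
  B τ = List.map (1ℤ ,_) (boxPoints (gens τ))

  HΔ : Laurent n
  HΔ = ∑ cone? λ τ →
    ∏ (_∈? τ) (λ i → x^ lookup v i) *ᴸ ∏ (λ j → ¬? (j ∈? τ)) (λ j → 1-x^ lookup v j)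

  Hlk : Subset s → Laurent n
  Hlk τ = ∑ (inLink? τ) λ γ →
    ∏ (_∈? γ) (λ i → x^ lookup v i) *ᴸ
    ∏ (λ j → rayOfLink? τ j ×-dec ¬? (j ∈? γ)) (λ j → 1-x^ lookup v j)

{-# OPTIONS --safe #-}
module Submission where

-- The lattice points of σ are partitioned by the relative interiors of the cones of
-- Δ.  Multiplying the lattice points with positive i-th coordinate by 1 - x^vᵢ leaves
-- those whose coordinate lies in (0, 1], that is, in (0, 1) or at 1; doing this for
-- every generator of τ gives
--   ∏_{i ∈ τ} (1 - x^vᵢ) · ∑_{w ∈ relint τ} xʷ = ∑_{ρ ⊆ τ} B_ρ · ∏_{i ∈ τ ∖ ρ} x^vᵢ.
-- Multiply by the remaining factors, sum over τ ∈ Δ and collect the terms of B_ρ.  For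
-- ρ = 0 they give H_Δ; for ρ ≠ 0 unimodular B_ρ = 0; otherwise γ = τ ∖ ρ runs through
-- lk ρ, and an index outside τ is either a ray of lk ρ outside γ or lies outside Star ρ.

open import Defs
open import Algebra.Bundles using (CommutativeMonoid)
import Algebra.Properties.AbelianGroup
import Algebra.Properties.CommutativeSemigroup
open import Data.Bool.Base using (Bool; true; false; if_then_else_)
import Data.Bool.Properties as Bool
open import Data.Fin.Base using (Fin; zero; suc)
open import Data.Fin.Properties using () renaming (_≟_ to _≟ᶠ_)
open import Data.Fin.Subset using (Subset; inside; outside; ⊥; ⁅_⁆; _⊆_; _⊃_; _∩_; _∪_; Empty) renaming (_∈_ to _∈ₛ_; _∉_ to _∉ₛ_; ∣_∣ to ∣_∣ₛ)
open import Data.Fin.Subset.Induction using (⊃-wellFounded; Acc; acc)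
open import Data.Fin.Subset.Properties
open import Data.Integer.Base as ℤ using (ℤ; 0ℤ; 1ℤ; _+_; _*_; -_; _-_; ≢-nonZero)
import Data.Integer.Properties as ℤ
open import Data.Integer.Tactic.RingSolver using (solve-∀)
open import Data.List.Base as List using (List; []; _∷_; _++_)
open import Data.List.Membership.Propositional using (_∈_; _∉_)
open import Data.List.Membership.Propositional.Properties using (finite)
open import Data.List.Relation.Unary.All as All using (All; []; _∷_)
import Data.List.Relation.Unary.All.Properties as All
open import Data.List.Relation.Unary.AllPairs using ([]; _∷_)
open import Data.List.Relation.Unary.Any using (here; there)
open import Data.List.Relation.Unary.Unique.Propositional using (Unique)
open import Data.Nat.Base as ℕ using (ℕ; zero; suc)
import Data.Nat.Properties as ℕ
open import Data.Product using (∃; ∃!; ∃-syntax; _×_; _,_; proj₁; proj₂)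
open import Data.Rational.Base as ℚ using (ℚ; 0ℚ; 1ℚ; _<_; _≤_; ↥_; ↧_)
import Data.Rational.Properties as ℚ
open import Data.Rational.Solver using (module +-*-Solver)
import Data.Rational.Unnormalised.Base as ℚᵘ
import Data.Rational.Unnormalised.Properties as ℚᵘ
open import Data.Sum.Base using ([_,_]′)
open import Data.Vec.Base as Vec using (Vec; []; _∷_; here; there; lookup; map; zipWith; replicate; _[_]%=_; _[_]≔_)
import Data.Vec.Properties as Vec
open import Data.Vec.Relation.Unary.All as VAll using ([]; _∷_)
open import Function.Base using (_∘_)
open import Function.Bundles using (mk↣; module Equivalence)
open import Level using (0ℓ)
open import Relation.Binary.Definitions using (tri<; tri≈; tri>)
open import Relation.Binary.PropositionalEquality hiding ([_])
open import Relation.Nullary.Decidable as Dec using (Dec; yes; no; does; ¬?; _×-dec_; dec-true; dec-false; decidable-stable)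
open import Relation.Nullary.Negation using (¬_; contradiction)
open import Relation.Unary using (Pred; Decidable)
open import Relation.Unary.Properties using (U?)
open ≡-Reasoning

private
  variable
    k n s : ℕ

-- Series with arbitrary support form a module over ℤ[N] with torsion: `1-x^ u` kills the
-- bi-infinite sum of all integer powers of `x^ u`. Hence a polynomial cannot be cancelled from its
-- product with a series, and the argument never tries to. If `b ⊛ S` is `a` and `P ⊛ S` is `R`,
-- then `P ⊛ a` and `b ⊛ R` both arise by letting `P` and `b` act on `S`, and the order of the two
-- actions is irrelevant; this is the identity with denominators cleared. Cancellation is needed
-- only inside ℤ[N], to know that the product of the `1 - x^vᵢ` is an admissible denominator.
--
-- The generators of all rays together are in general linearly dependent, so a point has no
-- coordinates with respect to `v` alone. A point is described by a coefficient vector of full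
-- length `s` that vanishes off some cone, and each uniqueness argument takes place inside such a
-- cone. Vectors belonging to different cones can then be compared directly.

indicator : ∀ {P : Set} → Dec P → ℤ
indicator P? = if does P? then 1ℤ else 0ℤ

indicator-true : ∀ {P : Set} (P? : Dec P) → P → indicator P? ≡ 1ℤ
indicator-true P? p = cong (if_then 1ℤ else 0ℤ) (dec-true P? p)

indicator-false : ∀ {P : Set} (P? : Dec P) → ¬ P → indicator P? ≡ 0ℤ
indicator-false P? ¬p = cong (if_then 1ℤ else 0ℤ) (dec-false P? ¬p)

-- The action of ℤ[N] on series

⊕-comm : (u w : N n) → u ⊕ w ≡ w ⊕ u
⊕-comm = Vec.zipWith-comm ℤ.+-comm

⊝-⊕ : (w u t : N n) → w ⊝ u ⊝ t ≡ w ⊝ (u ⊕ t)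
⊝-⊕ []      []      []      = refl
⊝-⊕ (x ∷ w) (y ∷ u) (z ∷ t) = cong₂ _∷_ (lem x y z) (⊝-⊕ w u t)
  where
  lem : ∀ x y z → x - y - z ≡ x - (y + z)
  lem = solve-∀

⊝-comm : (w u t : N n) → w ⊝ u ⊝ t ≡ w ⊝ t ⊝ u
⊝-comm w u t = trans (⊝-⊕ w u t) (trans (cong (w ⊝_) (⊕-comm u t)) (sym (⊝-⊕ w t u)))

⊝-identityʳ : (w : N n) → w ⊝ 0ᴺ ≡ w
⊝-identityʳ []      = refl
⊝-identityʳ (x ∷ w) = cong₂ _∷_ (ℤ.+-identityʳ x) (⊝-identityʳ w)

⊝-self : (w : N n) → w ⊝ w ≡ 0ᴺ
⊝-self []      = refl
⊝-self (x ∷ w) = cong₂ _∷_ (ℤ.+-inverseʳ x) (⊝-self w)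

⊝≡0⇒≡ : (w u : N n) → 0ᴺ ≡ w ⊝ u → u ≡ w
⊝≡0⇒≡ []      []      _ = refl
⊝≡0⇒≡ (x ∷ w) (y ∷ u) h = cong₂ _∷_
  (sym (ℤ.i-j≡0⇒i≡j x y (sym (Vec.∷-injectiveˡ h)))) (⊝≡0⇒≡ w u (Vec.∷-injectiveʳ h))

-- As `p ⊛ δ` is `coeff p`, any identity between actions becomes an identity between coefficients
-- when evaluated here.
δ : Series n
δ = coeff 1ᴸ

⊛-cong : ∀ (p : Laurent n) {S T : Series n} → S ≗ T → p ⊛ S ≗ p ⊛ T
⊛-cong []            S≗T w = refl
⊛-cong ((c , u) ∷ p) S≗T w = cong₂ _+_ (cong (c *_) (S≗T (w ⊝ u))) (⊛-cong p S≗T w)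

⊛-+ : ∀ (p : Laurent n) (S T : Series n) w → (p ⊛ λ u → S u + T u) w ≡ (p ⊛ S) w + (p ⊛ T) w
⊛-+ []            S T w = refl
⊛-+ ((c , u) ∷ p) S T w = trans (cong (c * (S (w ⊝ u) + T (w ⊝ u)) +_) (⊛-+ p S T w))
  (lem c (S (w ⊝ u)) (T (w ⊝ u)) ((p ⊛ S) w) ((p ⊛ T) w))
  where
  lem : ∀ c x y a b → c * (x + y) + (a + b) ≡ (c * x + a) + (c * y + b)
  lem = solve-∀

⊛-0 : ∀ (p : Laurent n) w → (p ⊛ λ _ → 0ℤ) w ≡ 0ℤ
⊛-0 []            w = refl
⊛-0 ((c , u) ∷ p) w = cong₂ _+_ (ℤ.*-zeroʳ c) (⊛-0 p w)

⊛-monomial : ∀ (p : Laurent n) c u (S : Series n) w → (p ⊛ λ t → c * S (t ⊝ u)) w ≡ c * (p ⊛ S) (w ⊝ u)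
⊛-monomial []            c u S w = sym (ℤ.*-zeroʳ c)
⊛-monomial ((d , t) ∷ p) c u S w = trans
  (cong₂ (λ x y → d * (c * S x) + y) (⊝-comm w t u) (⊛-monomial p c u S w))
  (lem c d (S (w ⊝ u ⊝ t)) ((p ⊛ S) (w ⊝ u)))
  where
  lem : ∀ c d x y → d * (c * x) + c * y ≡ c * (d * x + y)
  lem = solve-∀

-- Each monomial acts by a scaled translation, and translations commute. The induction peels
-- monomials off `q` and moves them past `p`.
⊛-comm : ∀ (p q : Laurent n) S → p ⊛ (q ⊛ S) ≗ q ⊛ (p ⊛ S)
⊛-comm p []            S w = ⊛-0 p w
⊛-comm p ((c , u) ∷ q) S w = trans (⊛-+ p (λ t → c * S (t ⊝ u)) (q ⊛ S) w)
  (cong₂ _+_ (⊛-monomial p c u S w) (⊛-comm p q S w))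

+ᴸ-⊛ : ∀ (p q : Laurent n) S w → ((p +ᴸ q) ⊛ S) w ≡ (p ⊛ S) w + (q ⊛ S) w
+ᴸ-⊛ []            q S w = sym (ℤ.+-identityˡ _)
+ᴸ-⊛ ((c , u) ∷ p) q S w = trans (cong (c * S (w ⊝ u) +_) (+ᴸ-⊛ p q S w)) (sym (ℤ.+-assoc (c * S (w ⊝ u)) ((p ⊛ S) w) ((q ⊛ S) w)))

*ᴸ-⊛ : ∀ (p q : Laurent n) S → (p *ᴸ q) ⊛ S ≗ p ⊛ (q ⊛ S)
*ᴸ-⊛ []            q S w = refl
*ᴸ-⊛ ((c , u) ∷ p) q S w = trans (+ᴸ-⊛ (List.map _ q) (p *ᴸ q) S w)
  (cong₂ _+_ (monomial q) (*ᴸ-⊛ p q S w))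
  where
  lem : ∀ c d x y → c * d * x + c * y ≡ c * (d * x + y)
  lem = solve-∀
  monomial : ∀ q → (List.map (λ (d , t) → c * d , u ⊕ t) q ⊛ S) w ≡ c * (q ⊛ S) (w ⊝ u)
  monomial []            = sym (ℤ.*-zeroʳ c)
  monomial ((d , t) ∷ q) = trans (cong₂ (λ x y → c * d * S x + y) (sym (⊝-⊕ w u t)) (monomial q))
    (lem c d (S (w ⊝ u ⊝ t)) ((q ⊛ S) (w ⊝ u)))

x^-⊛ : ∀ (u : N n) S w → (x^ u ⊛ S) w ≡ S (w ⊝ u)
x^-⊛ u S w = trans (ℤ.+-identityʳ _) (ℤ.*-identityˡ _)

1ᴸ-⊛ : ∀ (S : Series n) → 1ᴸ ⊛ S ≗ S
1ᴸ-⊛ S w = trans (x^-⊛ 0ᴺ S w) (cong S (⊝-identityʳ w))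

1-x^-⊛ : ∀ (u : N n) S w → (1-x^ u ⊛ S) w ≡ S w - S (w ⊝ u)
1-x^-⊛ u S w = trans (lem (S (w ⊝ 0ᴺ)) (S (w ⊝ u))) (cong (λ t → S t - S (w ⊝ u)) (⊝-identityʳ w))
  where
  lem : ∀ x y → 1ℤ * x + (- 1ℤ * y + 0ℤ) ≡ x - y
  lem = solve-∀

coeff-⊛ : ∀ (p : Laurent n) → coeff p ≗ p ⊛ δ
coeff-⊛ []            w = refl
coeff-⊛ ((c , u) ∷ p) w = cong₂ _+_ term (coeff-⊛ p w)
  where
  term : (if does (Vec.≡-dec ℤ._≟_ u w) then c else 0ℤ) ≡ c * δ (w ⊝ u)
  term with Vec.≡-dec ℤ._≟_ u w | Vec.≡-dec ℤ._≟_ 0ᴺ (w ⊝ u)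
  ... | yes refl | no ≢ = contradiction (sym (⊝-self w)) ≢
  ... | no ≢ | yes eq = contradiction (⊝≡0⇒≡ w u eq) ≢
  ... | yes refl | yes _ = sym (ℤ.*-identityʳ c)
  ... | no _ | no _ = sym (ℤ.*-zeroʳ c)

coeff-*ᴸ : ∀ (p q : Laurent n) → coeff (p *ᴸ q) ≗ p ⊛ coeff q
coeff-*ᴸ p q w = trans (coeff-⊛ (p *ᴸ q) w) (trans (*ᴸ-⊛ p q δ w) (⊛-cong p (sym ∘ coeff-⊛ q) w))

coeff-+ᴸ : ∀ (p q : Laurent n) w → coeff (p +ᴸ q) w ≡ coeff p w + coeff q w
coeff-+ᴸ p q w = trans (coeff-⊛ (p +ᴸ q) w)
  (trans (+ᴸ-⊛ p q δ w) (sym (cong₂ _+_ (coeff-⊛ p w) (coeff-⊛ q w))))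

coeff-monomials-∉ : ∀ (us : List (N n)) {w} → w ∉ us → coeff (List.map (1ℤ ,_) us) w ≡ 0ℤ
coeff-monomials-∉ []       w∉ = refl
coeff-monomials-∉ (u ∷ us) {w} w∉ = cong₂ _+_
  (indicator-false (Vec.≡-dec ℤ._≟_ u w) (w∉ ∘ here ∘ sym)) (coeff-monomials-∉ us (w∉ ∘ there))

coeff-monomials-∈ : ∀ {us : List (N n)} {w} → Unique us → w ∈ us → coeff (List.map (1ℤ ,_) us) w ≡ 1ℤ
coeff-monomials-∈ {us = u ∷ us} {w} (u∉ ∷ _) (here refl) = cong₂ _+_
  (indicator-true (Vec.≡-dec ℤ._≟_ u w) refl) (coeff-monomials-∉ us (λ w∈ → All.lookup u∉ w∈ refl))
coeff-monomials-∈ {us = u ∷ us} {w} (u∉ ∷ us!) (there w∈) = cong₂ _+_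
  (indicator-false (Vec.≡-dec ℤ._≟_ u w) (All.lookup u∉ w∈)) (coeff-monomials-∈ us! w∈)

-- Equality of actions, a congruence that yields _≈_ by evaluation at δ.
infix 4 _≋_

record _≋_ (p q : Laurent n) : Set where
  constructor acting
  field act : ∀ S → p ⊛ S ≗ q ⊛ S
open _≋_

≋⇒≈ : {p q : Laurent n} → p ≋ q → p ≈ q
≋⇒≈ {p = p} {q} p≋q w = trans (coeff-⊛ p w) (trans (act p≋q δ w) (sym (coeff-⊛ q w)))

-- As lists of terms, `p *ᴸ q` and `q *ᴸ p` differ in general. As operators on series they agree,
-- and since `*ᴸ-⊛` turns products into compositions, the laws are inherited from those of
-- composition and from `⊛-comm`.
*ᴸ-1ᴸ-commutativeMonoid : ℕ → CommutativeMonoid 0ℓ 0ℓ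
*ᴸ-1ᴸ-commutativeMonoid n = record
  { Carrier = Laurent n ; _≈_ = _≋_ ; _∙_ = _*ᴸ_ ; ε = 1ᴸ
  ; isCommutativeMonoid = record
    { isMonoid = record
      { isSemigroup = record
        { isMagma = record
          { isEquivalence = record
            { refl  = acting λ _ _ → refl
            ; sym   = λ p≋q → acting λ S w → sym (act p≋q S w)
            ; trans = λ p≋q q≋r → acting λ S w → trans (act p≋q S w) (act q≋r S w) }
          ; ∙-cong = λ {p} {p′} {q} {q′} p≋p′ q≋q′ → acting λ S w → begin
              ((p *ᴸ q) ⊛ S) w    ≡⟨ *ᴸ-⊛ p q S w ⟩
              (p ⊛ (q ⊛ S)) w     ≡⟨ ⊛-cong p (act q≋q′ S) w ⟩
              (p ⊛ (q′ ⊛ S)) w    ≡⟨ act p≋p′ (q′ ⊛ S) w ⟩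
              (p′ ⊛ (q′ ⊛ S)) w   ≡⟨ *ᴸ-⊛ p′ q′ S w ⟨
              ((p′ *ᴸ q′) ⊛ S) w  ∎ }
        ; assoc = λ p q r → acting λ S w → begin
            (((p *ᴸ q) *ᴸ r) ⊛ S) w  ≡⟨ *ᴸ-⊛ (p *ᴸ q) r S w ⟩
            ((p *ᴸ q) ⊛ (r ⊛ S)) w   ≡⟨ *ᴸ-⊛ p q (r ⊛ S) w ⟩
            (p ⊛ (q ⊛ (r ⊛ S))) w    ≡⟨ ⊛-cong p (*ᴸ-⊛ q r S) w ⟨
            (p ⊛ ((q *ᴸ r) ⊛ S)) w   ≡⟨ *ᴸ-⊛ p (q *ᴸ r) S w ⟨
            ((p *ᴸ (q *ᴸ r)) ⊛ S) w  ∎ }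
      ; identity = (λ p → acting λ S w → trans (*ᴸ-⊛ 1ᴸ p S w) (1ᴸ-⊛ (p ⊛ S) w))
                 , (λ p → acting λ S w → trans (*ᴸ-⊛ p 1ᴸ S w) (⊛-cong p (1ᴸ-⊛ S) w)) }
    ; comm = λ p q → acting λ S w →
        trans (*ᴸ-⊛ p q S w) (trans (⊛-comm p q S w) (sym (*ᴸ-⊛ q p S w))) } }

module _ {n : ℕ} where
  open CommutativeMonoid (*ᴸ-1ᴸ-commutativeMonoid n) public using ()
    renaming (refl to ≋-refl; sym to ≋-sym; trans to ≋-trans; ∙-cong to *ᴸ-cong; identityˡ to *ᴸ-identityˡ; identityʳ to *ᴸ-identityʳ)
  open Algebra.Properties.CommutativeSemigroup
    (CommutativeMonoid.commutativeSemigroup (*ᴸ-1ᴸ-commutativeMonoid n)) public using ()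
    renaming (interchange to *ᴸ-interchange)

-- Sums over all subsets and products over all indices

infix 10 [_]*_

[_]*_ : ∀ {P : Set} → Dec P → ℤ → ℤ
[ P? ]* x = if does P? then x else 0ℤ

[_]ᴸ_ : ∀ {P : Set} → Dec P → Laurent n → Laurent n
[ P? ]ᴸ p = if does P? then p else 1ᴸ

-- Recursion on the membership bits, instead of a fold over the list `subsets`, allows a sum to be
-- analysed by induction along a given subset.
Σₛ : (Subset s → ℤ) → ℤ
Σₛ {zero}  f = f []
Σₛ {suc s} f = Σₛ (f ∘ (outside ∷_)) + Σₛ (f ∘ (inside ∷_))

Πᵢ : (Fin s → Laurent n) → Laurent n
Πᵢ {zero}  f = 1ᴸ
Πᵢ {suc s} f = f zero *ᴸ Πᵢ (f ∘ suc)

Σₛ-cong : {f g : Subset s → ℤ} → f ≗ g → Σₛ f ≡ Σₛ g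
Σₛ-cong {zero}  f≗g = f≗g []
Σₛ-cong {suc s} f≗g = cong₂ _+_ (Σₛ-cong (f≗g ∘ (outside ∷_))) (Σₛ-cong (f≗g ∘ (inside ∷_)))

Σₛ-0 : Σₛ {s} (λ _ → 0ℤ) ≡ 0ℤ
Σₛ-0 {zero}  = refl
Σₛ-0 {suc s} = cong₂ _+_ (Σₛ-0 {s}) (Σₛ-0 {s})

Σₛ-≡0 : {f : Subset s → ℤ} → (∀ τ → f τ ≡ 0ℤ) → Σₛ f ≡ 0ℤ
Σₛ-≡0 {s} f≡0 = trans (Σₛ-cong f≡0) (Σₛ-0 {s})

+-interchange : ∀ a b c d → (a + b) + (c + d) ≡ (a + c) + (b + d)
+-interchange = solve-∀

Σₛ-+ : (f g : Subset s → ℤ) → Σₛ (λ τ → f τ + g τ) ≡ Σₛ f + Σₛ g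
Σₛ-+ {zero}  f g = refl
Σₛ-+ {suc s} f g = trans (cong₂ _+_ (Σₛ-+ (f ∘ (outside ∷_)) _) (Σₛ-+ (f ∘ (inside ∷_)) _))
  (+-interchange (Σₛ (f ∘ (outside ∷_))) _ _ _)

Σₛ-swap : ∀ {t} (f : Subset s → Subset t → ℤ) → Σₛ (λ τ → Σₛ (f τ)) ≡ Σₛ (λ ρ → Σₛ (λ τ → f τ ρ))
Σₛ-swap {t = zero}  f = refl
Σₛ-swap {t = suc t} f = trans (Σₛ-+ (λ τ → Σₛ (f τ ∘ (outside ∷_))) _)
  (cong₂ _+_ (Σₛ-swap (λ τ → f τ ∘ (outside ∷_))) (Σₛ-swap (λ τ → f τ ∘ (inside ∷_))))

Σₛ-singleton : ∀ (σ : Subset s) (f : Subset s → ℤ) → (∀ τ → τ ≢ σ → f τ ≡ 0ℤ) → Σₛ f ≡ f σ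
Σₛ-singleton []            f h = refl
Σₛ-singleton (outside ∷ σ) f h = trans
  (cong₂ _+_ (Σₛ-singleton σ _ λ τ τ≢σ → h _ (τ≢σ ∘ Vec.∷-injectiveʳ)) (Σₛ-≡0 λ τ → h (_ ∷ τ) λ ()))
  (ℤ.+-identityʳ _)
Σₛ-singleton (inside ∷ σ) f h = trans
  (cong₂ _+_ (Σₛ-≡0 λ τ → h (_ ∷ τ) λ ()) (Σₛ-singleton σ _ λ τ τ≢σ → h _ (τ≢σ ∘ Vec.∷-injectiveʳ)))
  (ℤ.+-identityˡ _)

⊛-Σₛ : ∀ (p : Laurent n) (S : Subset s → Series n) w → (p ⊛ λ u → Σₛ λ τ → S τ u) w ≡ Σₛ λ τ → (p ⊛ S τ) w
⊛-Σₛ {s = zero}  p S w = refl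
⊛-Σₛ {s = suc s} p S w = trans (⊛-+ p (λ u → Σₛ λ τ → S (outside ∷ τ) u) _ w)
  (cong₂ _+_ (⊛-Σₛ p (S ∘ (outside ∷_)) w) (⊛-Σₛ p (S ∘ (inside ∷_)) w))

∑-⊛ : ∀ {P : Pred (Subset s) 0ℓ} (P? : Decidable P) (f : Subset s → Laurent n) S w →
      (∑ P? f ⊛ S) w ≡ Σₛ (λ τ → [ P? τ ]* (f τ ⊛ S) w)
∑-⊛ {s} {n} P? f S w = trans (filtered (subsets s)) (all-subsets λ τ → [ P? τ ]* (f τ ⊛ S) w)
  where
  sum : ∀ {t} → (Subset t → ℤ) → List (Subset t) → ℤ
  sum g = List.foldr (λ τ x → g τ + x) 0ℤ
  filtered : ∀ τs → (List.foldr (λ τ p → f τ +ᴸ p) 0ᴸ (List.filter P? τs) ⊛ S) w ≡ sum (λ τ → [ P? τ ]* (f τ ⊛ S) w) τs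
  filtered []       = refl
  filtered (τ ∷ τs) with does (P? τ)
  ... | true  = trans (+ᴸ-⊛ (f τ) _ S w) (cong ((f τ ⊛ S) w +_) (filtered τs))
  ... | false = trans (filtered τs) (sym (ℤ.+-identityˡ _))
  sum-map : ∀ {t u} (g : Subset t → ℤ) (h : Subset u → Subset t) τs → sum g (List.map h τs) ≡ sum (g ∘ h) τs
  sum-map g h []       = refl
  sum-map g h (τ ∷ τs) = cong (g (h τ) +_) (sum-map g h τs)
  sum-++ : ∀ {t} (g : Subset t → ℤ) τs ρs → sum g (τs ++ ρs) ≡ sum g τs + sum g ρs
  sum-++ g []       ρs = sym (ℤ.+-identityˡ _)
  sum-++ g (τ ∷ τs) ρs = trans (cong (g τ +_) (sum-++ g τs ρs)) (sym (ℤ.+-assoc (g τ) (sum g τs) (sum g ρs)))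
  all-subsets : ∀ {t} (g : Subset t → ℤ) → sum g (subsets t) ≡ Σₛ g
  all-subsets {zero}  g = ℤ.+-identityʳ (g [])
  all-subsets {suc t} g = trans (sum-++ g (List.map (outside ∷_) (subsets t)) (List.map (inside ∷_) (subsets t)))
    (cong₂ _+_ (trans (sum-map g (outside ∷_) (subsets t)) (all-subsets (g ∘ (outside ∷_))))
               (trans (sum-map g (inside ∷_) (subsets t)) (all-subsets (g ∘ (inside ∷_)))))

∏-Πᵢ : ∀ {P : Pred (Fin s) 0ℓ} (P? : Decidable P) (f : Fin s → Laurent n) →
       ∏ P? f ≋ Πᵢ (λ i → [ P? i ]ᴸ f i)
∏-Πᵢ {s} {n} P? f = tabulated (λ i → i)
  where
  tabulated : ∀ {t} (g : Fin t → Fin s) →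
    List.foldr (λ i p → f i *ᴸ p) 1ᴸ (List.filter P? (List.tabulate g)) ≋ Πᵢ (λ i → [ P? (g i) ]ᴸ f (g i))
  tabulated {zero}  g = ≋-refl
  tabulated {suc t} g with does (P? (g zero))
  ... | true  = *ᴸ-cong (≋-refl {x = f (g zero)}) (tabulated (g ∘ suc))
  ... | false = ≋-trans (tabulated (g ∘ suc)) (≋-sym (*ᴸ-identityˡ (Πᵢ λ i → [ P? (g (suc i)) ]ᴸ f (g (suc i)))))

Πᵢ-cong : {f g : Fin s → Laurent n} → (∀ i → f i ≋ g i) → Πᵢ f ≋ Πᵢ g
Πᵢ-cong {zero}  f≋g = ≋-refl
Πᵢ-cong {suc s} f≋g = *ᴸ-cong (f≋g zero) (Πᵢ-cong (f≋g ∘ suc))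

Πᵢ-* : (f g : Fin s → Laurent n) → Πᵢ (λ i → f i *ᴸ g i) ≋ Πᵢ f *ᴸ Πᵢ g
Πᵢ-* {zero}  f g = ≋-sym (*ᴸ-identityˡ 1ᴸ)
Πᵢ-* {suc s} f g = ≋-trans (*ᴸ-cong (≋-refl {x = f zero *ᴸ g zero}) (Πᵢ-* (f ∘ suc) (g ∘ suc)))
  (*ᴸ-interchange (f zero) (g zero) (Πᵢ (f ∘ suc)) (Πᵢ (g ∘ suc)))

-- Reindexing along the bijection between the `γ` disjoint from `ρ` and the `τ` containing `ρ`, with
-- `τ` equal to `γ ∪ ρ`. At an index outside `ρ` the bits of `γ` and `τ` agree; at an index of `ρ`
-- only the inside half of the sum over `τ` and the outside half of the sum over `γ` survive.
Σₛ-⊇ : ∀ (ρ : Subset s) (f g : Subset s → ℤ) →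
       (∀ τ → ¬ ρ ⊆ τ → f τ ≡ 0ℤ) → (∀ γ → ¬ Empty (γ ∩ ρ) → g γ ≡ 0ℤ) →
       (∀ γ → Empty (γ ∩ ρ) → f (γ ∪ ρ) ≡ g γ) → Σₛ f ≡ Σₛ g
Σₛ-⊇ []            f g f≡0 g≡0 f≡g = f≡g [] λ ()
Σₛ-⊇ (outside ∷ ρ) f g f≡0 g≡0 f≡g = cong₂ _+_
  (Σₛ-⊇ ρ _ _ (λ τ ρ⊈τ → f≡0 _ (ρ⊈τ ∘ drop-∷-⊆)) (λ γ ≢∅ → g≡0 _ λ e → ≢∅ (drop-∷-Empty e))
    λ γ e → f≡g (outside ∷ γ) λ { (suc i , there h) → e (i , h) })
  (Σₛ-⊇ ρ _ _ (λ τ ρ⊈τ → f≡0 _ (ρ⊈τ ∘ drop-∷-⊆)) (λ γ ≢∅ → g≡0 _ λ e → ≢∅ (drop-∷-Empty e))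
    λ γ e → f≡g (inside ∷ γ) λ { (suc i , there h) → e (i , h) })
Σₛ-⊇ (inside ∷ ρ) f g f≡0 g≡0 f≡g = begin
  Σₛ (f ∘ (outside ∷_)) + Σₛ (f ∘ (inside ∷_))  ≡⟨ cong (_+ Σₛ (f ∘ (inside ∷_))) (Σₛ-≡0 λ τ → f≡0 (outside ∷ τ) λ ρ⊆τ → contradiction (ρ⊆τ here) λ ()) ⟩
  0ℤ + Σₛ (f ∘ (inside ∷_))                     ≡⟨ ℤ.+-comm 0ℤ (Σₛ (f ∘ (inside ∷_))) ⟩
  Σₛ (f ∘ (inside ∷_)) + 0ℤ                     ≡⟨ cong₂ _+_ same (sym (Σₛ-≡0 λ γ → g≡0 (inside ∷ γ) λ e → e (zero , here))) ⟩
  Σₛ (g ∘ (outside ∷_)) + Σₛ (g ∘ (inside ∷_))  ∎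
  where
  same = Σₛ-⊇ ρ (f ∘ (inside ∷_)) (g ∘ (outside ∷_))
    (λ τ ρ⊈τ → f≡0 _ (ρ⊈τ ∘ drop-∷-⊆)) (λ γ ≢∅ → g≡0 _ λ e → ≢∅ (drop-∷-Empty e))
    λ γ e → f≡g (outside ∷ γ) λ { (suc i , there h) → e (i , h) }

[]*-true : ∀ {P : Set} (P? : Dec P) x → P → [ P? ]* x ≡ x
[]*-true P? x p = cong (if_then x else 0ℤ) (dec-true P? p)

[]*-false : ∀ {P : Set} (P? : Dec P) x → ¬ P → [ P? ]* x ≡ 0ℤ
[]*-false P? x ¬p = cong (if_then x else 0ℤ) (dec-false P? ¬p)

[]*-≡0 : ∀ {P : Set} (P? : Dec P) {x} → (P → x ≡ 0ℤ) → [ P? ]* x ≡ 0ℤ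
[]*-≡0 (yes p) x≡0 = x≡0 p
[]*-≡0 (no _)  x≡0 = refl

[]*-cong : ∀ {P Q : Set} (P? : Dec P) (Q? : Dec Q) {x y} → (P → Q) → (Q → P) → (Q → x ≡ y) → [ P? ]* x ≡ [ Q? ]* y
[]*-cong P?      (yes q) P→Q Q→P x≡y = trans ([]*-true P? _ (Q→P q)) (x≡y q)
[]*-cong P?      (no ¬q) P→Q Q→P x≡y = []*-false P? _ (¬q ∘ P→Q)

[]*-Σₛ : ∀ {P : Set} (P? : Dec P) (f : Subset s → ℤ) → [ P? ]* Σₛ f ≡ Σₛ (λ ρ → [ P? ]* f ρ)
[]*-Σₛ {s} P? f with does P?
... | true  = refl
... | false = sym (Σₛ-0 {s})

⊛-[]* : ∀ {P : Set} (P? : Dec P) (p : Laurent n) S w → (p ⊛ λ u → [ P? ]* S u) w ≡ [ P? ]* (p ⊛ S) w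
⊛-[]* P? p S w with does P?
... | true  = refl
... | false = ⊛-0 p w

[]ᴸ-true : ∀ {P : Set} (P? : Dec P) (p : Laurent n) → P → [ P? ]ᴸ p ≡ p
[]ᴸ-true P? p h = cong (if_then p else 1ᴸ) (dec-true P? h)

[]ᴸ-false : ∀ {P : Set} (P? : Dec P) (p : Laurent n) → ¬ P → [ P? ]ᴸ p ≡ 1ᴸ
[]ᴸ-false P? p ¬h = cong (if_then p else 1ᴸ) (dec-false P? ¬h)

-- 1 - xᵘ is not a zero divisor

private
  multiple : ℕ → N n → N n
  multiple k u = Vec.map (ℤ.+ k *_) u

⊝-multiple : ∀ k (w u : N n) → w ⊝ multiple (suc k) u ≡ w ⊝ multiple k u ⊝ u
⊝-multiple k []      []      = refl
⊝-multiple k (x ∷ w) (y ∷ u) = cong₂ _∷_ (trans (cong (λ z → x - z * y) (ℤ.pos-+ 1 k)) (lem (ℤ.+ k) x y)) (⊝-multiple k w u)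
  where
  lem : ∀ k x y → x - (1ℤ + k) * y ≡ x - k * y - y
  lem = solve-∀

⊝-multiple-injective : ∀ (w u : N n) → u ≢ 0ᴺ → ∀ {k l} → w ⊝ multiple k u ≡ w ⊝ multiple l u → k ≡ l
⊝-multiple-injective []      []      u≢0 _ = contradiction refl u≢0
⊝-multiple-injective (x ∷ w) (y ∷ u) u≢0 {k} {l} eq with y ℤ.≟ 0ℤ
... | yes refl = ⊝-multiple-injective w u (u≢0 ∘ cong (0ℤ ∷_)) (Vec.∷-injectiveʳ eq)
... | no y≢0   = ℤ.+-injective (ℤ.*-cancelʳ-≡ (ℤ.+ k) (ℤ.+ l) y ⦃ ≢-nonZero y≢0 ⦄
  (ℤ.neg-injective (+-cancelˡ x _ _ (Vec.∷-injectiveˡ eq))))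
  where
  open Algebra.Properties.AbelianGroup ℤ.+-0-abelianGroup using () renaming (∙-cancelˡ to +-cancelˡ)

coeff≢0⇒∈ : ∀ (p : Laurent n) {w} → coeff p w ≢ 0ℤ → w ∈ List.map proj₂ p
coeff≢0⇒∈ []            h = contradiction refl h
coeff≢0⇒∈ ((c , u) ∷ p) {w} h with Vec.≡-dec ℤ._≟_ u w
... | yes refl = here refl
... | no _     = there (coeff≢0⇒∈ p (h ∘ trans (ℤ.+-identityˡ _)))

-- If (1 - xᵘ) p = 0, the coefficients of p are invariant under translation by u.
1-x^-regular : ∀ {u : N n} → u ≢ 0ᴺ → ∀ p → ¬ p ≈ 0ᴸ → ¬ 1-x^ u *ᴸ p ≈ 0ᴸ
1-x^-regular {u = u} u≢0 p p≉0 h = p≉0 λ w → decidable-stable (coeff p w ℤ.≟ 0ℤ) λ c≢0 →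
  -- A nonzero coefficient at `w` would place all the `w - k u`, distinct because `u ≠ 0`, in the
  -- finite list of exponents of `p`.
  finite (mk↣ (⊝-multiple-injective w u u≢0)) (List.map proj₂ p)
    λ k → coeff≢0⇒∈ p (c≢0 ∘ trans (translates w k))
  where
  periodic : ∀ w → coeff p w ≡ coeff p (w ⊝ u)
  periodic w = ℤ.i-j≡0⇒i≡j _ _ (trans (sym (1-x^-⊛ u (coeff p) w)) (trans (sym (coeff-*ᴸ (1-x^ u) p w)) (h w)))
  multiple-0 : ∀ {n} (w u : N n) → w ⊝ multiple 0 u ≡ w
  multiple-0 []      []      = refl
  multiple-0 (x ∷ w) (y ∷ u) = cong₂ _∷_ (lem x y) (multiple-0 w u)
    where
    lem : ∀ x y → x - 0ℤ * y ≡ x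
    lem = solve-∀
  translates : ∀ w k → coeff p w ≡ coeff p (w ⊝ multiple k u)
  translates w zero    = cong (coeff p) (sym (multiple-0 w u))
  translates w (suc k) = trans (translates w k) (trans (periodic _) (cong (coeff p) (sym (⊝-multiple k w u))))

∏-1-x^≉0 : ∀ {P : Pred (Fin s) 0ℓ} (P? : Decidable P) (u : Fin s → N n) → (∀ i → u i ≢ 0ᴺ) →
           ¬ ∏ P? (λ i → 1-x^ u i) ≈ 0ᴸ
∏-1-x^≉0 P? u u≢0 = product (List.filter P? (List.allFin _))
  where
  product : ∀ is → ¬ List.foldr (λ i p → 1-x^ u i *ᴸ p) 1ᴸ is ≈ 0ᴸ
  product []       = 1≉0
  product (i ∷ is) = 1-x^-regular (u≢0 i) (List.foldr (λ i p → 1-x^ u i *ᴸ p) 1ᴸ is) (product is)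

-- Integers inside ℚ and rational combinations of lattice vectors

open BoxPoints using (toℚᵘ-toℚ; toℚ-+; toℚ-cancel-≤)

toℚ-* : ∀ i j → toℚ i ℚ.* toℚ j ≡ toℚ (i ℤ.* j)
toℚ-* i j = ℚ.toℚᵘ-injective (ℚᵘ.≃-trans (ℚ.toℚᵘ-homo-* (toℚ i) (toℚ j))
  (ℚᵘ.≃-trans (ℚᵘ.*-cong (toℚᵘ-toℚ i) (toℚᵘ-toℚ j)) (ℚᵘ.≃-sym (toℚᵘ-toℚ (i ℤ.* j)))))

toℚ-injective : ∀ {i j} → toℚ i ≡ toℚ j → i ≡ j
toℚ-injective {i} {j} eq = ℤ.≤-antisym
  (toℚ-cancel-≤ i j (ℚ.≤-reflexive eq)) (toℚ-cancel-≤ j i (ℚ.≤-reflexive (sym eq)))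

toℚ-mono-≤ : ∀ {i j} → i ℤ.≤ j → toℚ i ≤ toℚ j
toℚ-mono-≤ {i} {j} i≤j = ℚ.toℚᵘ-cancel-≤ (ℚᵘ.≤-respʳ-≃ (ℚᵘ.≃-sym (toℚᵘ-toℚ j))
  (ℚᵘ.≤-respˡ-≃ (ℚᵘ.≃-sym (toℚᵘ-toℚ i)) (ℚᵘ.*≤* (ℤ.*-monoʳ-≤-nonNeg 1ℤ i≤j))))

↧*≡↥ : ∀ q → toℚ (↧ q) ℚ.* q ≡ toℚ (↥ q)
↧*≡↥ q@(ℚ.mkℚ a b-1 _) = ℚ.toℚᵘ-injective (ℚᵘ.≃-trans (ℚ.toℚᵘ-homo-* (toℚ (↧ q)) q)
  (ℚᵘ.≃-trans (ℚᵘ.*-cong (toℚᵘ-toℚ (↧ q)) ℚᵘ.≃-refl)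
  (ℚᵘ.≃-trans (ℚᵘ.*≡* eq) (ℚᵘ.≃-sym (toℚᵘ-toℚ a)))))
  where
  eq : ℤ.+ suc b-1 ℤ.* a ℤ.* 1ℤ ≡ a ℤ.* ℤ.+ (1 ℕ.* suc b-1)
  eq = trans (ℤ.*-identityʳ _) (trans (ℤ.*-comm (ℤ.+ suc b-1) a) (cong (λ m → a ℤ.* ℤ.+ suc m) (sym (ℕ.+-identityʳ b-1))))

embed-injective : ∀ {u w : N n} → embed u ≡ embed w → u ≡ w
embed-injective {u = []}    {[]}    _  = refl
embed-injective {u = x ∷ u} {y ∷ w} eq = cong₂ _∷_
  (toℚ-injective (Vec.∷-injectiveˡ eq)) (embed-injective (Vec.∷-injectiveʳ eq))

embed-axpy : ∀ z (v w : N n) → embed (axpy z v w) ≡ zipWith ℚ._+_ (map (toℚ z ℚ.*_) (embed v)) (embed w)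
embed-axpy z []      []      = refl
embed-axpy z (x ∷ v) (y ∷ w) = cong₂ _∷_
  (trans (sym (toℚ-+ (z ℤ.* x) y)) (cong (ℚ._+ toℚ y) (sym (toℚ-* z x)))) (embed-axpy z v w)

embed-0 : embed (0ᴺ {n}) ≡ replicate n 0ℚ
embed-0 {n} = Vec.map-replicate toℚ 0ℤ n

comb-toℚ : ∀ (c : Vec ℤ k) (vs : Vec (N n) k) → comb (map toℚ c) vs ≡ embed (combℤ c vs)
comb-toℚ []      []       = sym embed-0
comb-toℚ (z ∷ c) (v ∷ vs) = trans (cong (zipWith ℚ._+_ _) (comb-toℚ c vs)) (sym (embed-axpy z v (combℤ c vs)))

combine-0 : ∀ (v x : Nℚ n) → zipWith ℚ._+_ (map (0ℚ ℚ.*_) v) x ≡ x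
combine-0 []      []      = refl
combine-0 (y ∷ v) (x ∷ xs) = cong₂ _∷_ (trans (cong (ℚ._+ x) (ℚ.*-zeroˡ y)) (ℚ.+-identityˡ x)) (combine-0 v xs)

comb-0 : ∀ (vs : Vec (N n) k) → comb (replicate k 0ℚ) vs ≡ replicate n 0ℚ
comb-0 []       = refl
comb-0 (v ∷ vs) = trans (combine-0 (embed v) _) (comb-0 vs)

comb-∷0 : ∀ (a : Vec ℚ k) (v : N n) vs → comb (0ℚ ∷ a) (v ∷ vs) ≡ comb a vs
comb-∷0 a v vs = combine-0 (embed v) (comb a vs)

comb-scale : ∀ t (a : Vec ℚ k) (vs : Vec (N n) k) → comb (map (t ℚ.*_) a) vs ≡ map (t ℚ.*_) (comb a vs)
comb-scale {n = n} t []      []       = sym (trans (Vec.map-replicate (t ℚ.*_) 0ℚ n) (cong (replicate n) (ℚ.*-zeroʳ t)))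
comb-scale t (q ∷ a) (v ∷ vs) = trans (cong (zipWith ℚ._+_ _) (comb-scale t a vs)) (scale-combine (embed v) (comb a vs))
  where
  open +-*-Solver
  scale-combine : ∀ {n} (v x : Nℚ n) → zipWith ℚ._+_ (map (t ℚ.* q ℚ.*_) v) (map (t ℚ.*_) x) ≡
                                map (t ℚ.*_) (zipWith ℚ._+_ (map (q ℚ.*_) v) x)
  scale-combine []      []      = refl
  scale-combine (y ∷ v) (x ∷ xs) = cong₂ _∷_
    (solve 4 (λ t q y x → t :* q :* y :+ t :* x := t :* (q :* y :+ x)) refl t q y x) (scale-combine v xs)

comb-- : ∀ (a b : Vec ℚ k) (vs : Vec (N n) k) → comb (zipWith ℚ._-_ a b) vs ≡ zipWith ℚ._-_ (comb a vs) (comb b vs)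
comb-- []      []      []       = sym (Vec.zipWith-replicate ℚ._-_ 0ℚ 0ℚ)
comb-- (p ∷ a) (q ∷ b) (v ∷ vs) = trans (cong (zipWith ℚ._+_ _) (comb-- a b vs)) (combine-- (embed v) (comb a vs) (comb b vs))
  where
  open +-*-Solver
  combine-- : ∀ {n} (v x y : Nℚ n) → zipWith ℚ._+_ (map ((p ℚ.- q) ℚ.*_) v) (zipWith ℚ._-_ x y) ≡
    zipWith ℚ._-_ (zipWith ℚ._+_ (map (p ℚ.*_) v) x) (zipWith ℚ._+_ (map (q ℚ.*_) v) y)
  combine-- []      []       []       = refl
  combine-- (z ∷ v) (x ∷ xs) (y ∷ ys) = cong₂ _∷_
    (solve 5 (λ p q z x y → (p :- q) :* z :+ (x :- y) := (p :* z :+ x) :- (q :* z :+ y)) refl p q z x y)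
    (combine-- v xs ys)

comb-updateAt : ∀ (a : Vec ℚ k) (vs : Vec (N n) k) i t →
  comb (a [ i ]%= (ℚ._+ t)) vs ≡ zipWith ℚ._+_ (map (t ℚ.*_) (embed (lookup vs i))) (comb a vs)
comb-updateAt (q ∷ a) (v ∷ vs) zero t = combine-+ (embed v) (comb a vs)
  where
  open +-*-Solver
  combine-+ : ∀ {n} (v x : Nℚ n) → zipWith ℚ._+_ (map ((q ℚ.+ t) ℚ.*_) v) x ≡
    zipWith ℚ._+_ (map (t ℚ.*_) v) (zipWith ℚ._+_ (map (q ℚ.*_) v) x)
  combine-+ []      []       = refl
  combine-+ (y ∷ v) (x ∷ xs) = cong₂ _∷_
    (solve 4 (λ q t y x → (q :+ t) :* y :+ x := t :* y :+ (q :* y :+ x)) refl q t y x) (combine-+ v xs)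
comb-updateAt (q ∷ a) (v ∷ vs) (suc i) t = trans (cong (zipWith ℚ._+_ _) (comb-updateAt a vs i t))
  (+-exchange (map (q ℚ.*_) (embed v)) (map (t ℚ.*_) (embed (lookup vs i))) (comb a vs))
  where
  open +-*-Solver
  +-exchange : ∀ {n} (x y z : Nℚ n) → zipWith ℚ._+_ x (zipWith ℚ._+_ y z) ≡ zipWith ℚ._+_ y (zipWith ℚ._+_ x z)
  +-exchange []       []       []       = refl
  +-exchange (x ∷ xs) (y ∷ ys) (z ∷ zs) = cong₂ _∷_
    (solve 3 (λ x y z → x :+ (y :+ z) := y :+ (x :+ z)) refl x y z) (+-exchange xs ys zs)

comb-shift : ∀ (a : Vec ℚ k) (vs : Vec (N n) k) i z {w} → comb a vs ≡ embed w →
  comb (a [ i ]%= (ℚ._+ toℚ z)) vs ≡ embed (axpy z (lookup vs i) w)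
comb-shift a vs i z {w} eq = trans (comb-updateAt a vs i (toℚ z))
  (trans (cong (zipWith ℚ._+_ _) eq) (sym (embed-axpy z (lookup vs i) w)))

axpy-1 : ∀ (v w : N n) → axpy (ℤ.- 1ℤ) v w ≡ w ⊝ v
axpy-1 []      []      = refl
axpy-1 (x ∷ v) (y ∷ w) = cong₂ _∷_ (trans (ℤ.+-comm (ℤ.- 1ℤ ℤ.* x) y) (cong (λ u → y ℤ.+ u) (ℤ.-1*i≡-i x))) (axpy-1 v w)

axpy1-⊝ : ∀ (v w : N n) → axpy 1ℤ v (w ⊝ v) ≡ w
axpy1-⊝ []      []      = refl
axpy1-⊝ (x ∷ v) (y ∷ w) = cong₂ _∷_ (lem x y) (axpy1-⊝ v w)
  where
  open import Data.Integer.Tactic.RingSolver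
  lem : ∀ x y → 1ℤ ℤ.* x ℤ.+ (y ℤ.- x) ≡ y
  lem = solve-∀

-- The box of a unimodular cone contains no lattice point

clear-denominators : ∀ (a : Vec ℚ k) → ∃[ d ] ℤ.Positive d × ∃[ c ] map toℚ c ≡ map (toℚ d ℚ.*_) a
clear-denominators []      = 1ℤ , _ , [] , refl
clear-denominators (q ∷ a) with clear-denominators a
... | d , d>0 , c , eq = ↧ q ℤ.* d , positive d d>0 , ↥ q ℤ.* d ∷ map (↧ q ℤ.*_) c ,
  subst (λ D → map toℚ (↥ q ℤ.* d ∷ map (↧ q ℤ.*_) c) ≡ map (D ℚ.*_) (q ∷ a)) (toℚ-* (↧ q) d)
  (cong₂ _∷_
    (trans (sym (toℚ-* (↥ q) d)) (trans (cong (ℚ._* toℚ d) (sym (↧*≡↥ q)))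
      (solve 3 (λ x q y → x :* q :* y := x :* y :* q) refl (toℚ (↧ q)) q (toℚ d))))
    (scaled c a eq))
  where
  open +-*-Solver
  positive : ∀ d → ℤ.Positive d → ℤ.Positive (↧ q ℤ.* d)
  positive (ℤ.+ suc d) _ = _
  scaled : ∀ {k} (c : Vec ℤ k) a → map toℚ c ≡ map (toℚ d ℚ.*_) a →
    map toℚ (map (↧ q ℤ.*_) c) ≡ map (toℚ (↧ q) ℚ.* toℚ d ℚ.*_) a
  scaled []      []      _  = refl
  scaled (z ∷ c) (p ∷ a) eq = cong₂ _∷_
    (trans (sym (toℚ-* (↧ q) z)) (trans (cong (toℚ (↧ q) ℚ.*_) (Vec.∷-injectiveˡ eq))
      (sym (ℚ.*-assoc (toℚ (↧ q)) (toℚ d) p))))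
    (scaled c a (Vec.∷-injectiveʳ eq))

combℤ-++-0 : ∀ {m} (c : Vec ℤ k) (vs : Vec (N n) k) (ws : Vec (N n) m) → combℤ (c Vec.++ replicate m 0ℤ) (vs Vec.++ ws) ≡ combℤ c vs
combℤ-++-0 []      []       ws = Unimodularity.comb-0 ws
combℤ-++-0 (z ∷ c) (v ∷ vs) ws = cong (axpy z v) (combℤ-++-0 c vs ws)

toℚ-not-in-unit-interval : ∀ z → ¬ (0ℚ < toℚ z × toℚ z < 1ℚ)
toℚ-not-in-unit-interval z (0<z , z<1) with z ℤ.≤? 0ℤ
... | yes z≤0 = ℚ.<-irrefl refl (ℚ.<-≤-trans 0<z (toℚ-mono-≤ z≤0))
... | no  z≰0 = ℚ.<-irrefl refl (ℚ.<-≤-trans z<1 (toℚ-mono-≤ (ℤ.i<j⇒suc[i]≤j (ℤ.≰⇒> z≰0))))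

toℚ-*-cancelˡ : ∀ d → ℤ.Positive d → ∀ p q → toℚ d ℚ.* p ≡ toℚ d ℚ.* q → p ≡ q
toℚ-*-cancelˡ d d>0 p q eq = ℚ.≤-antisym
  (ℚ.*-cancelˡ-≤-pos (toℚ d) (ℚ.≤-reflexive eq)) (ℚ.*-cancelˡ-≤-pos (toℚ d) (ℚ.≤-reflexive (sym eq)))
  where
  instance
    toℚ-d>0 : ℚ.Positive (toℚ d)
    toℚ-d>0 = ℚ.positive (ℚ.≰⇒> λ d≤0 → ℤ.<⇒≱ (ℤ.positive⁻¹ d ⦃ d>0 ⦄) (toℚ-cancel-≤ d 0ℤ d≤0))

embed-scale : ∀ d (x : N n) → map (toℚ d ℚ.*_) (embed x) ≡ embed (map (d ℤ.*_) x)
embed-scale d []      = refl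
embed-scale d (z ∷ x) = cong₂ _∷_ (toℚ-* d z) (embed-scale d x)

combℤ-cleared : ∀ (vs : Vec (N n) k) x d c {a} → map toℚ c ≡ map (toℚ d ℚ.*_) a → comb a vs ≡ embed x →
                combℤ c vs ≡ map (d ℤ.*_) x
combℤ-cleared vs x d c {a} c≡da comb≡x = embed-injective (begin
  embed (combℤ c vs)               ≡⟨ comb-toℚ c vs ⟨
  comb (map toℚ c) vs              ≡⟨ cong (λ b → comb b vs) c≡da ⟩
  comb (map (toℚ d ℚ.*_) a) vs     ≡⟨ comb-scale (toℚ d) a vs ⟩
  map (toℚ d ℚ.*_) (comb a vs)     ≡⟨ cong (map (toℚ d ℚ.*_)) comb≡x ⟩
  map (toℚ d ℚ.*_) (embed x)       ≡⟨ embed-scale d x ⟩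
  embed (map (d ℤ.*_) x)           ∎)

basis-injective : ∀ {b : Vec (N n) k} → IsBasis b → ∀ {c e} → combℤ c b ≡ combℤ e b → c ≡ e
basis-injective {b = b} basis {c} {e} eq = let (_ , _ , unique) = basis (combℤ e b) in
  trans (sym (unique eq)) (unique refl)

-- Let v₁, … , vₖ, w₁, … be a basis and x = ∑ aᵢ vᵢ a lattice point.  Clearing the
-- denominators of a and comparing with the integral coordinates of x shows that
-- each aᵢ is an integer.
integral-coordinate : ∀ (vs : Vec (N n) (suc k)) → PartOfBasis vs → ∀ x a → comb a vs ≡ embed x →
                      ∃[ z ] Vec.head a ≡ toℚ z
integral-coordinate vs (m , ws , basis) x a@(a₀ ∷ _) comb≡x = go (clear-denominators a) (basis x)
  where
  go : (∃[ d ] ℤ.Positive d × ∃[ c ] map toℚ c ≡ map (toℚ d ℚ.*_) a) → ∃! _≡_ (λ e → combℤ e (vs Vec.++ ws) ≡ x) →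
       ∃[ z ] a₀ ≡ toℚ z
  go (d , d>0 , c@(c₀ ∷ _) , c≡da) (e@(e₀ ∷ _) , e≡x , _) = e₀ , toℚ-*-cancelˡ d d>0 a₀ (toℚ e₀)
    (trans (sym (Vec.∷-injectiveˡ c≡da)) (trans (cong toℚ (Vec.∷-injectiveˡ c≡de)) (sym (toℚ-* d e₀))))
    where
    -- Both sides are integral coordinates of `d x` in the full basis: one from the cleared
    -- coefficients padded with zeros at the `ws`, the other from scaling the coordinates `e` of
    -- `x`.
    c≡de : c Vec.++ replicate m 0ℤ ≡ map (d ℤ.*_) e
    c≡de = basis-injective basis (trans (combℤ-++-0 c vs ws) (trans (combℤ-cleared vs x d c c≡da comb≡x)
      (sym (trans (Unimodularity.comb-scale d e (vs Vec.++ ws)) (cong (map (d ℤ.*_)) e≡x)))))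

-- A single integral coordinate already contradicts lying strictly between 0 and 1. At least one
-- generator is required, since the box of none is the origin.
Box-unimodular : ∀ (vs : Vec (N n) (suc k)) → PartOfBasis vs → ∀ x → ¬ Box vs x
Box-unimodular vs unimodular x (a@(_ ∷ _) , 0<a<1 ∷ _ , comb≡x) =
  let (z , a₀≡z) = integral-coordinate vs unimodular x a comb≡x in
  toℚ-not-in-unit-interval z (subst (λ q → 0ℚ < q × q < 1ℚ) a₀≡z 0<a<1)

-- Points with prescribed conditions on their coordinates

-- Padding with zeros to length `s` avoids vectors whose length depends on the cone, so that one
-- vector can be regarded in several cones at once.
Supported : Subset s → Vec ℚ s → Set
Supported τ a = ∀ j → j ∉ₛ τ → lookup a j ≡ 0ℚ

record On (P : ℚ → Set) (τ : Subset s) (a : Vec ℚ s) : Set where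
  constructor on
  field at : ∀ j → if lookup τ j then P (lookup a j) else lookup a j ≡ 0ℚ
open On

∉⇒outside : ∀ {τ : Subset s} {j} → j ∉ₛ τ → lookup τ j ≡ outside
∉⇒outside {τ = τ} {j} j∉τ with lookup τ j in eq
... | inside  = contradiction (Vec.lookup⇒[]= j τ eq) j∉τ
... | outside = refl

On⇒Supported : ∀ {P} {τ : Subset s} {a} → On P τ a → Supported τ a
On⇒Supported {τ = τ} {a} h j j∉τ with lookup τ j | ∉⇒outside {τ = τ} j∉τ | at h j
... | _ | refl | aⱼ≡0 = aⱼ≡0

On-∈ : ∀ {P} {τ : Subset s} {a} → On P τ a → ∀ {j} → j ∈ₛ τ → P (lookup a j)
On-∈ {τ = τ} h {j} j∈τ with lookup τ j | Vec.[]=⇒lookup j∈τ | at h j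
... | _ | refl | p = p

On-map : ∀ {P Q : ℚ → Set} → (∀ {q} → P q → Q q) → {τ : Subset s} {a : Vec ℚ s} → On P τ a → On Q τ a
On-map {P = P} {Q} P⇒Q {τ} {a} h = on go
  where
  go : ∀ j → if lookup τ j then Q (lookup a j) else lookup a j ≡ 0ℚ
  go j with lookup τ j | at h j
  ... | inside  | p   = P⇒Q p
  ... | outside | q≡0 = q≡0

expand : (τ : Subset s) → Vec ℚ ∣ τ ∣ₛ → Vec ℚ s
expand []            []      = []
expand (inside  ∷ τ) (q ∷ a) = q ∷ expand τ a
expand (outside ∷ τ) a       = 0ℚ ∷ expand τ a

expand-0 : (τ : Subset s) → expand τ (replicate ∣ τ ∣ₛ 0ℚ) ≡ replicate s 0ℚ
expand-0 []            = refl
expand-0 (inside  ∷ τ) = cong (0ℚ ∷_) (expand-0 τ)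
expand-0 (outside ∷ τ) = cong (0ℚ ∷_) (expand-0 τ)

comb-expand : ∀ (τ : Subset s) a (vs : Vec (N n) s) → comb (expand τ a) vs ≡ comb a (select τ vs)
comb-expand []            []      []       = refl
comb-expand (inside  ∷ τ) (q ∷ a) (v ∷ vs) = cong (zipWith ℚ._+_ _) (comb-expand τ a vs)
comb-expand (outside ∷ τ) a       (v ∷ vs) = trans (comb-∷0 (expand τ a) v vs) (comb-expand τ a vs)

expand-select : ∀ (τ : Subset s) a → Supported τ a → expand τ (select τ a) ≡ a
expand-select []            []      _    = refl
expand-select (inside  ∷ τ) (q ∷ a) supp = cong (q ∷_) (expand-select τ a λ j j∉τ → supp (suc j) λ { (there h) → j∉τ h })
expand-select (outside ∷ τ) (q ∷ a) supp = cong₂ _∷_ (sym (supp zero λ ())) (expand-select τ a λ j j∉τ → supp (suc j) λ { (there h) → j∉τ h })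

comb-select : ∀ (τ : Subset s) a (vs : Vec (N n) s) → Supported τ a → comb (select τ a) (select τ vs) ≡ comb a vs
comb-select τ a vs supp = trans (sym (comb-expand τ (select τ a) vs)) (cong (λ b → comb b vs) (expand-select τ a supp))

On-expand : ∀ {P} (τ : Subset s) {a} → VAll.All P a → On P τ (expand τ a)
On-expand {P = P} τ ps = on (go τ ps)
  where
  go : ∀ {s} (τ : Subset s) {a} → VAll.All P a → ∀ j → if lookup τ j then P (lookup (expand τ a) j) else lookup (expand τ a) j ≡ 0ℚ
  go (inside  ∷ τ) (p ∷ ps) zero    = p
  go (inside  ∷ τ) (p ∷ ps) (suc j) = go τ ps j
  go (outside ∷ τ) ps       zero    = refl
  go (outside ∷ τ) ps       (suc j) = go τ ps j

On-select : ∀ {P} (τ : Subset s) {a} → On P τ a → VAll.All P (select τ a)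
On-select []            {[]}    h = []
On-select (inside  ∷ τ) {q ∷ a} h = at h zero ∷ On-select τ (on (at h ∘ suc))
On-select (outside ∷ τ) {q ∷ a} h = On-select τ (on (at h ∘ suc))

-- The difference of `a` and `b` is again supported in `τ`, so restricting it to `τ` loses nothing,
-- and independence of the generators of this one cone makes it zero.
coordinates-unique : ∀ {τ : Subset s} {vs : Vec (N n) s} → LinearlyIndependent (select τ vs) →
  ∀ {a b} → Supported τ a → Supported τ b → comb a vs ≡ comb b vs → a ≡ b
coordinates-unique {s = s} {τ = τ} {vs} indep {a} {b} supp-a supp-b eq = minus-0 a b (begin
  a-b                               ≡⟨ expand-select τ a-b supp ⟨
  expand τ (select τ a-b)           ≡⟨ cong (expand τ) (indep (select τ a-b) select≡0) ⟩
  expand τ (replicate _ 0ℚ)         ≡⟨ expand-0 τ ⟩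
  replicate s 0ℚ                    ∎)
  where
  a-b = zipWith ℚ._-_ a b
  supp : Supported τ a-b
  supp j j∉τ = trans (Vec.lookup-zipWith ℚ._-_ j a b) (cong₂ ℚ._-_ (supp-a j j∉τ) (supp-b j j∉τ))
  minus-self : ∀ {n} (x : Nℚ n) → zipWith ℚ._-_ x x ≡ replicate n 0ℚ
  minus-self []      = refl
  minus-self (q ∷ x) = cong₂ _∷_ (ℚ.+-inverseʳ q) (minus-self x)
  select≡0 : comb (select τ a-b) (select τ vs) ≡ replicate _ 0ℚ
  select≡0 = trans (comb-select τ a-b vs supp) (trans (comb-- a b vs)
    (trans (cong (λ x → zipWith ℚ._-_ x (comb b vs)) eq) (minus-self (comb b vs))))
  minus-0 : ∀ {k} (a b : Vec ℚ k) → zipWith ℚ._-_ a b ≡ replicate k 0ℚ → a ≡ b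
  minus-0 []      []      _  = refl
  minus-0 (p ∷ a) (q ∷ b) eq = cong₂ _∷_
    (trans (solve 2 (λ p q → p := (p :- q) :+ q) refl p q) (trans (cong (ℚ._+ q) (Vec.∷-injectiveˡ eq)) (ℚ.+-identityˡ q)))
    (minus-0 a b (Vec.∷-injectiveʳ eq))
    where open +-*-Solver

-- Conditions on single coordinates and the series they cut out

q-1≡0⇒q≡1 : ∀ {q} → q ℚ.- 1ℚ ≡ 0ℚ → q ≡ 1ℚ
q-1≡0⇒q≡1 {q} eq = trans (solve 1 (λ q → q := (q :- con 1ℚ) :+ con 1ℚ) refl q) (cong (ℚ._+ 1ℚ) eq)
  where open +-*-Solver

0<q⇒0<q+1 : ∀ {q} → 0ℚ < q → 0ℚ < q ℚ.+ 1ℚ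
0<q⇒0<q+1 {q} 0<q = ℚ.<-trans 0<q (FourierMotzkin.<-+1 q)

q≡0⇒0<q+1 : ∀ {q} → q ≡ 0ℚ → 0ℚ < q ℚ.+ 1ℚ
q≡0⇒0<q+1 refl = ℚ.positive⁻¹ 1ℚ

-- Using `positive` on a cone and `vanishing` elsewhere describes its relative interior;
-- `fractional` in place of `positive` describes its box. The half-open interval (0, 1] gets no
-- constructor: it is split into `fractional` and a translate by the generator of `vanishing`.
data Condition : Set where
  vanishing positive fractional : Condition

Fits : Condition → ℚ → Set
Fits vanishing q = q ≡ 0ℚ
Fits positive q = 0ℚ < q
Fits fractional q = 0ℚ < q × q < 1ℚ

only : Condition → Bool → Condition
only c b = if b then c else vanishing

infix 5 _realises_

record Realises (vs : Vec (N n) s) (K : Vec Condition s) (w : N n) (a : Vec ℚ s) : Set where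
  constructor _realises_
  field
    fits   : ∀ j → Fits (lookup K j) (lookup a j)
    comb≡w : comb a vs ≡ embed w

Realised : Vec (N n) s → Vec Condition s → N n → Set
Realised vs K w = ∃ (Realises vs K w)

module Decide where
  open FourierMotzkin

  -- A triple stands for an inequality in one unknown: strictness, slope and constant term. The
  -- equation `q ≡ 0ℚ` is written as two weak inequalities, so that Fourier-Motzkin elimination
  -- applies to every condition.
  constraints : Condition → List (Bool × ℚ × ℚ)
  constraints vanishing = (false , 1ℚ , 0ℚ) ∷ (false , ℚ.- 1ℚ , 0ℚ) ∷ []
  constraints positive = (true , 1ℚ , 0ℚ) ∷ []
  constraints fractional = (true , 1ℚ , 0ℚ) ∷ (true , ℚ.- 1ℚ , 1ℚ) ∷ []

  1*q+0 : ∀ q → 1ℚ ℚ.* q ℚ.+ 0ℚ ≡ q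
  1*q+0 q = trans (ℚ.+-identityʳ _) (ℚ.*-identityˡ q)

  -1*q+r : ∀ q r → (ℚ.- 1ℚ) ℚ.* q ℚ.+ r ≡ r ℚ.- q
  -1*q+r = solve 2 (λ q r → (:- con 1ℚ) :* q :+ r := r :- q) refl
    where open +-*-Solver

  Fits⇒Sat : ∀ c {q} → Fits c q → All (Sat₁ q) (constraints c)
  Fits⇒Sat vanishing {q} refl = ℚ.≤-refl ∷ ℚ.≤-refl ∷ []
  Fits⇒Sat positive {q} 0<q = subst (0ℚ <_) (sym (1*q+0 q)) 0<q ∷ []
  Fits⇒Sat fractional {q} (0<q , q<1) = subst (0ℚ <_) (sym (1*q+0 q)) 0<q
    ∷ subst (0ℚ <_) (sym (-1*q+r q 1ℚ)) (p≤q⇒0≤q-p true q<1) ∷ []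

  Sat⇒Fits : ∀ c {q} → All (Sat₁ q) (constraints c) → Fits c q
  Sat⇒Fits vanishing {q} (0≤q ∷ 0≤-q ∷ []) = ℚ.≤-antisym
    (0≤q-p⇒p≤q false (subst (0ℚ ≤_) (-1*q+r q 0ℚ) 0≤-q)) (subst (0ℚ ≤_) (1*q+0 q) 0≤q)
  Sat⇒Fits positive {q} (0<q ∷ []) = subst (0ℚ <_) (1*q+0 q) 0<q
  Sat⇒Fits fractional {q} (0<q ∷ 0<1-q ∷ []) = subst (0ℚ <_) (1*q+0 q) 0<q
    , 0≤q-p⇒p≤q true (subst (0ℚ <_) (-1*q+r q 1ℚ) 0<1-q)

  system : Vec Condition k → List (Constraint k)
  system []      = []
  system (c ∷ K) = List.map first (constraints c) ++ List.map weaken (system K)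

  system⁺ : ∀ (K : Vec Condition k) a → (∀ j → Fits (lookup K j) (lookup a j)) → All (Sat a) (system K)
  system⁺ []      []      _ = []
  system⁺ (c ∷ K) (q ∷ a) h = All.++⁺
    (All.map⁺ (All.map (λ {(t , d , b)} → subst (0ℚ ≤[ t ]_) (sym (first-ev d b q a))) (Fits⇒Sat c (h zero))))
    (All.map⁺ (All.map (λ {(t , d , b)} → subst (0ℚ ≤[ t ]_) (sym (weaken-ev d b q a))) (system⁺ K a (h ∘ suc))))

  system⁻ : ∀ (K : Vec Condition k) a → All (Sat a) (system K) → ∀ j → Fits (lookup K j) (lookup a j)
  system⁻ (c ∷ K) (q ∷ a) h zero    = Sat⇒Fits c (All.map (λ {(t , d , b)} → subst (0ℚ ≤[ t ]_) (first-ev d b q a))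
    (All.map⁻ (All.++⁻ˡ (List.map first (constraints c)) h)))
  system⁻ (c ∷ K) (q ∷ a) h (suc j) = system⁻ K a (All.map (λ {(t , d , b)} → subst (0ℚ ≤[ t ]_) (weaken-ev d b q a))
    (All.map⁻ (All.++⁻ʳ (List.map first (constraints c)) h))) j

  -- Only the decided proposition matters from here on; opacity keeps the elimination procedure from
  -- being unfolded.
  abstract
    realised? : ∀ (vs : Vec (N n) s) K w → Dec (Realised vs K w)
    realised? vs K w = Dec.map′
      (λ (a , h) → a , system⁻ K a (All.++⁻ˡ (system K) h) realises rows⁻ a vs (embed w) (All.++⁻ʳ (system K) h))
      (λ (a , (p realises q)) → a , All.++⁺ (system⁺ K a p) (rows⁺ a vs (embed w) q))
      (solvable? (system K ++ rows vs (embed w)))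

open Decide using (realised?)

Φ : Vec (N n) s → Vec Condition s → Series n
Φ vs K w = indicator (realised? vs K w)

-- This forces every vector realising `K` to be supported in `τ`, which makes its coordinates unique
-- when `τ` is simplicial.
_⊑_ : Vec Condition s → Subset s → Set
K ⊑ τ = ∀ j → j ∉ₛ τ → lookup K j ≡ vanishing

only-⊑ : ∀ c (τ : Subset s) → map (only c) τ ⊑ τ
only-⊑ c τ j j∉τ = trans (Vec.lookup-map j (only c) τ) (cong (only c) (∉⇒outside j∉τ))

Fits-only⇒On : ∀ c (τ : Subset s) {a} → (∀ j → Fits (lookup (map (only c) τ) j) (lookup a j)) → On (Fits c) τ a
Fits-only⇒On c τ {a} h = on go
  where
  go : ∀ j → if lookup τ j then Fits c (lookup a j) else lookup a j ≡ 0ℚ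
  go j with lookup τ j | lookup (map (only c) τ) j | Vec.lookup-map j (only c) τ | h j
  ... | inside  | _ | refl | p = p
  ... | outside | _ | refl | p = p

On⇒Fits-only : ∀ c (τ : Subset s) {a} → On (Fits c) τ a → ∀ j → Fits (lookup (map (only c) τ) j) (lookup a j)
On⇒Fits-only c τ h j with lookup τ j | lookup (map (only c) τ) j | Vec.lookup-map j (only c) τ | at h j
... | inside  | _ | refl | p = p
... | outside | _ | refl | p = p

-- The effect of one factor 1 - x^vᵢ on one coordinate

module _ {τ : Subset s} {vs : Vec (N n) s} (indep : LinearlyIndependent (select τ vs)) where

  Realises⇒Supported : ∀ {K w a} → K ⊑ τ → Realises vs K w a → Supported τ a
  Realises⇒Supported {a = a} K⊑τ (fits realises _) j j∉τ = subst (λ c → Fits c (lookup a j)) (K⊑τ j j∉τ) (fits j)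

  -- By uniqueness of coordinates in `τ`, one vector that represents `w` and violates the condition
  -- at `j` rules out all others.
  ¬Fits⇒¬Realised : ∀ {K w a} → K ⊑ τ → Supported τ a → comb a vs ≡ embed w →
                    ∀ j → ¬ Fits (lookup K j) (lookup a j) → ¬ Realised vs K w
  ¬Fits⇒¬Realised {K} {a = a} K⊑τ supp eq j ¬fits (b , r@(fits realises eq′)) = ¬fits
    (subst (λ a → Fits (lookup K j) (lookup a j)) (sym a≡b) (fits j))
    where
    a≡b : a ≡ b
    a≡b = coordinates-unique {τ = τ} {vs} indep supp (Realises⇒Supported K⊑τ r) (trans eq (sym eq′))

  module _ {i : Fin s} (i∈τ : i ∈ₛ τ) {K : Vec Condition s} (K⊑τ : K ⊑ τ) where

    update-⊑ : ∀ c → (K [ i ]≔ c) ⊑ τ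
    update-⊑ c j j∉τ = trans (Vec.lookup∘update′ (λ { refl → j∉τ i∈τ }) K c) (K⊑τ j j∉τ)

    Fits-update : ∀ {c c′ a} (f : ℚ → ℚ) → (∀ j → Fits (lookup (K [ i ]≔ c) j) (lookup a j)) →
      Fits c′ (f (lookup a i)) → ∀ j → Fits (lookup (K [ i ]≔ c′) j) (lookup (a [ i ]%= f) j)
    Fits-update {c} {c′} {a} f fits fit j with j ≟ᶠ i
    ... | yes refl = subst₂ Fits (sym (Vec.lookup∘update i K c′)) (sym (Vec.lookup∘updateAt i a)) fit
    ... | no j≢i   = subst₂ Fits (trans (Vec.lookup∘update′ j≢i K c) (sym (Vec.lookup∘update′ j≢i K c′)))
      (sym (Vec.lookup∘updateAt′ j i j≢i a)) (fits j)

    Realised-update : ∀ {c c′ w a} → Realises vs (K [ i ]≔ c) w a → Fits c′ (lookup a i) → Realised vs (K [ i ]≔ c′) w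
    Realised-update {a = a} (fits realises eq) fit = a [ i ]%= (λ q → q) , Fits-update {a = a} (λ q → q) fits fit
      realises trans (cong (λ b → comb b vs) (Vec.updateAt-id i a)) eq

    Realised-shift : ∀ {c c′ w a} z → Realises vs (K [ i ]≔ c) w a → Fits c′ (lookup a i ℚ.+ toℚ z) →
      Realised vs (K [ i ]≔ c′) (axpy z (lookup vs i) w)
    Realised-shift {a = a} z (fits realises eq) fit = a [ i ]%= (ℚ._+ toℚ z) , Fits-update {a = a} (ℚ._+ toℚ z) fits fit realises comb-shift a vs i z eq

    Realises-at : ∀ {c w a} → Realises vs (K [ i ]≔ c) w a → Fits c (lookup a i)
    Realises-at {c} (fits realises _) = subst (λ d → Fits d _) (Vec.lookup∘update i K c) (fits i)

    ¬Realised-update : ∀ {c c′ w a} → Realises vs (K [ i ]≔ c) w a → ¬ Fits c′ (lookup a i) → ¬ Realised vs (K [ i ]≔ c′) w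
    ¬Realised-update {c} {c′} {a = a} r@(_ realises eq) ¬fit = ¬Fits⇒¬Realised {a = a} (update-⊑ c′) (Realises⇒Supported (update-⊑ c) r) eq i
      (¬fit ∘ subst (λ d → Fits d _) (Vec.lookup∘update i K c′))

    ¬Realised-shift : ∀ {c c′ w a} z → Realises vs (K [ i ]≔ c) w a → ¬ Fits c′ (lookup a i ℚ.+ toℚ z) →
      ¬ Realised vs (K [ i ]≔ c′) (axpy z (lookup vs i) w)
    ¬Realised-shift {c} {c′} {a = a} z r@(_ realises eq) ¬fit = ¬Fits⇒¬Realised {a = a [ i ]%= (ℚ._+ toℚ z)} (update-⊑ c′) supp (comb-shift a vs i z eq) i
      (¬fit ∘ subst₂ Fits (Vec.lookup∘update i K c′) (Vec.lookup∘updateAt i {ℚ._+ toℚ z} a))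
      where
      supp : Supported τ (a [ i ]%= (ℚ._+ toℚ z))
      supp j j∉τ = trans (Vec.lookup∘updateAt′ j i (λ { refl → j∉τ i∈τ }) a) (Realises⇒Supported (update-⊑ c) r j j∉τ)

    open FourierMotzkin using (0≤q-p⇒p≤q; p≤q⇒0≤q-p)
    private
      v = lookup vs i
      unshift : ∀ {c} w → Realised vs (K [ i ]≔ c) (axpy 1ℤ v (w ⊝ v)) → Realised vs (K [ i ]≔ c) w
      unshift w = subst (Realised vs _) (axpy1-⊝ v w)
      shift : ∀ {c} w → Realised vs (K [ i ]≔ c) (axpy (ℤ.- 1ℤ) v w) → Realised vs (K [ i ]≔ c) (w ⊝ v)
      shift w = subst (Realised vs _) (axpy-1 v w)
      shift⁻¹ : ∀ {c} w → Realised vs (K [ i ]≔ c) (w ⊝ v) → Realised vs (K [ i ]≔ c) (axpy (ℤ.- 1ℤ) v w)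
      shift⁻¹ w = subst (Realised vs _) (sym (axpy-1 v w))

    -- If `w` has i-th coordinate `q`, then `w ⊝ v` has `q - 1` there and the same other
    -- coordinates. The left side counts `0 < q` minus `1 < q`, the right side counts `0 < q < 1`
    -- plus `q = 1`; both are the indicator of `0 < q ≤ 1`.
    1-x^-⊛-Φ : ∀ w → (1-x^ v ⊛ Φ vs (K [ i ]≔ positive)) w ≡ Φ vs (K [ i ]≔ fractional) w ℤ.+ (x^ v ⊛ Φ vs (K [ i ]≔ vanishing)) w
    1-x^-⊛-Φ w = trans (1-x^-⊛ v (Φ vs (K [ i ]≔ positive)) w)
      (trans split (cong (λ z → Φ vs (K [ i ]≔ fractional) w ℤ.+ z) (sym (x^-⊛ v (Φ vs (K [ i ]≔ vanishing)) w))))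
      where
      yes! : ∀ {c u} → Realised vs (K [ i ]≔ c) u → Φ vs (K [ i ]≔ c) u ≡ 1ℤ
      yes! = indicator-true (realised? vs _ _)
      no! : ∀ {c u} → ¬ Realised vs (K [ i ]≔ c) u → Φ vs (K [ i ]≔ c) u ≡ 0ℤ
      no! = indicator-false (realised? vs _ _)
      Split : ℤ → ℤ → ℤ → ℤ → Set
      Split p p′ f z = p ℤ.- p′ ≡ f ℤ.+ z
      values : ∀ {p p′ f z} → Φ vs (K [ i ]≔ positive) w ≡ p → Φ vs (K [ i ]≔ positive) (w ⊝ v) ≡ p′ →
               Φ vs (K [ i ]≔ fractional) w ≡ f → Φ vs (K [ i ]≔ vanishing) (w ⊝ v) ≡ z → Split p p′ f z →
               Split (Φ vs (K [ i ]≔ positive) w) (Φ vs (K [ i ]≔ positive) (w ⊝ v))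
                     (Φ vs (K [ i ]≔ fractional) w) (Φ vs (K [ i ]≔ vanishing) (w ⊝ v))
      values refl refl refl refl h = h
      split : Split (Φ vs (K [ i ]≔ positive) w) (Φ vs (K [ i ]≔ positive) (w ⊝ v))
                    (Φ vs (K [ i ]≔ fractional) w) (Φ vs (K [ i ]≔ vanishing) (w ⊝ v))
      split = cases (realised? vs (K [ i ]≔ positive) w)
        where
        cases : Dec (Realised vs (K [ i ]≔ positive) w) → Split (Φ vs (K [ i ]≔ positive) w) (Φ vs (K [ i ]≔ positive) (w ⊝ v))
                    (Φ vs (K [ i ]≔ fractional) w) (Φ vs (K [ i ]≔ vanishing) (w ⊝ v))
        -- All four values are 0: a fractional coordinate of `w` is positive, and a positive or zero
        -- coordinate of `w ⊝ v` becomes positive after adding 1, so each alternative would realise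
        -- `w`.
        cases (no ¬r) = values (no! ¬r)
          (no! λ (a , r) → ¬r (unshift w (Realised-shift 1ℤ r (0<q⇒0<q+1 (Realises-at r)))))
          (no! λ (a , r) → ¬r (Realised-update r (proj₁ (Realises-at r))))
          (no! λ (a , r) → ¬r (unshift w (Realised-shift 1ℤ r (q≡0⇒0<q+1 (Realises-at r)))))
          refl
        cases (yes (a , r)) with ℚ.<-cmp (lookup a i) 1ℚ
        ... | tri< a<1 a≢1 a≯1 = values (yes! (a , r))
          (no! (¬Realised-shift (ℤ.- 1ℤ) r (a≯1 ∘ 0≤q-p⇒p≤q true) ∘ shift⁻¹ w)) (yes! (Realised-update r (Realises-at r , a<1)))
          (no! (¬Realised-shift (ℤ.- 1ℤ) r (a≢1 ∘ q-1≡0⇒q≡1) ∘ shift⁻¹ w)) refl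
        ... | tri≈ a≮1 a≡1 a≯1 = values (yes! (a , r))
          (no! (¬Realised-shift (ℤ.- 1ℤ) r (a≯1 ∘ 0≤q-p⇒p≤q true) ∘ shift⁻¹ w)) (no! (¬Realised-update r (a≮1 ∘ proj₂)))
          (yes! (shift w (Realised-shift (ℤ.- 1ℤ) r (cong (ℚ._- 1ℚ) a≡1)))) refl
        ... | tri> a≮1 a≢1 a>1 = values (yes! (a , r))
          (yes! (shift w (Realised-shift (ℤ.- 1ℤ) r (p≤q⇒0≤q-p true a>1)))) (no! (¬Realised-update r (a≮1 ∘ proj₂)))
          (no! (¬Realised-shift (ℤ.- 1ℤ) r (a≢1 ∘ q-1≡0⇒q≡1) ∘ shift⁻¹ w)) refl

-- Expansion of ∏ (1 - x^vᵢ) ⊛ Φ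

-- The entry 0ᴸ makes termProduct u τ ρ vanish unless ρ ⊆ τ.
termFactor : Bool → Bool → N n → Laurent n
termFactor inside  inside  u = 1ᴸ
termFactor inside  outside u = x^ u
termFactor outside inside  u = 0ᴸ
termFactor outside outside u = 1-x^ u

-- For `ρ ⊆ τ` this is the product of `x^ u i` over `τ` minus `ρ`, times the product of `1-x^ u i`
-- over the complement of `τ`. The latter are the factors that the relative interior of `τ` does not
-- absorb.
termProduct : (Fin s → N n) → Subset s → Subset s → Laurent n
termProduct u τ ρ = Πᵢ λ i → termFactor (lookup τ i) (lookup ρ i) (u i)

-- The induction fixes the first entry of the condition vector, and `Φ` with a fixed entry is no
-- longer of the form `Φ`. The one-coordinate rule does survive this, so the statement concerns any
-- `Ψ` that obeys it.
expansion : ∀ (τ : Subset s) (u : Fin s → N n) (Ψ : Vec Condition s → Series n) →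
  (∀ {i} → i ∈ₛ τ → ∀ {K} → K ⊑ τ → ∀ w → (1-x^ u i ⊛ Ψ (K [ i ]≔ positive)) w ≡
    Ψ (K [ i ]≔ fractional) w ℤ.+ (x^ u i ⊛ Ψ (K [ i ]≔ vanishing)) w) →
  ∀ w → (Πᵢ (λ i → 1-x^ u i) ⊛ Ψ (map (only positive) τ)) w ≡
        Σₛ λ ρ → (termProduct u τ ρ ⊛ Ψ (map (only fractional) ρ)) w
expansion []            u Ψ h w = refl
expansion {s = suc s} {n} (outside ∷ τ) u Ψ h w = begin
  ((D *ᴸ P) ⊛ Ψ (vanishing ∷ map (only positive) τ)) w
    ≡⟨ *ᴸ-⊛ D P _ w ⟩
  (D ⊛ (P ⊛ Ψ (vanishing ∷ map (only positive) τ))) w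
    ≡⟨ ⊛-cong D (expansion τ (u ∘ suc) (Ψ ∘ (vanishing ∷_)) h′) w ⟩
  (D ⊛ (λ w → Σₛ λ ρ → (T ρ ⊛ Ψ (map (only fractional) (outside ∷ ρ))) w)) w
    ≡⟨ ⊛-Σₛ D (λ ρ → T ρ ⊛ Ψ (map (only fractional) (outside ∷ ρ))) w ⟩
  Σₛ (λ ρ → (D ⊛ (T ρ ⊛ Ψ (map (only fractional) (outside ∷ ρ)))) w)
    ≡⟨ Σₛ-cong (λ ρ → sym (*ᴸ-⊛ D (T ρ) _ w)) ⟩
  Σₛ (λ ρ → ((D *ᴸ T ρ) ⊛ Ψ (map (only fractional) (outside ∷ ρ))) w)
    ≡⟨ ℤ.+-identityʳ _ ⟨
  Σₛ (λ ρ → ((D *ᴸ T ρ) ⊛ Ψ (map (only fractional) (outside ∷ ρ))) w) ℤ.+ 0ℤ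
    -- Subsets `ρ` containing the first index contribute zero by computation, since their product
    -- starts with the empty list `0ᴸ`.
    ≡⟨ cong₂ ℤ._+_ (refl {x = Σₛ (λ ρ → ((D *ᴸ T ρ) ⊛ Ψ (map (only fractional) (outside ∷ ρ))) w)}) (sym (Σₛ-0 {s})) ⟩
  Σₛ (λ ρ → (termProduct u (outside ∷ τ) ρ ⊛ Ψ (map (only fractional) ρ)) w) ∎
  where
  D P : Laurent n
  D = 1-x^ u zero
  P = Πᵢ (λ i → 1-x^ u (suc i))
  T : Subset s → Laurent n
  T = termProduct (u ∘ suc) τ
  h′ : ∀ {i} → i ∈ₛ τ → ∀ {K} → K ⊑ τ → ∀ w → (1-x^ u (suc i) ⊛ Ψ (vanishing ∷ (K [ i ]≔ positive))) w ≡
    Ψ (vanishing ∷ (K [ i ]≔ fractional)) w ℤ.+ (x^ u (suc i) ⊛ Ψ (vanishing ∷ (K [ i ]≔ vanishing))) w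
  h′ i∈τ {K} K⊑τ = h (there i∈τ) {vanishing ∷ K} λ { zero _ → refl ; (suc j) j∉ → K⊑τ j (j∉ ∘ there) }
expansion {s = suc s} {n} (inside ∷ τ) u Ψ h w = begin
  ((D *ᴸ P) ⊛ Ψ (positive ∷ K)) w
    ≡⟨ *ᴸ-⊛ D P _ w ⟩
  (D ⊛ (P ⊛ Ψ (positive ∷ K))) w
    ≡⟨ ⊛-comm D P _ w ⟩
  (P ⊛ (D ⊛ Ψ (positive ∷ K))) w
    -- The first factor acts first, while its coordinate is the only one changed. Its two summands
    -- become the halves of the sum over `ρ`: `fractional` when the first index belongs to `ρ`, and
    -- `vanishing` with the factor `X` when it does not.
    ≡⟨ ⊛-cong P (h here {positive ∷ K} λ { zero j∉ → contradiction here j∉ ; (suc j) j∉ → only-⊑ positive τ j (j∉ ∘ there) }) w ⟩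
  (P ⊛ (λ w → Ψ (fractional ∷ K) w ℤ.+ (X ⊛ Ψ (vanishing ∷ K)) w)) w
    ≡⟨ ⊛-+ P (Ψ (fractional ∷ K)) (X ⊛ Ψ (vanishing ∷ K)) w ⟩
  (P ⊛ Ψ (fractional ∷ K)) w ℤ.+ (P ⊛ (X ⊛ Ψ (vanishing ∷ K))) w
    ≡⟨ cong₂ ℤ._+_ (expansion τ (u ∘ suc) (Ψ ∘ (fractional ∷_)) (h′ fractional) w) (⊛-comm P X _ w) ⟩
  Σₛ (λ ρ → (T ρ ⊛ Ψ (fractional ∷ F ρ)) w) ℤ.+ (X ⊛ (P ⊛ Ψ (vanishing ∷ K))) w
    ≡⟨ cong₂ ℤ._+_ (Σₛ-cong λ ρ → sym (trans (*ᴸ-⊛ 1ᴸ (T ρ) _ w) (1ᴸ-⊛ (T ρ ⊛ Ψ (fractional ∷ F ρ)) w)))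
         (trans (⊛-cong X (expansion τ (u ∘ suc) (Ψ ∘ (vanishing ∷_)) (h′ vanishing)) w)
           (trans (⊛-Σₛ X (λ ρ → T ρ ⊛ Ψ (vanishing ∷ F ρ)) w) (Σₛ-cong λ ρ → sym (*ᴸ-⊛ X (T ρ) _ w)))) ⟩
  Σₛ (λ ρ → ((1ᴸ *ᴸ T ρ) ⊛ Ψ (fractional ∷ F ρ)) w) ℤ.+ Σₛ (λ ρ → ((X *ᴸ T ρ) ⊛ Ψ (vanishing ∷ F ρ)) w)
    ≡⟨ ℤ.+-comm (Σₛ λ ρ → ((1ᴸ *ᴸ T ρ) ⊛ Ψ (fractional ∷ F ρ)) w) _ ⟩
  Σₛ (λ ρ → (termProduct u (inside ∷ τ) ρ ⊛ Ψ (map (only fractional) ρ)) w) ∎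
  where
  D P X : Laurent n
  D = 1-x^ u zero
  X = x^ u zero
  P = Πᵢ (λ i → 1-x^ u (suc i))
  T : Subset s → Laurent n
  T = termProduct (u ∘ suc) τ
  K : Vec Condition s
  K = map (only positive) τ
  F : Subset s → Vec Condition s
  F = map (only fractional)
  h′ : ∀ c {i} → i ∈ₛ τ → ∀ {K} → K ⊑ τ → ∀ w → (1-x^ u (suc i) ⊛ Ψ (c ∷ (K [ i ]≔ positive))) w ≡
    Ψ (c ∷ (K [ i ]≔ fractional)) w ℤ.+ (x^ u (suc i) ⊛ Ψ (c ∷ (K [ i ]≔ vanishing))) w
  h′ c i∈τ {K} K⊑τ = h (there i∈τ) {c ∷ K} λ { zero j∉ → contradiction here j∉ ; (suc j) j∉ → K⊑τ j (j∉ ∘ there) }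

termProduct-⊈ : ∀ (u : Fin s → N n) τ ρ → ¬ ρ ⊆ τ → ∀ S w → (termProduct u τ ρ ⊛ S) w ≡ 0ℤ
termProduct-⊈ u []            []            ρ⊈τ S w = contradiction (λ ()) ρ⊈τ
termProduct-⊈ u (outside ∷ τ) (inside ∷ ρ)  ρ⊈τ S w = refl
termProduct-⊈ u (outside ∷ τ) (outside ∷ ρ) ρ⊈τ S w = trans (*ᴸ-⊛ (1-x^ u zero) (termProduct (u ∘ suc) τ ρ) S w)
  (trans (⊛-cong (1-x^ u zero) (termProduct-⊈ (u ∘ suc) τ ρ (ρ⊈τ ∘ out⊆) S) w) (⊛-0 (1-x^ u zero) w))
termProduct-⊈ u (inside ∷ τ)  (outside ∷ ρ) ρ⊈τ S w = trans (*ᴸ-⊛ (x^ u zero) (termProduct (u ∘ suc) τ ρ) S w)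
  (trans (⊛-cong (x^ u zero) (termProduct-⊈ (u ∘ suc) τ ρ (ρ⊈τ ∘ out⊆) S) w) (⊛-0 (x^ u zero) w))
termProduct-⊈ u (inside ∷ τ)  (inside ∷ ρ)  ρ⊈τ S w = trans (*ᴸ-⊛ 1ᴸ (termProduct (u ∘ suc) τ ρ) S w)
  (trans (⊛-cong 1ᴸ (termProduct-⊈ (u ∘ suc) τ ρ (ρ⊈τ ∘ in⊆in) S) w) (⊛-0 {n = _} 1ᴸ w))

-- Box points, and the relative interiors of the cones

module _ (vs : Vec (N n) s) where

  Box⇒Realised : ∀ ρ {w} → Box (select ρ vs) w → Realised vs (map (only fractional) ρ) w
  Box⇒Realised ρ (b , 0<b<1 , eq) = expand ρ b , (On⇒Fits-only fractional ρ (On-expand ρ 0<b<1) realises trans (comb-expand ρ b vs) eq)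

  Realised⇒Box : ∀ ρ {w} → Realised vs (map (only fractional) ρ) w → Box (select ρ vs) w
  Realised⇒Box ρ (a , (fits realises eq)) = let h = Fits-only⇒On fractional ρ {a} fits in
    select ρ a , On-select ρ h , trans (comb-select ρ a vs (On⇒Supported h)) eq

  pos⇒On : ∀ τ {x} → pos (select τ vs) x → ∃[ a ] On (0ℚ ≤_) τ a × comb a vs ≡ x
  pos⇒On τ (b , 0≤b , eq) = expand τ b , On-expand τ 0≤b , trans (comb-expand τ b vs) eq

  On⇒pos : ∀ τ {x a} → On (0ℚ ≤_) τ a → comb a vs ≡ x → pos (select τ vs) x
  On⇒pos τ {a = a} h eq = select τ a , On-select τ h , trans (comb-select τ a vs (On⇒Supported h)) eq

  -- The box of the zero cone is the origin, so its polynomial is 1. This is why the terms for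
  -- `ρ = ⊥` carry no box factor in `HΔ`.
  Φ-⊥ : Φ vs (map (only fractional) ⊥) ≗ δ
  Φ-⊥ w = cases (Vec.≡-dec ℤ._≟_ 0ᴺ w)
    where
    δ-≡ : ∀ {z : ℤ} {u : N n} → indicator (Vec.≡-dec ℤ._≟_ 0ᴺ u) ≡ z → δ u ≡ z
    δ-≡ eq = trans (ℤ.+-identityʳ _) eq
    zero-coordinates : ∀ {a} → On (λ q → 0ℚ < q × q < 1ℚ) ⊥ a → comb a vs ≡ replicate n 0ℚ
    zero-coordinates {a} h = trans (cong (λ b → comb b vs) (Vec-ext a λ j → On⇒Supported h j ∉⊥)) (comb-0 vs)
      where
      Vec-ext : ∀ {k} (a : Vec ℚ k) → (∀ j → lookup a j ≡ 0ℚ) → a ≡ replicate k 0ℚ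
      Vec-ext []      _ = refl
      Vec-ext (q ∷ a) h = cong₂ _∷_ (h zero) (Vec-ext a (h ∘ suc))
    cases : Dec (0ᴺ ≡ w) → Φ vs (map (only fractional) ⊥) w ≡ δ w
    cases (yes 0≡w) = trans (indicator-true (realised? vs _ w) (replicate s 0ℚ ,
        ((λ j → subst₂ Fits (sym (trans (Vec.lookup-map j (only fractional) ⊥) (cong (only fractional) (Vec.lookup-replicate j outside))))
          (sym (Vec.lookup-replicate j 0ℚ)) refl) realises trans (comb-0 vs) (trans (sym embed-0) (cong embed 0≡w)))))
      (sym (δ-≡ {u = w} (indicator-true (Vec.≡-dec ℤ._≟_ 0ᴺ w) 0≡w)))
    cases (no 0≢w) = trans (indicator-false (realised? vs _ w) λ { (a , (fits realises eq)) →
        0≢w (embed-injective (trans embed-0 (trans (sym (zero-coordinates {a} (Fits-only⇒On fractional ⊥ fits))) eq))) })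
      (sym (δ-≡ {u = w} (indicator-false (Vec.≡-dec ℤ._≟_ 0ᴺ w) 0≢w)))

∣ρ∣≡0⇒ρ≡⊥ : ∀ (ρ : Subset s) → ∣ ρ ∣ₛ ≡ 0 → ρ ≡ ⊥
∣ρ∣≡0⇒ρ≡⊥ []            _  = refl
∣ρ∣≡0⇒ρ≡⊥ (outside ∷ ρ) eq = cong (outside ∷_) (∣ρ∣≡0⇒ρ≡⊥ ρ eq)

partOfBasis-empty : ∀ (vs : Vec (N n) k) → k ≡ 0 → PartOfBasis vs
partOfBasis-empty [] refl = Unimodularity.partOfBasis[] _

Box-unimodular-nonempty : ∀ (vs : Vec (N n) k) → k ≢ 0 → PartOfBasis vs → ∀ x → ¬ Box vs x
Box-unimodular-nonempty []         k≢0 = contradiction refl k≢0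
Box-unimodular-nonempty vs@(_ ∷ _) k≢0 = Box-unimodular vs

-- For nonnegative coefficients in a cone, this is the face whose relative interior contains the
-- point.
support : Vec ℚ s → Subset s
support = map (λ q → does (0ℚ ℚ.<? q))

On-support : ∀ {τ : Subset s} {a} → On (0ℚ ≤_) τ a → On (0ℚ <_) (support a) a
On-support {τ = τ} {a} h = on go
  where
  cases : ∀ j → (0<? : Dec (0ℚ < lookup a j)) → if does 0<? then 0ℚ < lookup a j else lookup a j ≡ 0ℚ
  cases j (yes 0<q) = 0<q
  cases j (no  0≮q) with lookup τ j | On.at h j
  ... | inside  | 0≤q = ℚ.≤-antisym (ℚ.≮⇒≥ 0≮q) 0≤q
  ... | outside | q≡0 = q≡0
  go : ∀ j → if lookup (support a) j then 0ℚ < lookup a j else lookup a j ≡ 0ℚ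
  go j = subst (λ b → if b then 0ℚ < lookup a j else lookup a j ≡ 0ℚ)
    (sym (Vec.lookup-map j (λ q → does (0ℚ ℚ.<? q)) a)) (cases j (0ℚ ℚ.<? lookup a j))

support-⊆ : ∀ {τ : Subset s} {a} → On (0ℚ ≤_) τ a → support a ⊆ τ
support-⊆ {τ = τ} {a} h {i} i∈ = decidable-stable (i ∈? τ) λ i∉τ →
  ℚ.<-irrefl (sym (On⇒Supported h i i∉τ)) (On-∈ (On-support h) i∈)

module _ (Δ : SimplicialFan n s) where

  open SimplicialFan Δ

  interior : Subset s → Series n
  interior τ = Φ v (map (only positive) τ)

  box : Subset s → Series n
  box ρ = Φ v (map (only fractional) ρ)

  -- The common point lies in the cone of `τ ∩ ρ`, which gives it coefficients supported there.
  -- Uniqueness inside `τ` identifies these with `a`, so an index where `a` is positive must lie in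
  -- `ρ`.
  interior-⊆ : ∀ {τ ρ a b} → τ ∈ cones → ρ ∈ cones → On (0ℚ <_) τ a → On (0ℚ <_) ρ b → comb a v ≡ comb b v → τ ⊆ ρ
  interior-⊆ {τ} {ρ} {a} {b} τ∈Δ ρ∈Δ h h′ a≡b {i} i∈τ = decidable-stable (i ∈? ρ) λ i∉ρ →
    ℚ.<-irrefl (sym (trans (cong (λ c → lookup c i) a≡c) (On⇒Supported on-c i (i∉ρ ∘ proj₂ ∘ x∈p∩q⁻ τ ρ)))) (On-∈ h i∈τ)
    where
    common = pos⇒On v (τ ∩ ρ) (intersection τ∈Δ ρ∈Δ (comb a v) (On⇒pos v τ (On-map ℚ.<⇒≤ h) refl) (On⇒pos v ρ (On-map ℚ.<⇒≤ h′) (sym a≡b)))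
    on-c = proj₁ (proj₂ common)
    a≡c : a ≡ proj₁ common
    a≡c = coordinates-unique {τ = τ} {v} (simplicial τ∈Δ) (On⇒Supported h)
      (λ j j∉τ → On⇒Supported on-c j (j∉τ ∘ proj₁ ∘ x∈p∩q⁻ τ ρ)) (sym (proj₂ (proj₂ common)))

  realised-interior : ∀ {τ w a} → On (0ℚ <_) τ a → comb a v ≡ embed w → Realised v (map (only positive) τ) w
  realised-interior {τ} {a = a} h eq = a , (On⇒Fits-only positive τ h realises eq)

  interior-realised : ∀ {τ w} → Realised v (map (only positive) τ) w → ∃[ a ] On (0ℚ <_) τ a × comb a v ≡ embed w
  interior-realised {τ} (a , (fits realises eq)) = a , Fits-only⇒On positive τ fits , eq

  -- At a point of σ the sum has exactly one nonzero term. The `support` of its coefficients in some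
  -- cone is a face, hence a cone with the point in its interior; any other such cone equals it by
  -- `interior-⊆` in both directions.
  latticePoints-Σ : ∀ {m} (σ : Vec (N n) m) → Δ Subdivides σ → ∀ w →
                    latticePoints σ w ≡ Σₛ λ τ → [ cone? τ ]* interior τ w
  latticePoints-Σ σ subdivides w = cases (pos? σ (embed w))
    where
    open Equivalence (subdivides (embed w)) using (to; from)
    interior-in : ∀ {τ} → τ ∈ cones → Realised v (map (only positive) τ) w → pos σ (embed w)
    interior-in {τ} τ∈Δ r = let (a , h , eq) = interior-realised {τ} r in
      from (τ , τ∈Δ , On⇒pos v τ (On-map ℚ.<⇒≤ h) eq)
    cases : (pos?σ : Dec (pos σ (embed w))) → indicator pos?σ ≡ Σₛ λ τ → [ cone? τ ]* interior τ w
    cases (no ∉σ) = sym (Σₛ-≡0 λ τ → []*-≡0 (cone? τ) λ τ∈Δ → indicator-false (realised? v _ w) (∉σ ∘ interior-in τ∈Δ))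
    cases (yes ∈σ) =
      let (τ₀ , τ₀∈Δ , in-τ₀) = to ∈σ
          (a , h , eq) = pos⇒On v τ₀ in-τ₀
          τ = support a
          h⁺ = On-support h
          τ∈Δ = face τ₀∈Δ (support-⊆ h)
          other : ∀ ρ → ρ ≢ τ → [ cone? ρ ]* interior ρ w ≡ 0ℤ
          other = λ ρ ρ≢τ → []*-≡0 (cone? ρ) λ ρ∈Δ → indicator-false (realised? v _ w) λ r →
            let (b , h′ , eq′) = interior-realised {ρ} r in
            ρ≢τ (⊆-antisym (interior-⊆ ρ∈Δ τ∈Δ h′ h⁺ (trans eq′ (sym eq))) (interior-⊆ τ∈Δ ρ∈Δ h⁺ h′ (trans eq (sym eq′))))
      in sym (trans (Σₛ-singleton τ _ other) (trans ([]*-true (cone? τ) _ τ∈Δ)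
           (indicator-true (realised? v _ w) (realised-interior {τ} h⁺ eq))))

  coeff-B : ∀ ρ → coeff (B Δ ρ) ≗ box ρ
  coeff-B ρ w = cases (Box? (gens ρ) w)
    where
    cases : Dec (Box (gens ρ) w) → coeff (B Δ ρ) w ≡ box ρ w
    cases (yes b) = trans (coeff-monomials-∈ (boxPoints-unique (gens ρ)) (boxPoints-complete (gens ρ) b))
      (sym (indicator-true (realised? v _ w) (Box⇒Realised v ρ b)))
    cases (no ¬b) = trans (coeff-monomials-∉ (boxPoints (gens ρ)) (¬b ∘ boxPoints-sound (gens ρ)))
      (sym (indicator-false (realised? v _ w) (¬b ∘ Realised⇒Box v ρ)))

  box-unimodular : ∀ {ρ} → ρ ≢ ⊥ → Unimodular ρ → ∀ w → box ρ w ≡ 0ℤ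
  box-unimodular {ρ} ρ≢⊥ unimodular w = indicator-false (realised? v _ w)
    (Box-unimodular-nonempty (gens ρ) (ρ≢⊥ ∘ ∣ρ∣≡0⇒ρ≡⊥ ρ) unimodular w ∘ Realised⇒Box v ρ)

  ⊥-unimodular : Unimodular ⊥
  ⊥-unimodular = partOfBasis-empty (gens ⊥) (∣⊥∣≡0 s)

  D X : Fin s → Laurent n
  D i = 1-x^ lookup v i
  X i = x^ lookup v i

  interior-expansion : ∀ {τ} → τ ∈ cones → ∀ w →
    (Πᵢ D ⊛ interior τ) w ≡ Σₛ λ ρ → (termProduct (lookup v) τ ρ ⊛ box ρ) w
  interior-expansion {τ} τ∈Δ = expansion τ (lookup v) (Φ v) λ i∈τ {K} K⊑τ →
    1-x^-⊛-Φ {τ = τ} {v} (simplicial τ∈Δ) i∈τ {K} K⊑τ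

  boxTerm : Subset s → N n → ℤ
  boxTerm ρ w = Σₛ λ τ → [ cone? τ ]* (termProduct (lookup v) τ ρ ⊛ box ρ) w

  product-⊛-latticePoints : ∀ {m} (σ : Vec (N n) m) → Δ Subdivides σ → ∀ w →
    (Πᵢ D ⊛ latticePoints σ) w ≡ Σₛ λ ρ → boxTerm ρ w
  product-⊛-latticePoints σ subdivides w = begin
    (Πᵢ D ⊛ latticePoints σ) w
      ≡⟨ ⊛-cong (Πᵢ D) (latticePoints-Σ σ subdivides) w ⟩
    (Πᵢ D ⊛ λ u → Σₛ λ τ → [ cone? τ ]* interior τ u) w
      ≡⟨ ⊛-Σₛ (Πᵢ D) (λ τ u → [ cone? τ ]* interior τ u) w ⟩
    Σₛ (λ τ → (Πᵢ D ⊛ λ u → [ cone? τ ]* interior τ u) w)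
      ≡⟨ Σₛ-cong (λ τ → trans (⊛-[]* (cone? τ) (Πᵢ D) (interior τ) w)
           (trans ([]*-cong (cone? τ) (cone? τ) (λ p → p) (λ p → p) (λ τ∈Δ → interior-expansion τ∈Δ w))
                  ([]*-Σₛ (cone? τ) (λ ρ → (termProduct (lookup v) τ ρ ⊛ box ρ) w)))) ⟩
    Σₛ (λ τ → Σₛ λ ρ → [ cone? τ ]* (termProduct (lookup v) τ ρ ⊛ box ρ) w)
      ≡⟨ Σₛ-swap (λ τ ρ → [ cone? τ ]* (termProduct (lookup v) τ ρ ⊛ box ρ) w) ⟩
    Σₛ (λ ρ → boxTerm ρ w) ∎

  -- Strict enlargement of a subset of a finite set must stop. The star is defined by maximal cones,
  -- so this is what lets an arbitrary cone containing `ρ` witness membership in it.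
  extends-to-maximal : ∀ {τ} → τ ∈ cones → ∃[ ρ ] Maximal ρ × τ ⊆ ρ
  extends-to-maximal {τ} = go τ (⊃-wellFounded τ)
    where
    go : ∀ τ → Acc _⊃_ τ → τ ∈ cones → ∃[ ρ ] Maximal ρ × τ ⊆ ρ
    go τ (acc rec) τ∈Δ with anySubset? (λ ρ → cone? ρ ×-dec τ ⊂? ρ)
    ... | yes (ρ , ρ∈Δ , τ⊂ρ) = let (μ , max , ρ⊆μ) = go ρ (rec τ⊂ρ) ρ∈Δ in μ , max , ρ⊆μ ∘ proj₁ τ⊂ρ
    ... | no none = τ , (τ∈Δ , λ ρ ρ∈Δ τ⊆ρ {i} i∈ρ → decidable-stable (i ∈? τ) λ i∉τ →
                          none (ρ , ρ∈Δ , (λ {j} → τ⊆ρ {j}) , i , i∈ρ , i∉τ)) , λ i∈τ → i∈τ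

-- Links and stars

module _ (Δ : SimplicialFan n s) where

  open SimplicialFan Δ

  rayOfStar : ∀ {ρ μ i} → μ ∈ cones → ρ ⊆ μ → i ∈ₛ μ → RayOfStar ρ i
  rayOfStar μ∈Δ ρ⊆μ i∈μ = let (ν , max , μ⊆ν) = extends-to-maximal Δ μ∈Δ in
    ν , max , (λ {j} j∈ρ → μ⊆ν (ρ⊆μ j∈ρ)) , μ⊆ν i∈μ

  link⇒star : ∀ {ρ i} → RayOfLink ρ i → RayOfStar ρ i
  link⇒star {ρ} (γ , (_ , _ , γ∪ρ∈Δ) , i∈γ) = rayOfStar γ∪ρ∈Δ (q⊆p∪q γ ρ) (p⊆p∪q ρ i∈γ)

  link⇒∉ : ∀ {ρ i} → RayOfLink ρ i → i ∉ₛ ρ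
  link⇒∉ (γ , (_ , disjoint , _) , i∈γ) i∈ρ = disjoint (_ , x∈p∩q⁺ (i∈γ , i∈ρ))

  -- The ray `⁅ i ⁆` itself is the witness: together with `ρ` it lies in the maximal cone `μ` and so
  -- spans a face of it.
  star⇒link : ∀ {ρ i} → i ∉ₛ ρ → RayOfStar ρ i → RayOfLink ρ i
  star⇒link {ρ} {i} i∉ρ (μ , (μ∈Δ , _) , ρ⊆μ , i∈μ) = ⁅ i ⁆ , (v-ray i , disjoint , face μ∈Δ ⊆μ) , x∈⁅x⁆ i
    where
    disjoint : Empty (⁅ i ⁆ ∩ ρ)
    disjoint (j , j∈) = let (j∈i , j∈ρ) = x∈p∩q⁻ ⁅ i ⁆ ρ j∈ in i∉ρ (subst (_∈ₛ ρ) (x∈⁅y⁆⇒x≡y i j∈i) j∈ρ)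
    ⊆μ : ⁅ i ⁆ ∪ ρ ⊆ μ
    ⊆μ {j} j∈ = [ (λ j∈i → subst (_∈ₛ μ) (sym (x∈⁅y⁆⇒x≡y i j∈i)) i∈μ) , ρ⊆μ ]′ (x∈p∪q⁻ ⁅ i ⁆ ρ j∈)

  linkFactor : Subset s → Subset s → Fin s → Laurent n
  linkFactor ρ γ i = ([ i ∈? γ ]ᴸ X Δ i *ᴸ [ rayOfLink? ρ i ×-dec ¬? (i ∈? γ) ]ᴸ D Δ i) *ᴸ [ ¬? (rayOfStar? ρ i) ]ᴸ D Δ i

  -- Each index is of exactly one of four kinds: in `ρ`, with factor 1; in `γ`, with a monomial; a
  -- ray of the link outside `γ`, with its factor from `Hlk`; or outside the star, with its factor
  -- from the last product. Membership in `ρ` or `γ` places an index in the star because `γ ∪ ρ` is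
  -- a cone.
  termFactor-link : ∀ {ρ γ} → InLink ρ γ → ∀ i →
    termFactor (lookup (γ ∪ ρ) i) (lookup ρ i) (lookup v i) ≋ linkFactor ρ γ i
  termFactor-link {ρ} {γ} inLink@(_ , disjoint , γ∪ρ∈Δ) i = cases (i ∈? ρ) (i ∈? γ) (rayOfLink? ρ i)
    where
    goal : ∀ {x y a b c} → lookup (γ ∪ ρ) i ≡ x → lookup ρ i ≡ y →
      [ i ∈? γ ]ᴸ X Δ i ≡ a → [ rayOfLink? ρ i ×-dec ¬? (i ∈? γ) ]ᴸ D Δ i ≡ b → [ ¬? (rayOfStar? ρ i) ]ᴸ D Δ i ≡ c →
      termFactor x y (lookup v i) ≋ (a *ᴸ b) *ᴸ c →
      termFactor (lookup (γ ∪ ρ) i) (lookup ρ i) (lookup v i) ≋ linkFactor ρ γ i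
    goal refl refl refl refl refl h = h
    cases : Dec (i ∈ₛ ρ) → Dec (i ∈ₛ γ) → Dec (RayOfLink ρ i) →
      termFactor (lookup (γ ∪ ρ) i) (lookup ρ i) (lookup v i) ≋ linkFactor ρ γ i
    cases (yes i∈ρ) _ _ = goal (Vec.[]=⇒lookup (q⊆p∪q γ ρ i∈ρ)) (Vec.[]=⇒lookup i∈ρ)
      ([]ᴸ-false (i ∈? γ) _ λ i∈γ → disjoint (i , x∈p∩q⁺ (i∈γ , i∈ρ)))
      ([]ᴸ-false (rayOfLink? ρ i ×-dec ¬? (i ∈? γ)) _ λ (ray , _) → link⇒∉ ray i∈ρ)
      ([]ᴸ-false (¬? (rayOfStar? ρ i)) _ λ ¬star → ¬star (rayOfStar γ∪ρ∈Δ (q⊆p∪q γ ρ) (q⊆p∪q γ ρ i∈ρ)))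
      (≋-sym (≋-trans (*ᴸ-identityʳ (1ᴸ *ᴸ 1ᴸ)) (*ᴸ-identityʳ 1ᴸ)))
    cases (no i∉ρ) (yes i∈γ) _ = goal (Vec.[]=⇒lookup (p⊆p∪q ρ i∈γ)) (∉⇒outside i∉ρ)
      ([]ᴸ-true (i ∈? γ) _ i∈γ)
      ([]ᴸ-false (rayOfLink? ρ i ×-dec ¬? (i ∈? γ)) _ λ (_ , i∉γ) → i∉γ i∈γ)
      ([]ᴸ-false (¬? (rayOfStar? ρ i)) _ λ ¬star → ¬star (rayOfStar γ∪ρ∈Δ (q⊆p∪q γ ρ) (p⊆p∪q ρ i∈γ)))
      (≋-sym (≋-trans (*ᴸ-identityʳ (X Δ i *ᴸ 1ᴸ)) (*ᴸ-identityʳ (X Δ i))))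
    cases (no i∉ρ) (no i∉γ) (yes ray) = goal (∉⇒outside i∉∪) (∉⇒outside i∉ρ)
      ([]ᴸ-false (i ∈? γ) _ i∉γ)
      ([]ᴸ-true (rayOfLink? ρ i ×-dec ¬? (i ∈? γ)) _ (ray , i∉γ))
      ([]ᴸ-false (¬? (rayOfStar? ρ i)) _ λ ¬star → ¬star (link⇒star ray))
      (≋-sym (≋-trans (*ᴸ-identityʳ (1ᴸ *ᴸ D Δ i)) (*ᴸ-identityˡ (D Δ i))))
      where
      i∉∪ : i ∉ₛ γ ∪ ρ
      i∉∪ = [ i∉γ , i∉ρ ]′ ∘ x∈p∪q⁻ γ ρ
    cases (no i∉ρ) (no i∉γ) (no ¬ray) = goal (∉⇒outside i∉∪) (∉⇒outside i∉ρ)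
      ([]ᴸ-false (i ∈? γ) _ i∉γ)
      ([]ᴸ-false (rayOfLink? ρ i ×-dec ¬? (i ∈? γ)) _ (¬ray ∘ proj₁))
      ([]ᴸ-true (¬? (rayOfStar? ρ i)) _ (¬ray ∘ star⇒link i∉ρ))
      (≋-sym (≋-trans (*ᴸ-cong (*ᴸ-identityˡ 1ᴸ) (≋-refl {x = D Δ i})) (*ᴸ-identityˡ (D Δ i))))
      where
      i∉∪ : i ∉ₛ γ ∪ ρ
      i∉∪ = [ i∉γ , i∉ρ ]′ ∘ x∈p∪q⁻ γ ρ

  ∏link ∏star : Subset s → Subset s → Laurent n
  ∏link ρ γ = ∏ (_∈? γ) (X Δ) *ᴸ ∏ (λ j → rayOfLink? ρ j ×-dec ¬? (j ∈? γ)) (D Δ)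
  ∏star ρ _ = ∏ (λ i → ¬? (rayOfStar? ρ i)) (D Δ)

  termProduct-link : ∀ {ρ γ} → InLink ρ γ → termProduct (lookup v) (γ ∪ ρ) ρ ≋ ∏link ρ γ *ᴸ ∏star ρ γ
  termProduct-link {ρ} {γ} inLink = ≋-trans (Πᵢ-cong (termFactor-link inLink))
    (≋-trans (Πᵢ-* (λ i → x i *ᴸ y i) z)
    (*ᴸ-cong (≋-trans (Πᵢ-* x y) (≋-sym (*ᴸ-cong (∏-Πᵢ (_∈? γ) (X Δ)) (∏-Πᵢ (λ j → rayOfLink? ρ j ×-dec ¬? (j ∈? γ)) (D Δ)))))
      (≋-sym (∏-Πᵢ (λ i → ¬? (rayOfStar? ρ i)) (D Δ)))))
    where
    x y z : Fin s → Laurent n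
    x i = [ i ∈? γ ]ᴸ X Δ i
    y i = [ rayOfLink? ρ i ×-dec ¬? (i ∈? γ) ]ᴸ D Δ i
    z i = [ ¬? (rayOfStar? ρ i) ]ᴸ D Δ i

  termProduct-⊥ : ∀ τ → termProduct (lookup v) τ ⊥ ≋ ∏ (_∈? τ) (X Δ) *ᴸ ∏ (λ j → ¬? (j ∈? τ)) (D Δ)
  termProduct-⊥ τ = ≋-trans (Πᵢ-cong λ i → factor i (i ∈? τ))
    (≋-trans (Πᵢ-* (λ i → [ i ∈? τ ]ᴸ X Δ i) (λ i → [ ¬? (i ∈? τ) ]ᴸ D Δ i))
      (≋-sym (*ᴸ-cong (∏-Πᵢ (_∈? τ) (X Δ)) (∏-Πᵢ (λ j → ¬? (j ∈? τ)) (D Δ)))))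
    where
    factor : ∀ i → (i∈τ? : Dec (i ∈ₛ τ)) → termFactor (lookup τ i) (lookup ⊥ i) (lookup v i) ≋ [ i∈τ? ]ᴸ X Δ i *ᴸ [ ¬? i∈τ? ]ᴸ D Δ i
    factor i (yes i∈τ) rewrite Vec.[]=⇒lookup i∈τ | Vec.lookup-replicate i outside = ≋-sym (*ᴸ-identityʳ (X Δ i))
    factor i (no i∉τ) rewrite ∉⇒outside i∉τ | Vec.lookup-replicate i outside = ≋-sym (*ᴸ-identityˡ (D Δ i))

  -- Evaluating the collected terms and assembling the identity

  boxTerm-⊥ : ∀ w → boxTerm Δ ⊥ w ≡ coeff (HΔ Δ) w
  boxTerm-⊥ w = begin
    Σₛ (λ τ → [ cone? τ ]* (termProduct (lookup v) τ ⊥ ⊛ box Δ ⊥) w)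
      ≡⟨ Σₛ-cong (λ τ → []*-cong (cone? τ) (cone? τ) (λ p → p) (λ p → p) λ _ →
           trans (⊛-cong (termProduct (lookup v) τ ⊥) (Φ-⊥ v) w) (_≋_.act (termProduct-⊥ τ) δ w)) ⟩
    Σₛ (λ τ → [ cone? τ ]* ((∏ (_∈? τ) (X Δ) *ᴸ ∏ (λ j → ¬? (j ∈? τ)) (D Δ)) ⊛ δ) w)
      ≡⟨ ∑-⊛ cone? (λ τ → ∏ (_∈? τ) (X Δ) *ᴸ ∏ (λ j → ¬? (j ∈? τ)) (D Δ)) δ w ⟨
    (HΔ Δ ⊛ δ) w
      ≡⟨ coeff-⊛ (HΔ Δ) w ⟨
    coeff (HΔ Δ) w ∎

  singularTerm : Subset s → Laurent n
  singularTerm ρ = B Δ ρ *ᴸ Hlk Δ ρ *ᴸ ∏ (λ i → ¬? (rayOfStar? ρ i)) (D Δ)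

  -- Only cones `τ` containing `ρ` contribute, and these are the `γ ∪ ρ` with `γ` in the link, `γ`
  -- being a face of `τ`. The box series and the product over the complement of the star do not
  -- depend on `γ`, so they leave the sum.
  boxTerm-link : ∀ {ρ} w → boxTerm Δ ρ w ≡ coeff (singularTerm ρ) w
  boxTerm-link {ρ} w = begin
    Σₛ (λ τ → [ cone? τ ]* (termProduct (lookup v) τ ρ ⊛ box Δ ρ) w)
      ≡⟨ Σₛ-⊇ ρ _ (λ γ → [ inLink? ρ γ ]* (∏link ρ γ ⊛ (E ⊛ box Δ ρ)) w)
           (λ τ ρ⊈τ → []*-≡0 (cone? τ) λ _ → termProduct-⊈ (lookup v) τ ρ ρ⊈τ (box Δ ρ) w)
           (λ γ meets → []*-false (inLink? ρ γ) _ λ (_ , disjoint , _) → meets disjoint)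
           (λ γ disjoint → []*-cong (cone? (γ ∪ ρ)) (inLink? ρ γ)
             (λ γ∪ρ∈Δ → face γ∪ρ∈Δ (p⊆p∪q ρ) , disjoint , γ∪ρ∈Δ)
             (λ (_ , _ , γ∪ρ∈Δ) → γ∪ρ∈Δ)
             (λ inLink → trans (_≋_.act (termProduct-link inLink) (box Δ ρ) w) (*ᴸ-⊛ (∏link ρ γ) E (box Δ ρ) w))) ⟩
    Σₛ (λ γ → [ inLink? ρ γ ]* (∏link ρ γ ⊛ (E ⊛ box Δ ρ)) w)
      ≡⟨ ∑-⊛ (inLink? ρ) (∏link ρ) (E ⊛ box Δ ρ) w ⟨
    (H ⊛ (E ⊛ box Δ ρ)) w
      -- Writing the box series as `B` acting on `δ` makes it one more operator, which can be
      -- commuted to the front.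
      ≡⟨ ⊛-cong H (⊛-cong E λ u → trans (sym (coeff-B Δ ρ u)) (coeff-⊛ (B Δ ρ) u)) w ⟩
    (H ⊛ (E ⊛ (B Δ ρ ⊛ δ))) w
      ≡⟨ ⊛-cong H (⊛-comm E (B Δ ρ) δ) w ⟩
    (H ⊛ (B Δ ρ ⊛ (E ⊛ δ))) w
      ≡⟨ ⊛-comm H (B Δ ρ) (E ⊛ δ) w ⟩
    (B Δ ρ ⊛ (H ⊛ (E ⊛ δ))) w
      ≡⟨ *ᴸ-⊛ (B Δ ρ) H (E ⊛ δ) w ⟨
    ((B Δ ρ *ᴸ H) ⊛ (E ⊛ δ)) w
      ≡⟨ *ᴸ-⊛ (B Δ ρ *ᴸ H) E δ w ⟨
    (singularTerm ρ ⊛ δ) w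
      ≡⟨ coeff-⊛ (singularTerm ρ) w ⟨
    coeff (singularTerm ρ) w ∎
    where
    E H : Laurent n
    E = ∏ (λ i → ¬? (rayOfStar? ρ i)) (D Δ)
    H = Hlk Δ ρ

  _≟ₛ_ : (ρ τ : Subset s) → Dec (ρ ≡ τ)
  _≟ₛ_ = Vec.≡-dec Bool._≟_

  -- Here `ρ` is any subset, not necessarily a cone. For a cone `τ` not containing `ρ` the
  -- `termProduct` acts as zero; if `τ` contains `ρ`, then `ρ` is a face, so being nonsingular makes
  -- it unimodular and its box series is zero.
  boxTerm-zero : ∀ {ρ} → ρ ≢ ⊥ → ¬ Singular ρ → ∀ w → boxTerm Δ ρ w ≡ 0ℤ
  boxTerm-zero {ρ} ρ≢⊥ ¬singular w = Σₛ-≡0 λ τ → []*-≡0 (cone? τ) λ τ∈Δ → cases τ τ∈Δ (ρ ⊆? τ)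
    where
    cases : ∀ τ → τ ∈ cones → Dec (ρ ⊆ τ) → (termProduct (lookup v) τ ρ ⊛ box Δ ρ) w ≡ 0ℤ
    cases τ τ∈Δ (no ρ⊈τ)  = termProduct-⊈ (lookup v) τ ρ ρ⊈τ (box Δ ρ) w
    cases τ τ∈Δ (yes ρ⊆τ) = trans (⊛-cong (termProduct (lookup v) τ ρ) (box-unimodular Δ ρ≢⊥ unimodular) w)
      (⊛-0 (termProduct (lookup v) τ ρ) w)
      where
      unimodular : Unimodular ρ
      unimodular = decidable-stable (partOfBasis? (gens ρ)) λ ¬unimodular → ¬singular (face τ∈Δ ρ⊆τ , ¬unimodular)

  -- The two brackets never apply together, because the zero cone is unimodular.
  boxTerm-split : ∀ ρ w → boxTerm Δ ρ w ≡ [ ρ ≟ₛ ⊥ ]* coeff (HΔ Δ) w ℤ.+ [ singular? ρ ]* coeff (singularTerm ρ) w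
  boxTerm-split ρ w = cases (ρ ≟ₛ ⊥) (singular? ρ)
    where
    cases : (ρ≡⊥? : Dec (ρ ≡ ⊥)) (sing? : Dec (Singular ρ)) →
      boxTerm Δ ρ w ≡ [ ρ≡⊥? ]* coeff (HΔ Δ) w ℤ.+ [ sing? ]* coeff (singularTerm ρ) w
    cases (yes refl)  (yes (_ , ¬uni)) = contradiction (⊥-unimodular Δ) ¬uni
    cases (yes refl)  (no _)           = trans (boxTerm-⊥ w) (sym (ℤ.+-identityʳ _))
    cases (no _)      (yes _)          = trans (boxTerm-link w) (sym (ℤ.+-identityˡ _))
    cases (no ρ≢⊥)    (no ¬singular)   = boxTerm-zero ρ≢⊥ ¬singular w

  rhs : Laurent n
  rhs = HΔ Δ +ᴸ ∑ singular? singularTerm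

  product-⊛-latticePoints≗rhs : ∀ {m} (σ : Vec (N n) m) → Δ Subdivides σ → ∏ U? (D Δ) ⊛ latticePoints σ ≗ coeff rhs
  product-⊛-latticePoints≗rhs σ subdivides w = begin
    (∏ U? (D Δ) ⊛ latticePoints σ) w
      ≡⟨ _≋_.act (∏-Πᵢ U? (D Δ)) (latticePoints σ) w ⟩
    (Πᵢ (D Δ) ⊛ latticePoints σ) w
      ≡⟨ product-⊛-latticePoints Δ σ subdivides w ⟩
    Σₛ (λ ρ → boxTerm Δ ρ w)
      ≡⟨ Σₛ-cong (λ ρ → boxTerm-split ρ w) ⟩
    Σₛ (λ ρ → [ ρ ≟ₛ ⊥ ]* coeff (HΔ Δ) w ℤ.+ [ singular? ρ ]* coeff (singularTerm ρ) w)
      ≡⟨ Σₛ-+ (λ ρ → [ ρ ≟ₛ ⊥ ]* coeff (HΔ Δ) w) _ ⟩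
    Σₛ (λ ρ → [ ρ ≟ₛ ⊥ ]* coeff (HΔ Δ) w) ℤ.+ Σₛ (λ ρ → [ singular? ρ ]* coeff (singularTerm ρ) w)
      ≡⟨ cong₂ ℤ._+_
           (trans (Σₛ-singleton ⊥ _ λ ρ ρ≢⊥ → []*-false (ρ ≟ₛ ⊥) _ ρ≢⊥) ([]*-true (⊥ ≟ₛ ⊥) _ refl))
           (trans (Σₛ-cong λ ρ → []*-cong (singular? ρ) (singular? ρ) (λ p → p) (λ p → p) λ _ → coeff-⊛ (singularTerm ρ) w)
             (trans (sym (∑-⊛ singular? singularTerm δ w)) (sym (coeff-⊛ (∑ singular? singularTerm) w)))) ⟩
    coeff (HΔ Δ) w ℤ.+ coeff (∑ singular? singularTerm) w
      ≡⟨ coeff-+ᴸ (HΔ Δ) (∑ singular? singularTerm) w ⟨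
    coeff rhs w ∎

  v≢0 : ∀ i → lookup v i ≢ 0ᴺ
  -- Primitivity is applied with the multiplier 0: writing `vᵢ` as 0 times a vector would force 0 to
  -- equal 1.
  v≢0 i vᵢ≡0 = contradiction (v-primitive i 0 0ᴺ (trans vᵢ≡0 (sym (Vec.map-replicate (0ℤ ℤ.*_) 0ℤ n)))) λ ()

theorem1p1 : ∀ {n m s : ℕ} (σ : Vec (N n) m) → StronglyConvex σ →
    (Δ : SimplicialFan n s) → Δ Subdivides σ →
    let open SimplicialFan Δ in
    (∃ λ G → G IsGeneratingFunctionOf σ) ×
    (∀ G → G IsGeneratingFunctionOf σ →
      ∏ U? (λ i → 1-x^ lookup v i) · G
        ≃ ι (HΔ Δ +ᴸ ∑ singular? (λ τ →
               B Δ τ *ᴸ Hlk Δ τ *ᴸ ∏ (λ i → ¬? (rayOfStar? τ i)) (λ i → 1-x^ lookup v i))))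
theorem1p1 {n} σ _ Δ subdivides = (R over P [ ∏-1-x^≉0 U? (lookup v) (v≢0 Δ) ] , P⊛σ) , identity
  where
  open SimplicialFan Δ
  P R : Laurent n
  P = ∏ U? (λ i → 1-x^ lookup v i)
  R = rhs Δ
  -- This one equation both shows that `R` over `P` is a generating function and gives the value of
  -- `P ⊛ latticePoints σ` from which `identity` treats every other one.
  P⊛σ : P ⊛ latticePoints σ ≗ coeff R
  P⊛σ = product-⊛-latticePoints≗rhs Δ σ subdivides
  identity : ∀ G → G IsGeneratingFunctionOf σ → P · G ≃ ι R
  identity (a over b [ _ ]) b⊛σ w = begin
    coeff ((P *ᴸ a) *ᴸ 1ᴸ) w          ≡⟨ ≋⇒≈ (*ᴸ-identityʳ (P *ᴸ a)) w ⟩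
    coeff (P *ᴸ a) w                  ≡⟨ coeff-*ᴸ P a w ⟩
    (P ⊛ coeff a) w                   ≡⟨ ⊛-cong P b⊛σ w ⟨
    (P ⊛ (b ⊛ latticePoints σ)) w     ≡⟨ ⊛-comm P b (latticePoints σ) w ⟩
    (b ⊛ (P ⊛ latticePoints σ)) w     ≡⟨ ⊛-cong b P⊛σ w ⟩
    (b ⊛ coeff R) w                   ≡⟨ coeff-*ᴸ b R w ⟨
    coeff (b *ᴸ R) w                  ≡⟨ ≋⇒≈ (CommutativeMonoid.comm (*ᴸ-1ᴸ-commutativeMonoid n) b R) w ⟩
    coeff (R *ᴸ b) w                  ∎
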